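{- Let $\Bbbk$ be a perfect field, let $K$ be an $n$-dimensional topological local field over $\Bbbk$, and let $\boldsymbol{\sigma}$ and $\boldsymbol{\sigma}'$ be two systems of liftings for $K$. (1) There is equality $\mathrm{E}_{\boldsymbol{\sigma}}(K) = \mathrm{E}_{\boldsymbol{\sigma}'}(K)$ of these subrings of $\operatorname{End}_{\Bbbk}(K)$. (2) For any $i = 1, \ldots, n$ and $j = 1, 2$ there is equality $\mathrm{E}_{\boldsymbol{\sigma}}(K)_{i,j} = \mathrm{E}_{\boldsymbol{\sigma}'}(K)_{i,j}$ of these ideals of $\mathrm{E}_{\boldsymbol{\sigma}}(K)$.
   Context: **Semi-topological (ST) rings and modules.** $\Bbbk$ is a perfect field with the discrete topology. A $\Bbbk$-linear topology on a $\Bbbk$-module is a module topology in which $0$ has a basis of open neighborhoods consisting of $\Bbbk$-submodules. A commutative ST $\Bbbk$-ring is a commutative $\Bbbk$-ring $A$ with a $\Bbbk$-linear topology such that for every $a \in A$ the map $A \to A$, $b \mapsto ab$, is continuous; homomorphisms of ST $\Bbbk$-rings are the continuous $\Bbbk$-ring homomorphisms. A ST $A$-module is an $A$-module $M$ with a $\Bbbk$-linear topology such that for every $a \in A$ and $m \in M$ the maps $M \to M$, $m' \mapsto a m'$, and $A \to M$, $a' \mapsto a' m$, are continuous. The fine $A$-module topology on an $A$-module is the finest $\Bbbk$-linear topology making it a ST $A$-module (it exists). **Laurent series.** For a commutative ST $\Bbbk$-ring $A$: give $A[t]/(t^{i+1})$ the fine $A$-module topology, $A[[t]] = \lim_{\leftarrow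 i} A[t]/(t^{i+1})$ the inverse limit topology, and $A((t)) = A[[t]][t^{ -1}]$ the fine $A[[t]]$-module topology. Recursively $A((t_1,\ldots,t_n)) := A((t_2,\ldots,t_n))((t_1))$. **Local fields.** An $n$-dimensional local field is a field $K$ with complete discrete valuation rings $\mathcal{O}_1(K),\ldots,\mathcal{O}_n(K)$ such that $K$ is the fraction field of $\mathcal{O}_1(K)$ and for $1\le i\le n-1$ the residue field of $\mathcal{O}_i(K)$ is the fraction field of $\mathcal{O}_{i+1}(K)$. Let $\boldsymbol{k}_i(K)$ be the residue field of $\mathcal{O}_i(K)$, and $\boldsymbol{k}_0(K):=K$. The ring of integers $\mathcal{O}(K) := \mathcal{O}_1(K)\times_{\boldsymbol{k}_1(K)}\mathcal{O}_2(K)\cdots\times_{\boldsymbol{k}_{n-1}(K)}\mathcal{O}_n(K)$ is a subring of $K$ ($\mathcal{O}(K)=K$ if $n=0$). For a finite field extension $\Bbbk'$ of $\Bbbk$ (discrete topology), the standard $n$-dimensional topological local field is $\Bbbk'((t_1,\ldots,t_n))$ with the iterated Laurent series topology (obtained from the discrete topology on $\Bbbk'$ by the recursion $\Bbbk'((t_1,\ldots,t_n)) = \Bbbk'((t_2,\ldots,t_n))((t_1))$, where $A((t))$ has the fine $A[[t]]$-module topology) and with $\mathcal{O}_i = \Bbbk'((t_{i+1},\ldots,t_n))[[t_i]]$. An $n$-dimensional topological local field (TLF) over $\Bbbk$ is an $n$-dimensional local field $K$ with a ring homomorphism $\Bbbk\to\mathcal{O}(K)$ such that $\Bbbk\to\boldsymbol{k}_n(K)$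 is finite, and a topology making $K$ a ST $\Bbbk$-ring, for which there exists a $\Bbbk$-ring isomorphism $\Bbbk'((t_1,\ldots,t_n)) \to K$, $\Bbbk' := \boldsymbol{k}_n(K)$, that is a homeomorphism and respects the valuation rings (it maps $\mathcal{O}_1$ onto $\mathcal{O}_1$, the induced map on residue fields maps $\mathcal{O}_2$ onto $\mathcal{O}_2$, etc.). Each $\mathcal{O}_i(K)\subset\boldsymbol{k}_{i-1}(K)$ has the subspace topology and each $\boldsymbol{k}_i(K)$ has the quotient topology from $\mathcal{O}_i(K)$; then $\boldsymbol{k}_i(K)$ is an $(n-i)$-dimensional TLF. **Systems of liftings.** A system of liftings for $K$ is a sequence $\boldsymbol{\sigma}=(\sigma_1,\ldots,\sigma_n)$, where each $\sigma_i:\boldsymbol{k}_i(K)\to\mathcal{O}_i(K)$ is a continuous $\Bbbk$-ring homomorphism splitting the canonical surjection $\mathcal{O}_i(K)\to\boldsymbol{k}_i(K)$ (the empty sequence if $n=0$). If $n \geq 1$, $\mathrm{d}_1(\boldsymbol{\sigma}) := (\sigma_2,\ldots,\sigma_n)$, a system of liftings for $\boldsymbol{k}_1(K)$. **Lattices.** "Finite module" means finitely generated. For $n \ge 1$ and a finite $K$-module $M$, an $\mathcal{O}_1(K)$-lattice in $M$ is a finite $\mathcal{O}_1(K)$-submodule $L$ with $M = K\cdot L$; $\operatorname{Lat}(M)$ is the set of lattices, and $\operatorname{Lat}(M_1,M_2):=\operatorname{Lat}(M_1)\times\operatorname{Lat}(M_2)$. For lattices $L\subset L'$, $L'/L$ has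 finite length over $\mathcal{O}_1(K)$, and $\operatorname{rest}_{\sigma_1}(L'/L)$ denotes it as a finite $\boldsymbol{k}_1(K)$-module via $\sigma_1$. For a $\Bbbk$-linear $\phi:M_1\to M_2$ and $(L_1,L_2),(L'_1,L'_2)\in\operatorname{Lat}(M_1,M_2)$, $(L'_1,L'_2)$ is a $\phi$-refinement of $(L_1,L_2)$, written $(L'_1,L'_2)\prec_\phi(L_1,L_2)$, if $L'_1\subset L_1$, $L_2\subset L'_2$, $\phi(L'_1)\subset L_2$ and $\phi(L_1)\subset L'_2$; then there is an induced $\bar\phi:L_1/L'_1\to L'_2/L_2$. **BT operators.** For finite $K$-modules $M_1,M_2$ define $\mathrm{E}^K_{\boldsymbol{\sigma}}(M_1,M_2)\subset\operatorname{Hom}_{\Bbbk}(M_1,M_2)$ recursively. If $n=0$ it is all of $\operatorname{Hom}_{\Bbbk}(M_1,M_2)$. If $n\ge1$, $\phi$ belongs to it iff: (i) every $(L_1,L_2)\in\operatorname{Lat}(M_1,M_2)$ has some $\phi$-refinement; and (ii) for every $\phi$-refinement $(L'_1,L'_2)\prec_\phi(L_1,L_2)$ the induced $\bar\phi$ belongs to $\mathrm{E}^{\boldsymbol{k}_1(K)}_{\mathrm{d}_1(\boldsymbol{\sigma})}(\operatorname{rest}_{\sigma_1}(L_1/L'_1),\operatorname{rest}_{\sigma_1}(L'_2/L_2))$. For $n\ge1$, $i\in\{1,\ldots,n\}$, $j\in\{1,2\}$, the subset $\mathrm{E}^K_{\boldsymbol{\sigma}}(M_1,M_2)_{i,j}$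 consists of those $\phi\in\mathrm{E}^K_{\boldsymbol{\sigma}}(M_1,M_2)$ such that: for $(i,j)=(1,1)$, $\phi(M_1)\subset L_2$ for some $L_2\in\operatorname{Lat}(M_2)$; for $(i,j)=(1,2)$, $\phi(L_1)=0$ for some $L_1\in\operatorname{Lat}(M_1)$; for $i\ge2$, for every $\phi$-refinement $(L'_1,L'_2)\prec_\phi(L_1,L_2)$ the induced $\bar\phi$ belongs to $\mathrm{E}^{\boldsymbol{k}_1(K)}_{\mathrm{d}_1(\boldsymbol{\sigma})}(\operatorname{rest}_{\sigma_1}(L_1/L'_1),\operatorname{rest}_{\sigma_1}(L'_2/L_2))_{i-1,j}$. Finally $\mathrm{E}_{\boldsymbol{\sigma}}(K):=\mathrm{E}^K_{\boldsymbol{\sigma}}(K,K)$ and $\mathrm{E}_{\boldsymbol{\sigma}}(K)_{i,j}:=\mathrm{E}^K_{\boldsymbol{\sigma}}(K,K)_{i,j}$. -}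

module Defs where

open import Level using (Level; Lift) renaming (suc to lsuc)
open import Algebra.Bundles using (CommutativeMonoid; Ring; CommutativeRing)
import Algebra.Definitions.RawMonoid as RawMonoidDefinitions
open import Algebra.Module.Bundles using (LeftModule)
import Algebra.Module.Construct.TensorUnit as TensorUnit
open import Algebra.Module.Morphism.Structures using (module LeftModuleMorphisms)
import Algebra.Module.Properties.LeftModule as LeftModuleProperties
open import Algebra.Morphism.Structures using (IsRingHomomorphism; IsRingMonomorphism; IsRingIsomorphism)
import Algebra.Morphism.Construct.Composition as Composition
import Algebra.Morphism.RingMonomorphism as RingMonomorphism
import Algebra.Construct.Pointwise as Pointwise
import Algebra.Properties.AbelianGroup as AbelianGroupProperties
import Algebra.Properties.CommutativeSemigroup as CommutativeSemigroupProperties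
import Algebra.Properties.Monoid.Sum as MonoidSum
import Algebra.Properties.Ring as RingProperties
import Algebra.Properties.Semiring.Exp as Exp
import Algebra.Properties.Semiring.Mult as Mult
import Algebra.Solver.Ring.NaturalCoefficients.Default as SemiringSolver
open import Data.Fin.Base using (Fin; zero; suc; toℕ)
open import Data.Nat.Base as ℕ using (ℕ; zero; suc; _∸_)
open import Data.Nat.Primality using (Prime)
open import Data.Product.Base using (Σ; ∃; _×_; _,_; proj₁; proj₂)
open import Data.Sum.Base using (_⊎_)
open import Data.Unit.Polymorphic.Base using (⊤; tt)
open import Data.Vec.Functional using (Vector)
open import Function.Base using (_∘_)
open import Function.Bundles using (_⇔_)
open import Relation.Binary.Core using (Rel)
open import Relation.Binary.Definitions using (_Respects_)
import Relation.Binary.Reasoning.Setoid as ≈-Reasoning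
open import Relation.Nullary.Negation.Core using (¬_)
open import Relation.Unary using (Pred; _⊆_; _≐_; _∩_; ⋃)

private variable
  ℓ : Level

CRing : (ℓ : Level) → Set (lsuc ℓ)
CRing ℓ = CommutativeRing ℓ ℓ

Mod : CRing ℓ → Set (lsuc ℓ)
Mod {ℓ} R = LeftModule (CommutativeRing.ring R) ℓ ℓ

-- The library bundle is indexed by raw rings, from which A and B cannot
-- be inferred.
record RingHom (A B : CRing ℓ) : Set ℓ where
  private
    module A = CommutativeRing A
    module B = CommutativeRing B
  field
    ⟦_⟧ : A.Carrier → B.Carrier
    isRingHomomorphism : IsRingHomomorphism A.rawRing B.rawRing ⟦_⟧
  open IsRingHomomorphism isRingHomomorphism public

open RingHom using (⟦_⟧)

regular : (R : CRing ℓ) → Mod R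
regular R = TensorUnit.leftModule {R = CommutativeRing.ring R}

composeHom : {A B C : CRing ℓ} → RingHom A B → RingHom B C → RingHom A C
composeHom {C = C} f g = record
  { ⟦_⟧ = ⟦ g ⟧ ∘ ⟦ f ⟧
  ; isRingHomomorphism = Composition.isRingHomomorphism (CommutativeRing.trans C)
      (RingHom.isRingHomomorphism f) (RingHom.isRingHomomorphism g)
  }

mkRingHom : (A B : CRing ℓ) →
  let module A = CommutativeRing A ; module B = CommutativeRing B in
  (f : A.Carrier → B.Carrier) →
  (∀ {x y} → x A.≈ y → f x B.≈ f y) →
  (∀ x y → f (x A.+ y) B.≈ f x B.+ f y) →
  (∀ x y → f (x A.* y) B.≈ f x B.* f y) →
  f A.0# B.≈ B.0# → f A.1# B.≈ B.1# → (∀ x → f (A.- x) B.≈ B.- f x) →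
  RingHom A B
mkRingHom A B f f-cong f-+ f-* f-0 f-1 f-neg = record
  { ⟦_⟧ = f
  ; isRingHomomorphism = record
    { isSemiringHomomorphism = record
      { isNearSemiringHomomorphism = record
        { +-isMonoidHomomorphism = record
          { isMagmaHomomorphism = record
            { isRelHomomorphism = record { cong = f-cong }
            ; homo = f-+
            }
          ; ε-homo = f-0
          }
        ; *-homo = f-*
        }
      ; 1#-homo = f-1
      }
    ; -‿homo = f-neg
    }
  }

restrictScalars : {A B : CRing ℓ} → RingHom A B → Mod B → Mod A
restrictScalars f M = record
  { Carrierᴹ = M.Carrierᴹ
  ; _≈ᴹ_ = M._≈ᴹ_
  ; _+ᴹ_ = M._+ᴹ_
  ; _*ₗ_ = λ a m → ⟦ f ⟧ a M.*ₗ m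
  ; 0ᴹ = M.0ᴹ
  ; -ᴹ_ = M.-ᴹ_
  ; isLeftModule = record
    { isLeftSemimodule = record
      { +ᴹ-isCommutativeMonoid = M.+ᴹ-isCommutativeMonoid
      ; isPreleftSemimodule = record
        { *ₗ-cong = λ p q → M.*ₗ-cong (f.⟦⟧-cong p) q
        ; *ₗ-zeroˡ = λ m → M.≈ᴹ-trans (M.*ₗ-congʳ f.0#-homo) (M.*ₗ-zeroˡ m)
        ; *ₗ-distribʳ = λ m a b → M.≈ᴹ-trans (M.*ₗ-congʳ (f.+-homo a b)) (M.*ₗ-distribʳ m _ _)
        ; *ₗ-identityˡ = λ m → M.≈ᴹ-trans (M.*ₗ-congʳ f.1#-homo) (M.*ₗ-identityˡ m)
        ; *ₗ-assoc = λ a b m → M.≈ᴹ-trans (M.*ₗ-congʳ (f.*-homo a b)) (M.*ₗ-assoc _ _ m)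
        ; *ₗ-zeroʳ = λ a → M.*ₗ-zeroʳ (⟦ f ⟧ a)
        ; *ₗ-distribˡ = λ a → M.*ₗ-distribˡ (⟦ f ⟧ a)
        }
      }
    ; -ᴹ‿cong = M.-ᴹ‿cong
    ; -ᴹ‿inverse = M.-ᴹ‿inverse
    }
  }
  where
  module M = LeftModule M
  module f = RingHom f

linearCombination : {R : Ring ℓ ℓ} (M : LeftModule R ℓ ℓ) {n : ℕ} →
  Vector (Ring.Carrier R) n → Vector (LeftModule.Carrierᴹ M) n → LeftModule.Carrierᴹ M
linearCombination M a g = RawMonoidDefinitions.sum +ᴹ-rawMonoid (λ i → a i *ₗ g i)
  where open LeftModule M

IsFiniteModule : {R : Ring ℓ ℓ} → LeftModule R ℓ ℓ → Set ℓ
IsFiniteModule M =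
  ∃ λ n → Σ (Vector Carrierᴹ n) λ g → ∀ x → ∃ λ a → x ≈ᴹ linearCombination M a g
  where open LeftModule M

record Submodule {R : Ring ℓ ℓ} (M : LeftModule R ℓ ℓ) : Set (lsuc ℓ) where
  open LeftModule M
  field
    mem : Pred Carrierᴹ ℓ
    mem-resp : mem Respects _≈ᴹ_
    mem-+ : ∀ {x y} → mem x → mem y → mem (x +ᴹ y)
    mem-0 : mem 0ᴹ
    mem-* : ∀ a {x} → mem x → mem (a *ₗ x)

  mem-neg : ∀ {x} → mem x → mem (-ᴹ x)
  mem-neg {x} p = mem-resp (-1*x≈-x) (mem-* (R.- R.1#) p)
    where
    module R = Ring R
    open LeftModuleProperties M
    -1*x≈-x : (R.- R.1#) *ₗ x ≈ᴹ -ᴹ x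
    -1*x≈-x = inverseˡ-uniqueᴹ _ _ (≈ᴹ-trans (+ᴹ-congˡ (≈ᴹ-sym (*ₗ-identityˡ x)))
      (≈ᴹ-trans (≈ᴹ-sym (*ₗ-distribʳ x (R.- R.1#) R.1#))
        (≈ᴹ-trans (*ₗ-congʳ (R.-‿inverseˡ R.1#)) (*ₗ-zeroˡ x))))

open Submodule public using (mem)

Ideal : CRing ℓ → Set (lsuc ℓ)
Ideal R = Submodule (regular R)

module Congruence {R : Ring ℓ ℓ} (M : LeftModule R ℓ ℓ) (L : Submodule M) where
  open LeftModule M
  private
    module L = Submodule L
    open AbelianGroupProperties +ᴹ-abelianGroup using (⁻¹-∙-comm; ⁻¹-involutive)
    open CommutativeSemigroupProperties
      (CommutativeMonoid.commutativeSemigroup +ᴹ-commutativeMonoid)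
      using (interchange)
    open ≈-Reasoning ≈ᴹ-setoid

  infix 4 _~_
  _~_ : Rel Carrierᴹ ℓ
  x ~ y = mem L (x +ᴹ -ᴹ y)

  ≈⇒~ : ∀ {x y} → x ≈ᴹ y → x ~ y
  ≈⇒~ {x} {y} p = L.mem-resp (≈ᴹ-sym (≈ᴹ-trans (+ᴹ-congʳ p) (-ᴹ‿inverseʳ y))) L.mem-0

  ~-sym : ∀ {x y} → x ~ y → y ~ x
  ~-sym {x} {y} p = L.mem-resp (begin
    -ᴹ (x +ᴹ -ᴹ y)     ≈⟨ ⁻¹-∙-comm x (-ᴹ y) ⟨
    -ᴹ x +ᴹ -ᴹ (-ᴹ y)  ≈⟨ +ᴹ-congˡ (⁻¹-involutive y) ⟩
    -ᴹ x +ᴹ y          ≈⟨ +ᴹ-comm _ _ ⟩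
    y +ᴹ -ᴹ x          ∎) (L.mem-neg p)

  ~-trans : ∀ {x y z} → x ~ y → y ~ z → x ~ z
  ~-trans {x} {y} {z} p q = L.mem-resp (begin
    (x +ᴹ -ᴹ y) +ᴹ (y +ᴹ -ᴹ z)  ≈⟨ +ᴹ-assoc _ _ _ ⟩
    x +ᴹ (-ᴹ y +ᴹ (y +ᴹ -ᴹ z))  ≈⟨ +ᴹ-congˡ (+ᴹ-assoc _ _ _) ⟨
    x +ᴹ ((-ᴹ y +ᴹ y) +ᴹ -ᴹ z)  ≈⟨ +ᴹ-congˡ (+ᴹ-congʳ (-ᴹ‿inverseˡ y)) ⟩
    x +ᴹ (0ᴹ +ᴹ -ᴹ z)           ≈⟨ +ᴹ-congˡ (+ᴹ-identityˡ _) ⟩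
    x +ᴹ -ᴹ z                   ∎) (L.mem-+ p q)

  ~-+ : ∀ {x x′ y y′} → x ~ x′ → y ~ y′ → (x +ᴹ y) ~ (x′ +ᴹ y′)
  ~-+ {x} {x′} {y} {y′} p q = L.mem-resp (begin
    (x +ᴹ -ᴹ x′) +ᴹ (y +ᴹ -ᴹ y′)  ≈⟨ interchange x (-ᴹ x′) y (-ᴹ y′) ⟩
    (x +ᴹ y) +ᴹ (-ᴹ x′ +ᴹ -ᴹ y′)  ≈⟨ +ᴹ-congˡ (⁻¹-∙-comm x′ y′) ⟩
    (x +ᴹ y) +ᴹ -ᴹ (x′ +ᴹ y′)     ∎) (L.mem-+ p q)

  ~-neg : ∀ {x y} → x ~ y → (-ᴹ x) ~ (-ᴹ y)
  ~-neg {x} {y} p = L.mem-resp (≈ᴹ-sym (⁻¹-∙-comm x (-ᴹ y))) (L.mem-neg p)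

  ~-* : ∀ a {x y} → x ~ y → (a *ₗ x) ~ (a *ₗ y)
  ~-* a {x} {y} p = L.mem-resp (≈ᴹ-trans (*ₗ-distribˡ a x (-ᴹ y)) (+ᴹ-congˡ a*-y)) (L.mem-* a p)
    where
    open LeftModuleProperties M
    a*-y : a *ₗ -ᴹ y ≈ᴹ -ᴹ (a *ₗ y)
    a*-y = inverseˡ-uniqueᴹ _ _ (≈ᴹ-trans (≈ᴹ-sym (*ₗ-distribˡ a (-ᴹ y) y))
      (≈ᴹ-trans (*ₗ-congˡ (-ᴹ‿inverseˡ y)) (*ₗ-zeroʳ a)))

-- The image of L in M/L′; when L′ ⊆ L this is the quotient L/L′.
subquotient : {R : Ring ℓ ℓ} (M : LeftModule R ℓ ℓ) (L L′ : Submodule M) → LeftModule R ℓ ℓ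
subquotient M L L′ = record
  { Carrierᴹ = Σ Carrierᴹ (mem L)
  ; _≈ᴹ_ = λ x y → proj₁ x ~ proj₁ y
  ; _+ᴹ_ = λ (x , p) (y , q) → x +ᴹ y , L.mem-+ p q
  ; _*ₗ_ = λ a (x , p) → a *ₗ x , L.mem-* a p
  ; 0ᴹ = 0ᴹ , L.mem-0
  ; -ᴹ_ = λ (x , p) → -ᴹ x , L.mem-neg p
  ; isLeftModule = record
    { isLeftSemimodule = record
      { +ᴹ-isCommutativeMonoid = record
        { isMonoid = record
          { isSemigroup = record
            { isMagma = record
              { isEquivalence = record { refl = ≈⇒~ ≈ᴹ-refl ; sym = ~-sym ; trans = ~-trans }
              ; ∙-cong = ~-+
              }
            ; assoc = λ _ _ _ → ≈⇒~ (+ᴹ-assoc _ _ _)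
            }
          ; identity = (λ _ → ≈⇒~ (+ᴹ-identityˡ _)) , (λ _ → ≈⇒~ (+ᴹ-identityʳ _))
          }
        ; comm = λ _ _ → ≈⇒~ (+ᴹ-comm _ _)
        }
      ; isPreleftSemimodule = record
        { *ₗ-cong = λ {a} p q → ~-trans (~-* a q) (≈⇒~ (*ₗ-congʳ p))
        ; *ₗ-zeroˡ = λ _ → ≈⇒~ (*ₗ-zeroˡ _)
        ; *ₗ-distribʳ = λ _ _ _ → ≈⇒~ (*ₗ-distribʳ _ _ _)
        ; *ₗ-identityˡ = λ _ → ≈⇒~ (*ₗ-identityˡ _)
        ; *ₗ-assoc = λ _ _ _ → ≈⇒~ (*ₗ-assoc _ _ _)
        ; *ₗ-zeroʳ = λ _ → ≈⇒~ (*ₗ-zeroʳ _)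
        ; *ₗ-distribˡ = λ _ _ _ → ≈⇒~ (*ₗ-distribˡ _ _ _)
        }
      }
    ; -ᴹ‿cong = ~-neg
    ; -ᴹ‿inverse = (λ _ → ≈⇒~ (-ᴹ‿inverseˡ _)) , (λ _ → ≈⇒~ (-ᴹ‿inverseʳ _))
    }
  }
  where
  open LeftModule M
  open Congruence M L′
  module L = Submodule L

record Subring (R : CRing ℓ) : Set (lsuc ℓ) where
  open CommutativeRing R
  field
    mem : Pred Carrier ℓ
    mem-resp : mem Respects _≈_
    mem-+ : ∀ {x y} → mem x → mem y → mem (x + y)
    mem-* : ∀ {x y} → mem x → mem y → mem (x * y)
    mem-neg : ∀ {x} → mem x → mem (- x)
    mem-0 : mem 0#
    mem-1 : mem 1#

subringRing : {R : CRing ℓ} → Subring R → CRing ℓ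
subringRing {R = R} S = record
  { Carrier = Σ Carrier S.mem
  ; _≈_ = λ x y → proj₁ x ≈ proj₁ y
  ; _+_ = λ (x , p) (y , q) → x + y , S.mem-+ p q
  ; _*_ = λ (x , p) (y , q) → x * y , S.mem-* p q
  ; -_ = λ (x , p) → - x , S.mem-neg p
  ; 0# = 0# , S.mem-0
  ; 1# = 1# , S.mem-1
  ; isCommutativeRing = RingMonomorphism.isCommutativeRing {R₂ = rawRing} mono isCommutativeRing
  }
  where
  open CommutativeRing R
  module S = Subring S
  mono : IsRingMonomorphism _ rawRing proj₁
  mono = record
    { isRingHomomorphism = record
      { isSemiringHomomorphism = record
        { isNearSemiringHomomorphism = record
          { +-isMonoidHomomorphism = record
            { isMagmaHomomorphism = record
              { isRelHomomorphism = record { cong = λ p → p }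
              ; homo = λ _ _ → refl
              }
            ; ε-homo = refl
            }
          ; *-homo = λ _ _ → refl
          }
        ; 1#-homo = refl
        }
      ; -‿homo = λ _ → refl
      }
    ; injective = λ p → p
    }

inclusion : {R : CRing ℓ} (S : Subring R) → RingHom (subringRing S) R
inclusion {R = R} S = mkRingHom (subringRing S) R proj₁ (λ p → p)
  (λ _ _ → refl) (λ _ _ → refl) refl refl (λ _ → refl)
  where open CommutativeRing R

-- The quotient keeps the carrier and coarsens the equality.
quotientRing : (R : CRing ℓ) → Ideal R → CRing ℓ
quotientRing R I = record
  { Carrier = Carrier
  ; _≈_ = _~_
  ; _+_ = _+_
  ; _*_ = _*_
  ; -_ = -_
  ; 0# = 0#
  ; 1# = 1#
  ; isCommutativeRing = record
    { isRing = record
      { +-isAbelianGroup = record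
        { isGroup = record
          { isMonoid = record
            { isSemigroup = record
              { isMagma = record
                { isEquivalence = record { refl = ≈⇒~ refl ; sym = ~-sym ; trans = ~-trans }
                ; ∙-cong = ~-+
                }
              ; assoc = λ _ _ _ → ≈⇒~ (+-assoc _ _ _)
              }
            ; identity = (λ _ → ≈⇒~ (+-identityˡ _)) , (λ _ → ≈⇒~ (+-identityʳ _))
            }
          ; inverse = (λ _ → ≈⇒~ (-‿inverseˡ _)) , (λ _ → ≈⇒~ (-‿inverseʳ _))
          ; ⁻¹-cong = ~-neg
          }
        ; comm = λ _ _ → ≈⇒~ (+-comm _ _)
        }
      ; *-cong = λ {x} {x′} {y} {y′} p q → ~-trans (~-* x q)
          (~-trans (≈⇒~ (*-comm x y′)) (~-trans (~-* y′ p) (≈⇒~ (*-comm y′ x′))))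
      ; *-assoc = λ _ _ _ → ≈⇒~ (*-assoc _ _ _)
      ; *-identity = (λ _ → ≈⇒~ (*-identityˡ _)) , (λ _ → ≈⇒~ (*-identityʳ _))
      ; distrib = (λ _ _ _ → ≈⇒~ (distribˡ _ _ _)) , (λ _ _ _ → ≈⇒~ (distribʳ _ _ _))
      }
    ; *-comm = λ _ _ → ≈⇒~ (*-comm _ _)
    }
  }
  where
  open CommutativeRing R
  open Congruence (regular R) I

quotientHom : (R : CRing ℓ) (I : Ideal R) → RingHom R (quotientRing R I)
quotientHom R I = mkRingHom R (quotientRing R I) (λ x → x) ≈⇒~
  (λ _ _ → ≈⇒~ refl) (λ _ _ → ≈⇒~ refl) (≈⇒~ refl) (≈⇒~ refl) (λ _ → ≈⇒~ refl)
  where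
  open CommutativeRing R
  open Congruence (regular R) I

IsUnit : (R : CRing ℓ) → Pred (CommutativeRing.Carrier R) ℓ
IsUnit R x = ∃ λ y → x * y ≈ 1#
  where open CommutativeRing R

record IsField (R : CRing ℓ) : Set ℓ where
  open CommutativeRing R
  field
    1≉0 : ¬ 1# ≈ 0#
    invertible : ∀ x → ¬ x ≈ 0# → IsUnit R x

-- Characteristic 0, or characteristic p with surjective Frobenius.
IsPerfect : (R : CRing ℓ) → Set ℓ
IsPerfect R = ∀ p → Prime p → (p ·ℕ 1#) ≈ 0# → ∀ x → ∃ λ y → y ^ p ≈ x
  where
  open CommutativeRing R
  open Exp semiring using (_^_)
  open Mult semiring using () renaming (_×_ to _·ℕ_)

data Power (R : CRing ℓ) (I : Ideal R) : ℕ → Pred (CommutativeRing.Carrier R) ℓ where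
  whole : ∀ x → Power R I 0 x
  products : ∀ {n x y} → mem I x → Power R I n y → Power R I (suc n) (CommutativeRing._*_ R x y)
  sums : ∀ {n x y} → Power R I n x → Power R I n y → Power R I n (CommutativeRing._+_ R x y)
  nil : ∀ {n} → Power R I n (CommutativeRing.0# R)
  resp : ∀ {n x y} → CommutativeRing._≈_ R x y → Power R I n x → Power R I n y

-- The canonical map R → lim R/Iⁿ is injective and surjective.
record IsAdicallyComplete (R : CRing ℓ) (I : Ideal R) : Set ℓ where
  open CommutativeRing R
  field
    separated : ∀ x → (∀ n → Power R I n x) → x ≈ 0#
    complete : (s : ℕ → Carrier) → (∀ n → Power R I n (s (suc n) - s n)) →
      ∃ λ y → ∀ n → Power R I n (y - s n)

-- A local principal ideal domain that is not a field.
record IsDVR (R : CRing ℓ) : Set (lsuc ℓ) where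
  open CommutativeRing R
  field
    1≉0 : ¬ 1# ≈ 0#
    integral : ∀ x y → x * y ≈ 0# → x ≈ 0# ⊎ y ≈ 0#
    principal : (I : Ideal R) → ∃ λ g → ∀ x → mem I x ⇔ (∃ λ y → x ≈ y * g)
    local : ∀ x y → ¬ IsUnit R x → ¬ IsUnit R y → ¬ IsUnit R (x + y)
    notField : ∃ λ x → ¬ x ≈ 0# × ¬ IsUnit R x

  maximalIdeal : Ideal R
  maximalIdeal = record
    { mem = λ x → ¬ IsUnit R x
    ; mem-resp = λ p ¬u (y , q) → ¬u (y , trans (*-congʳ p) q)
    ; mem-+ = λ {x} {y} → local x y
    ; mem-0 = λ (y , q) → 1≉0 (trans (sym q) (zeroˡ y))
    ; mem-* = λ a {x} ¬u (y , q) → ¬u (a * y , trans (sym (*-assoc x a y))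
        (trans (*-congʳ (*-comm x a)) q))
    }

record CDVRIn (K : CRing ℓ) : Set (lsuc ℓ) where
  open CommutativeRing K using (_≈_; _*_; 0#)
  field
    subring : Subring K
  valuationRing : CRing ℓ
  valuationRing = subringRing subring
  field
    isDVR : IsDVR valuationRing
    isComplete : IsAdicallyComplete valuationRing (IsDVR.maximalIdeal isDVR)
    fraction : ∀ x → ∃ λ a → ∃ λ b →
      Subring.mem subring a × Subring.mem subring b × ¬ b ≈ 0# × x * b ≈ a

  open Subring subring public using (mem)
  open IsDVR isDVR public using (maximalIdeal)

  residueField : CRing ℓ
  residueField = quotientRing valuationRing maximalIdeal

  toResidueField : RingHom valuationRing residueField
  toResidueField = quotientHom valuationRing maximalIdeal

data LocalField {ℓ} : ℕ → CRing ℓ → Set (lsuc ℓ) where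
  dim0 : ∀ {K} → IsField K → LocalField 0 K
  step : ∀ {n K} → IsField K → (O : CDVRIn K) →
    LocalField n (CDVRIn.residueField O) → LocalField (suc n) K

-- O₁ ×_{k₁} O₂ ×_{k₂} ⋯ ×_{kₙ₋₁} Oₙ as a subset of K: x is in O₁ and its
-- class in k₁ lies in the same kind of subset of k₁.
integers : ∀ {n} {K : CRing ℓ} → LocalField n K → Pred (CommutativeRing.Carrier K) ℓ
integers (dim0 _) x = ⊤
integers (step _ O lf) x = Σ (CDVRIn.mem O x) λ p → integers lf (x , p)

lastResidueField : ∀ {n} {K : CRing ℓ} → LocalField n K → CRing ℓ
lastResidueField {K = K} (dim0 _) = K
lastResidueField (step _ _ lf) = lastResidueField lf

record IntegralHom (𝕜 : CRing ℓ) {n} {K : CRing ℓ} (lf : LocalField n K) : Set ℓ where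
  field
    hom : RingHom 𝕜 K
    integral : ∀ c → integers lf (⟦ hom ⟧ c)

module _ {𝕜 : CRing ℓ} where

  open IntegralHom

  toO₁ : ∀ {n} {K : CRing ℓ} {F : IsField K} (O : CDVRIn K) {lf : LocalField n (CDVRIn.residueField O)} →
    IntegralHom 𝕜 (step F O lf) → RingHom 𝕜 (CDVRIn.valuationRing O)
  toO₁ O ι = mkRingHom 𝕜 (CDVRIn.valuationRing O) (λ c → ⟦ hom ι ⟧ c , proj₁ (integral ι c))
    ⟦⟧-cong +-homo *-homo 0#-homo 1#-homo -‿homo
    where open RingHom (hom ι) hiding (⟦_⟧)

  residueHom : ∀ {n} {K : CRing ℓ} {F : IsField K} (O : CDVRIn K) {lf : LocalField n (CDVRIn.residueField O)} →
    IntegralHom 𝕜 (step F O lf) → IntegralHom 𝕜 lf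
  residueHom O ι = record
    { hom = composeHom {B = CDVRIn.valuationRing O} {C = CDVRIn.residueField O} (toO₁ O ι) (CDVRIn.toResidueField O)
    ; integral = λ c → proj₂ (integral ι c)
    }

  lastResidueHom : ∀ {n} {K : CRing ℓ} (lf : LocalField n K) →
    IntegralHom 𝕜 lf → RingHom 𝕜 (lastResidueField lf)
  lastResidueHom (dim0 _) ι = hom ι
  lastResidueHom (step _ O lf) ι = lastResidueHom lf (residueHom O ι)

-- A topology on the quotient of A by _≈_: open sets are saturated.
record Topology {A : Set ℓ} (_≈_ : Rel A ℓ) : Set (lsuc (lsuc ℓ)) where
  field
    Open : Pred (Pred A ℓ) (lsuc ℓ)
    Open-saturated : ∀ {U} → Open U → U Respects _≈_
    Open-≐ : ∀ {U V} → U ≐ V → Open U → Open V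
    Open-whole : Open (λ _ → ⊤)
    Open-∩ : ∀ {U V} → Open U → Open V → Open (U ∩ V)
    Open-⋃ : (I : Set ℓ) (U : I → Pred A ℓ) → (∀ i → Open (U i)) → Open (⋃ I U)

open Topology public using (Open)

TopologyOn : CRing ℓ → Set (lsuc (lsuc ℓ))
TopologyOn R = Topology (CommutativeRing._≈_ R)

TopologyOnᴹ : {R : Ring ℓ ℓ} → LeftModule R ℓ ℓ → Set (lsuc (lsuc ℓ))
TopologyOnᴹ M = Topology (LeftModule._≈ᴹ_ M)

module _ {A B : Set ℓ} {_≈₁_ : Rel A ℓ} {_≈₂_ : Rel B ℓ} where

  Continuous : Topology _≈₁_ → Topology _≈₂_ → (A → B) → Set (lsuc ℓ)
  Continuous τ₁ τ₂ f = ∀ V → Open τ₂ V → Open τ₁ (V ∘ f)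

  IsOpenMap : Topology _≈₁_ → Topology _≈₂_ → (A → B) → Set (lsuc ℓ)
  IsOpenMap τ₁ τ₂ f = ∀ U → Open τ₁ U → Open τ₂ (λ y → ∃ λ x → U x × f x ≈₂ y)

IsDiscrete : {A : Set ℓ} {_≈_ : Rel A ℓ} → Topology _≈_ → Set (lsuc ℓ)
IsDiscrete {_≈_ = _≈_} τ = ∀ U → U Respects _≈_ → Open τ U

subspaceTopology : {R : CRing ℓ} (S : Subring R) → TopologyOn R → TopologyOn (subringRing S)
subspaceTopology {ℓ} {R} S τ = record
  { Open = λ U → Σ (Pred (CommutativeRing.Carrier R) ℓ) λ V → Open τ V × U ≐ (V ∘ proj₁)
  ; Open-saturated = λ (V , o , (U⊆V , V⊆U)) x≈y Ux → V⊆U (τ.Open-saturated o x≈y (U⊆V Ux))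
  ; Open-≐ = λ (U⊆U′ , U′⊆U) (V , o , (U⊆V , V⊆U)) →
      V , o , ((λ {x} p → U⊆V (U′⊆U p)) , (λ {x} p → U⊆U′ (V⊆U p)))
  ; Open-whole = (λ _ → ⊤) , τ.Open-whole , ((λ _ → tt) , (λ _ → tt))
  ; Open-∩ = λ (V , o , (U⊆V , V⊆U)) (V′ , o′ , (U′⊆V′ , V′⊆U′)) →
      V ∩ V′ , τ.Open-∩ o o′ ,
      ((λ (p , q) → U⊆V p , U′⊆V′ q) , (λ (p , q) → V⊆U p , V′⊆U′ q))
  ; Open-⋃ = λ I U os →
      ⋃ I (λ i → proj₁ (os i)) , τ.Open-⋃ I _ (λ i → proj₁ (proj₂ (os i))) ,
      ( (λ (i , p) → i , proj₁ (proj₂ (proj₂ (os i))) p)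
      , (λ (i , p) → i , proj₂ (proj₂ (proj₂ (os i))) p))
  }
  where module τ = Topology τ

quotientTopology : (R : CRing ℓ) (I : Ideal R) → TopologyOn R → TopologyOn (quotientRing R I)
quotientTopology R I τ = record
  { Open = λ U → U Respects _~_ × Open τ U
  ; Open-saturated = proj₁
  ; Open-≐ = λ (U⊆V , V⊆U) (r , o) →
      (λ x~y p → U⊆V (r x~y (V⊆U p))) , τ.Open-≐ (U⊆V , V⊆U) o
  ; Open-whole = (λ _ _ → tt) , τ.Open-whole
  ; Open-∩ = λ (r , o) (r′ , o′) → (λ x~y (p , q) → r x~y p , r′ x~y q) , τ.Open-∩ o o′
  ; Open-⋃ = λ I U os →
      (λ x~y (i , p) → i , proj₁ (os i) x~y p) , τ.Open-⋃ I U (λ i → proj₂ (os i))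
  }
  where
  module τ = Topology τ
  open Congruence (regular R) I

module _ {K : CRing ℓ} (O : CDVRIn K) where
  open CDVRIn O

  integerTopology : TopologyOn K → TopologyOn valuationRing
  integerTopology = subspaceTopology subring

  residueTopology : TopologyOn K → TopologyOn residueField
  residueTopology τ = quotientTopology valuationRing maximalIdeal (integerTopology τ)

-- 𝕜 is discrete, so scalar multiplication 𝕜 × M → M is continuous as
-- soon as each c *ₗ_ is.
record IsLinearTopology {𝕜 : Ring ℓ ℓ} (M : LeftModule 𝕜 ℓ ℓ) (τ : TopologyOnᴹ M) : Set (lsuc ℓ) where
  open LeftModule M
  field
    +-continuous : ∀ W → Open τ W → ∀ x y → W (x +ᴹ y) →
      ∃ λ U → ∃ λ V → Open τ U × Open τ V × U x × V y ×
        (∀ u v → U u → V v → W (u +ᴹ v))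
    *-continuous : ∀ c → Continuous τ τ (c *ₗ_)
    linear-basis : ∀ U → Open τ U → U 0ᴹ →
      Σ (Submodule M) λ N → Open τ (mem N) × mem N ⊆ U

module _ {𝕜 A : CRing ℓ} (κ : RingHom 𝕜 A) where

  record IsSTRing (τ : TopologyOn A) : Set (lsuc ℓ) where
    open CommutativeRing A
    field
      isLinearTopology : IsLinearTopology (restrictScalars κ (regular A)) τ
      *-continuous : ∀ a → Continuous τ τ (a *_)

  record IsSTModule (τA : TopologyOn A) (M : Mod A) (τ : TopologyOnᴹ M) : Set (lsuc ℓ) where
    open LeftModule M
    field
      isLinearTopology : IsLinearTopology (restrictScalars κ M) τ
      *-continuousʳ : ∀ a → Continuous τ τ (a *ₗ_)
      *-continuousˡ : ∀ m → Continuous τA τ (_*ₗ m)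

  record IsFineTopology (τA : TopologyOn A) (M : Mod A) (τ : TopologyOnᴹ M) : Set (lsuc (lsuc ℓ)) where
    field
      isSTModule : IsSTModule τA M τ
      finest : ∀ τ′ → IsSTModule τA M τ′ → Open τ′ ⊆ Open τ

module _ (A : CRing ℓ) where
  open CommutativeRing A
  open MonoidSum +-monoid using (sum; sum-cong-≋)

  private
    Series : Set ℓ
    Series = ℕ → Carrier

    infix 4 _≋_
    _≋_ : Rel Series ℓ
    f ≋ g = ∀ n → f n ≈ g n

    infixl 6 _⊕_
    _⊕_ : Series → Series → Series
    (f ⊕ g) n = f n + g n

    C : Carrier → Series
    C a zero = a
    C a (suc n) = 0#

    infixl 7 _⊛_
    _⊛_ : Series → Series → Series
    (f ⊛ g) n = sum {suc n} λ i → f (toℕ i) * g (n ∸ toℕ i)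

    open CommutativeSemigroupProperties +-commutativeSemigroup using (interchange; x∙yz≈y∙xz)
    open RingProperties ring using (-0#≈0#)
    open ≈-Reasoning setoid

    ⊛-cong : ∀ {f f′ g g′} → f ≋ f′ → g ≋ g′ → f ⊛ g ≋ f′ ⊛ g′
    ⊛-cong p q n = sum-cong-≋ {suc n} λ i → *-cong (p (toℕ i)) (q (n ∸ toℕ i))

    ⊛-zeroˡ : ∀ g n → ((λ _ → 0#) ⊛ g) n ≈ 0#
    ⊛-zeroˡ g zero = trans (+-identityʳ _) (zeroˡ _)
    ⊛-zeroˡ g (suc n) = trans (+-cong (zeroˡ _) (⊛-zeroˡ g n)) (+-identityˡ 0#)

    ⊛-C : ∀ a g → C a ⊛ g ≋ λ n → a * g n
    ⊛-C a g zero = +-identityʳ _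
    ⊛-C a g (suc n) = trans (+-congˡ (⊛-zeroˡ g n)) (+-identityʳ _)

    ⊛-distribʳ : ∀ f g h → (g ⊕ h) ⊛ f ≋ (g ⊛ f) ⊕ (h ⊛ f)
    ⊛-distribʳ f g h zero = begin
      (g 0 + h 0) * f 0 + 0#             ≈⟨ +-cong (distribʳ _ _ _) (sym (+-identityˡ 0#)) ⟩
      (g 0 * f 0 + h 0 * f 0) + (0# + 0#) ≈⟨ interchange _ _ _ _ ⟩
      (g 0 * f 0 + 0#) + (h 0 * f 0 + 0#) ∎
    ⊛-distribʳ f g h (suc n) =
      trans (+-cong (distribʳ _ _ _) (⊛-distribʳ f (g ∘ suc) (h ∘ suc) n)) (interchange _ _ _ _)

    ⊛-scale : ∀ a f g → (λ n → a * f n) ⊛ g ≋ λ n → a * (f ⊛ g) n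
    ⊛-scale a f g zero = begin
      a * f 0 * g 0 + 0#    ≈⟨ +-identityʳ _ ⟩
      a * f 0 * g 0         ≈⟨ *-assoc _ _ _ ⟩
      a * (f 0 * g 0)       ≈⟨ *-congˡ (+-identityʳ _) ⟨
      a * (f 0 * g 0 + 0#)  ∎
    ⊛-scale a f g (suc n) =
      trans (+-cong (*-assoc _ _ _) (⊛-scale a (f ∘ suc) g n)) (sym (distribˡ _ _ _))

    ⊛-tail : ∀ f g n → (f ⊛ g) (suc n) ≈ g 0 * f (suc n) + (f ⊛ (g ∘ suc)) n
    ⊛-tail f g zero = begin
      f 0 * g 1 + (f 1 * g 0 + 0#)  ≈⟨ x∙yz≈y∙xz _ _ _ ⟩
      f 1 * g 0 + (f 0 * g 1 + 0#)  ≈⟨ +-congʳ (*-comm _ _) ⟩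
      g 0 * f 1 + (f 0 * g 1 + 0#)  ∎
    ⊛-tail f g (suc n) = trans (+-congˡ (⊛-tail (f ∘ suc) g n)) (x∙yz≈y∙xz _ _ _)

    ⊛-comm : ∀ f g → f ⊛ g ≋ g ⊛ f
    ⊛-comm f g zero = +-congʳ (*-comm _ _)
    ⊛-comm f g (suc n) = trans (+-congˡ (⊛-comm (f ∘ suc) g n)) (sym (⊛-tail g f n))

    ⊛-assoc : ∀ f g h → (f ⊛ g) ⊛ h ≋ f ⊛ (g ⊛ h)
    ⊛-assoc f g h zero = +-congʳ (begin
      (f 0 * g 0 + 0#) * h 0  ≈⟨ *-congʳ (+-identityʳ _) ⟩
      f 0 * g 0 * h 0         ≈⟨ *-assoc _ _ _ ⟩
      f 0 * (g 0 * h 0)       ≈⟨ *-congˡ (+-identityʳ _) ⟨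
      f 0 * (g 0 * h 0 + 0#)  ∎)
    ⊛-assoc f g h (suc n) = begin
      (f ⊛ g) 0 * h (suc n) + (((λ m → f 0 * g (suc m)) ⊕ (f ∘ suc ⊛ g)) ⊛ h) n
        ≈⟨ +-cong (trans (*-congʳ (+-identityʳ _)) (*-assoc _ _ _))
             (trans (⊛-distribʳ h (λ m → f 0 * g (suc m)) ((f ∘ suc) ⊛ g) n) (+-cong (⊛-scale (f 0) (g ∘ suc) h n) (⊛-assoc (f ∘ suc) g h n))) ⟩
      f 0 * (g 0 * h (suc n)) + (f 0 * ((g ∘ suc) ⊛ h) n + ((f ∘ suc) ⊛ (g ⊛ h)) n)
        ≈⟨ +-assoc _ _ _ ⟨
      f 0 * (g 0 * h (suc n)) + f 0 * ((g ∘ suc) ⊛ h) n + ((f ∘ suc) ⊛ (g ⊛ h)) n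
        ≈⟨ +-congʳ (distribˡ _ _ _) ⟨
      f 0 * (g ⊛ h) (suc n) + ((f ∘ suc) ⊛ (g ⊛ h)) n ∎

    ⊛-identityˡ : ∀ f → C 1# ⊛ f ≋ f
    ⊛-identityˡ f n = trans (⊛-C 1# f n) (*-identityˡ _)

  powerSeriesRing : CRing ℓ
  powerSeriesRing = record
    { Carrier = Series
    ; _≈_ = _≋_
    ; _+_ = _⊕_
    ; _*_ = _⊛_
    ; -_ = λ f n → - f n
    ; 0# = λ _ → 0#
    ; 1# = C 1#
    ; isCommutativeRing = record
      { isRing = record
        { +-isAbelianGroup = Pointwise.isAbelianGroup ℕ +-isAbelianGroup
        ; *-cong = ⊛-cong
        ; *-assoc = ⊛-assoc
        ; *-identity = ⊛-identityˡ , (λ f n → trans (⊛-comm f (C 1#) n) (⊛-identityˡ f n))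
        ; distrib =
            (λ f g h n → trans (⊛-comm f (g ⊕ h) n) (trans (⊛-distribʳ f g h n)
              (+-cong (⊛-comm g f n) (⊛-comm h f n))))
          , ⊛-distribʳ
        }
      ; *-comm = ⊛-comm
      }
    }

  constantSeries : RingHom A powerSeriesRing
  constantSeries = mkRingHom A powerSeriesRing C
    (λ p → λ { zero → p ; (suc n) → refl })
    (λ x y → λ { zero → refl ; (suc n) → sym (+-identityˡ 0#) })
    (λ x y → λ { zero → sym (+-identityʳ _)
               ; (suc n) → sym (trans (⊛-C x (C y) (suc n)) (zeroʳ x)) })
    (λ { zero → refl ; (suc n) → refl })
    (λ n → refl)
    (λ x → λ { zero → refl ; (suc n) → sym -0#≈0# })

  seriesVariable : Series
  seriesVariable 1 = 1#
  seriesVariable _ = 0#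

  -- A[t]/(tⁿ) as an A-module, through the coefficients of 1, t, …, tⁿ⁻¹.
  truncatedPolynomials : ℕ → Mod A
  truncatedPolynomials n = record
    { Carrierᴹ = Vector Carrier n
    ; _≈ᴹ_ = λ f g → ∀ i → f i ≈ g i
    ; _+ᴹ_ = λ f g i → f i + g i
    ; _*ₗ_ = λ a f i → a * f i
    ; 0ᴹ = λ _ → 0#
    ; -ᴹ_ = λ f i → - f i
    ; isLeftModule = record
      { isLeftSemimodule = record
        { +ᴹ-isCommutativeMonoid = Pointwise.isCommutativeMonoid (Fin n) +-isCommutativeMonoid
        ; isPreleftSemimodule = record
          { *ₗ-cong = λ p q i → *-cong p (q i)
          ; *ₗ-zeroˡ = λ f i → zeroˡ (f i)
          ; *ₗ-distribʳ = λ f a b i → distribʳ (f i) a b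
          ; *ₗ-identityˡ = λ f i → *-identityˡ (f i)
          ; *ₗ-assoc = λ a b f i → *-assoc a b (f i)
          ; *ₗ-zeroʳ = λ a i → zeroʳ a
          ; *ₗ-distribˡ = λ a f g i → distribˡ a (f i) (g i)
          }
        }
      ; -ᴹ‿cong = λ p i → -‿cong (p i)
      ; -ᴹ‿inverse = (λ f i → -‿inverseˡ (f i)) , (λ f i → -‿inverseʳ (f i))
      }
    }

  truncate : ∀ n → Series → Vector Carrier n
  truncate n f i = f (toℕ i)

-- R[t⁻¹]; the pair (x , m) stands for t⁻ᵐ x.
module Localization (R : CRing ℓ) (t : CommutativeRing.Carrier R) where
  open CommutativeRing R
  private
    open Exp semiring using (_^_; ^-homo-*)
    open SemiringSolver commutativeSemiring using (solve; _:=_; _:+_; _:*_)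
    open ≈-Reasoning setoid
    open RingProperties ring using (-‿distribʳ-*)

    Fraction : Set ℓ
    Fraction = Carrier × ℕ

    infix 4 _≃_
    record _≃_ (p q : Fraction) : Set ℓ where
      constructor _,_
      field
        k : ℕ
        equal : t ^ k * (t ^ proj₂ q * proj₁ p) ≈ t ^ k * (t ^ proj₂ p * proj₁ q)

    ≃-trans : ∀ {x y z} → x ≃ y → y ≃ z → x ≃ z
    ≃-trans {x , m} {y , n} {z , p} (k , e) (l , e′) = (k ℕ.+ l) ℕ.+ n , (begin
      t ^ (k ℕ.+ l ℕ.+ n) * (t ^ p * x)           ≈⟨ *-congʳ pow ⟩
      (t ^ k * t ^ l) * t ^ n * (t ^ p * x)
        ≈⟨ solve 5 (λ K L N P X → ((K :* L) :* N) :* (P :* X) := (L :* P) :* (K :* (N :* X))) refl (t ^ k) (t ^ l) (t ^ n) (t ^ p) x ⟩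
      (t ^ l * t ^ p) * (t ^ k * (t ^ n * x))     ≈⟨ *-congˡ e ⟩
      (t ^ l * t ^ p) * (t ^ k * (t ^ m * y))
        ≈⟨ solve 5 (λ K L M P Y → (L :* P) :* (K :* (M :* Y)) := (K :* M) :* (L :* (P :* Y))) refl (t ^ k) (t ^ l) (t ^ m) (t ^ p) y ⟩
      (t ^ k * t ^ m) * (t ^ l * (t ^ p * y))     ≈⟨ *-congˡ e′ ⟩
      (t ^ k * t ^ m) * (t ^ l * (t ^ n * z))
        ≈⟨ solve 5 (λ K L N M Z → (K :* M) :* (L :* (N :* Z)) := ((K :* L) :* N) :* (M :* Z)) refl (t ^ k) (t ^ l) (t ^ n) (t ^ m) z ⟩
      (t ^ k * t ^ l) * t ^ n * (t ^ m * z)       ≈⟨ *-congʳ pow ⟨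
      t ^ (k ℕ.+ l ℕ.+ n) * (t ^ m * z)           ∎)
      where
      pow : t ^ (k ℕ.+ l ℕ.+ n) ≈ (t ^ k * t ^ l) * t ^ n
      pow = trans (^-homo-* t (k ℕ.+ l) n) (*-congʳ (^-homo-* t k l))

    infixl 6 _⊕_
    _⊕_ : Fraction → Fraction → Fraction
    (x , m) ⊕ (y , n) = t ^ n * x + t ^ m * y , m ℕ.+ n

    infixl 7 _⊛_
    _⊛_ : Fraction → Fraction → Fraction
    (x , m) ⊛ (y , n) = x * y , m ℕ.+ n

    exact : ∀ {x y m n} → t ^ n * x ≈ t ^ m * y → (x , m) ≃ (y , n)
    exact p = 0 , *-congˡ p

    ⊕-cong : ∀ {x x′ y y′} → x ≃ x′ → y ≃ y′ → x ⊕ y ≃ x′ ⊕ y′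
    ⊕-cong {x , m} {x′ , m′} {y , n} {y′ , n′} (k , e) (l , e′) = k ℕ.+ l , (begin
      t ^ (k ℕ.+ l) * (t ^ (m′ ℕ.+ n′) * (t ^ n * x + t ^ m * y))
        ≈⟨ *-cong (^-homo-* t k l) (*-congʳ (^-homo-* t m′ n′)) ⟩
      (t ^ k * t ^ l) * ((t ^ m′ * t ^ n′) * (t ^ n * x + t ^ m * y))
        ≈⟨ solve 8 (λ K L M M′ N N′ X Y → (K :* L) :* ((M′ :* N′) :* (N :* X :+ M :* Y))
             := (L :* N′ :* N) :* (K :* (M′ :* X)) :+ (K :* M′ :* M) :* (L :* (N′ :* Y))) refl (t ^ k) (t ^ l) (t ^ m) (t ^ m′) (t ^ n) (t ^ n′) x y ⟩
      (t ^ l * t ^ n′ * t ^ n) * (t ^ k * (t ^ m′ * x)) + (t ^ k * t ^ m′ * t ^ m) * (t ^ l * (t ^ n′ * y))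
        ≈⟨ +-cong (*-congˡ e) (*-congˡ e′) ⟩
      (t ^ l * t ^ n′ * t ^ n) * (t ^ k * (t ^ m * x′)) + (t ^ k * t ^ m′ * t ^ m) * (t ^ l * (t ^ n * y′))
        ≈⟨ solve 8 (λ K L M M′ N N′ X Y → (L :* N′ :* N) :* (K :* (M :* X)) :+ (K :* M′ :* M) :* (L :* (N :* Y))
             := (K :* L) :* ((M :* N) :* (N′ :* X :+ M′ :* Y))) refl (t ^ k) (t ^ l) (t ^ m) (t ^ m′) (t ^ n) (t ^ n′) x′ y′ ⟩
      (t ^ k * t ^ l) * ((t ^ m * t ^ n) * (t ^ n′ * x′ + t ^ m′ * y′))
        ≈⟨ *-cong (^-homo-* t k l) (*-congʳ (^-homo-* t m n)) ⟨
      t ^ (k ℕ.+ l) * (t ^ (m ℕ.+ n) * (t ^ n′ * x′ + t ^ m′ * y′)) ∎)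

    ⊛-cong : ∀ {x x′ y y′} → x ≃ x′ → y ≃ y′ → x ⊛ y ≃ x′ ⊛ y′
    ⊛-cong {x , m} {x′ , m′} {y , n} {y′ , n′} (k , e) (l , e′) = k ℕ.+ l , (begin
      t ^ (k ℕ.+ l) * (t ^ (m′ ℕ.+ n′) * (x * y))
        ≈⟨ *-cong (^-homo-* t k l) (*-congʳ (^-homo-* t m′ n′)) ⟩
      (t ^ k * t ^ l) * ((t ^ m′ * t ^ n′) * (x * y))
        ≈⟨ solve 6 (λ K L M N X Y → (K :* L) :* ((M :* N) :* (X :* Y)) := (K :* (M :* X)) :* (L :* (N :* Y))) refl (t ^ k) (t ^ l) (t ^ m′) (t ^ n′) x y ⟩
      (t ^ k * (t ^ m′ * x)) * (t ^ l * (t ^ n′ * y))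
        ≈⟨ *-cong e e′ ⟩
      (t ^ k * (t ^ m * x′)) * (t ^ l * (t ^ n * y′))
        ≈⟨ solve 6 (λ K L M N X Y → (K :* (M :* X)) :* (L :* (N :* Y)) := (K :* L) :* ((M :* N) :* (X :* Y))) refl (t ^ k) (t ^ l) (t ^ m) (t ^ n) x′ y′ ⟩
      (t ^ k * t ^ l) * ((t ^ m * t ^ n) * (x′ * y′))
        ≈⟨ *-cong (^-homo-* t k l) (*-congʳ (^-homo-* t m n)) ⟨
      t ^ (k ℕ.+ l) * (t ^ (m ℕ.+ n) * (x′ * y′)) ∎)

    ⊕-assoc : ∀ x y z → (x ⊕ y) ⊕ z ≃ x ⊕ (y ⊕ z)
    ⊕-assoc (x , m) (y , n) (z , p) = exact (begin
      t ^ (m ℕ.+ (n ℕ.+ p)) * (t ^ p * (t ^ n * x + t ^ m * y) + t ^ (m ℕ.+ n) * z)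
        ≈⟨ *-cong (trans (^-homo-* t m (n ℕ.+ p)) (*-congˡ (^-homo-* t n p))) (+-congˡ (*-congʳ (^-homo-* t m n))) ⟩
      (t ^ m * (t ^ n * t ^ p)) * (t ^ p * (t ^ n * x + t ^ m * y) + t ^ m * t ^ n * z)
        ≈⟨ solve 6 (λ M N P X Y Z → (M :* (N :* P)) :* (P :* (N :* X :+ M :* Y) :+ M :* N :* Z)
             := (M :* N :* P) :* (N :* P :* X :+ M :* (P :* Y :+ N :* Z))) refl (t ^ m) (t ^ n) (t ^ p) x y z ⟩
      (t ^ m * t ^ n * t ^ p) * (t ^ n * t ^ p * x + t ^ m * (t ^ p * y + t ^ n * z))
        ≈⟨ *-cong (trans (^-homo-* t (m ℕ.+ n) p) (*-congʳ (^-homo-* t m n))) (+-congʳ (*-congʳ (^-homo-* t n p))) ⟨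
      t ^ (m ℕ.+ n ℕ.+ p) * (t ^ (n ℕ.+ p) * x + t ^ m * (t ^ p * y + t ^ n * z)) ∎)

    ⊕-comm : ∀ x y → x ⊕ y ≃ y ⊕ x
    ⊕-comm (x , m) (y , n) = exact (*-cong
      (trans (^-homo-* t n m) (trans (*-comm _ _) (sym (^-homo-* t m n)))) (+-comm _ _))

    ⊕-identityˡ : ∀ x → (0# , 0) ⊕ x ≃ x
    ⊕-identityˡ (x , m) = exact (*-congˡ
      (trans (+-cong (zeroʳ _) (*-identityˡ x)) (+-identityˡ x)))

    ⊕-inverseˡ : ∀ x → (- proj₁ x , proj₂ x) ⊕ x ≃ (0# , 0)
    ⊕-inverseˡ (x , m) = exact (begin
      1# * (t ^ m * - x + t ^ m * x)  ≈⟨ *-identityˡ _ ⟩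
      t ^ m * - x + t ^ m * x         ≈⟨ distribˡ _ _ _ ⟨
      t ^ m * (- x + x)               ≈⟨ *-congˡ (-‿inverseˡ x) ⟩
      t ^ m * 0#                      ≈⟨ zeroʳ _ ⟩
      0#                              ≈⟨ zeroʳ _ ⟨
      t ^ (m ℕ.+ m) * 0#              ∎)

    neg-cong : ∀ {x y} → x ≃ y → (- proj₁ x , proj₂ x) ≃ (- proj₁ y , proj₂ y)
    neg-cong {x , m} {y , n} (k , e) = k , trans (out n x) (trans (-‿cong e) (sym (out m y)))
      where
      out : ∀ i z → t ^ k * (t ^ i * - z) ≈ - (t ^ k * (t ^ i * z))
      out i z = trans (*-congˡ (sym (-‿distribʳ-* _ z))) (sym (-‿distribʳ-* _ _))

    ⊛-assoc : ∀ x y z → (x ⊛ y) ⊛ z ≃ x ⊛ (y ⊛ z)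
    ⊛-assoc (x , m) (y , n) (z , p) = exact (*-cong (begin
      t ^ (m ℕ.+ (n ℕ.+ p))      ≈⟨ trans (^-homo-* t m (n ℕ.+ p)) (*-congˡ (^-homo-* t n p)) ⟩
      t ^ m * (t ^ n * t ^ p)    ≈⟨ *-assoc _ _ _ ⟨
      t ^ m * t ^ n * t ^ p      ≈⟨ trans (^-homo-* t (m ℕ.+ n) p) (*-congʳ (^-homo-* t m n)) ⟨
      t ^ (m ℕ.+ n ℕ.+ p)        ∎) (*-assoc x y z))

    ⊛-comm : ∀ x y → x ⊛ y ≃ y ⊛ x
    ⊛-comm (x , m) (y , n) = exact (*-cong
      (trans (^-homo-* t n m) (trans (*-comm _ _) (sym (^-homo-* t m n)))) (*-comm _ _))

    ⊛-identityˡ : ∀ x → (1# , 0) ⊛ x ≃ x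
    ⊛-identityˡ (x , m) = exact (*-congˡ (*-identityˡ x))

    ⊛-distribˡ : ∀ x y z → x ⊛ (y ⊕ z) ≃ (x ⊛ y) ⊕ (x ⊛ z)
    ⊛-distribˡ (x , m) (y , n) (z , p) = exact (begin
      t ^ ((m ℕ.+ n) ℕ.+ (m ℕ.+ p)) * (x * (t ^ p * y + t ^ n * z))
        ≈⟨ *-congʳ (trans (^-homo-* t (m ℕ.+ n) (m ℕ.+ p)) (*-cong (^-homo-* t m n) (^-homo-* t m p))) ⟩
      ((t ^ m * t ^ n) * (t ^ m * t ^ p)) * (x * (t ^ p * y + t ^ n * z))
        ≈⟨ solve 6 (λ M N P X Y Z → ((M :* N) :* (M :* P)) :* (X :* (P :* Y :+ N :* Z))
             := (M :* (N :* P)) :* (M :* P :* (X :* Y) :+ M :* N :* (X :* Z))) refl (t ^ m) (t ^ n) (t ^ p) x y z ⟩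
      (t ^ m * (t ^ n * t ^ p)) * (t ^ m * t ^ p * (x * y) + t ^ m * t ^ n * (x * z))
        ≈⟨ *-cong (trans (^-homo-* t m (n ℕ.+ p)) (*-congˡ (^-homo-* t n p)))
             (+-cong (*-congʳ (^-homo-* t m p)) (*-congʳ (^-homo-* t m n))) ⟨
      t ^ (m ℕ.+ (n ℕ.+ p)) * (t ^ (m ℕ.+ p) * (x * y) + t ^ (m ℕ.+ n) * (x * z)) ∎)

  localization : CRing ℓ
  localization = record
    { Carrier = Fraction
    ; _≈_ = _≃_
    ; _+_ = _⊕_
    ; _*_ = _⊛_
    ; -_ = λ (x , m) → - x , m
    ; 0# = 0# , 0
    ; 1# = 1# , 0
    ; isCommutativeRing = record
      { isRing = record
        { +-isAbelianGroup = record
          { isGroup = record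
            { isMonoid = record
              { isSemigroup = record
                { isMagma = record
                  { isEquivalence = record
                    { refl = 0 , refl
                    ; sym = λ (k , e) → k , sym e
                    ; trans = ≃-trans
                    }
                  ; ∙-cong = ⊕-cong
                  }
                ; assoc = ⊕-assoc
                }
              ; identity = ⊕-identityˡ , λ x → ≃-trans (⊕-comm x _) (⊕-identityˡ x)
              }
            ; inverse = ⊕-inverseˡ , λ x → ≃-trans (⊕-comm x _) (⊕-inverseˡ x)
            ; ⁻¹-cong = neg-cong
            }
          ; comm = ⊕-comm
          }
        ; *-cong = ⊛-cong
        ; *-assoc = ⊛-assoc
        ; *-identity = ⊛-identityˡ , λ x → ≃-trans (⊛-comm x _) (⊛-identityˡ x)
        ; distrib = ⊛-distribˡ , λ x y z → ≃-trans (⊛-comm (y ⊕ z) x)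
            (≃-trans (⊛-distribˡ x y z) (⊕-cong (⊛-comm x y) (⊛-comm x z)))
        }
      ; *-comm = ⊛-comm
      }
    }

  toLocalization : RingHom R localization
  toLocalization = mkRingHom R localization (_, 0)
    (λ p → exact (*-congˡ p))
    (λ x y → exact (*-congˡ (sym (+-cong (*-identityˡ x) (*-identityˡ y)))))
    (λ x y → exact refl) (0 , refl) (0 , refl) (λ x → 0 , refl)

laurentSeriesRing : CRing ℓ → CRing ℓ
laurentSeriesRing A = Localization.localization (powerSeriesRing A) (seriesVariable A)

toLaurentSeries : (A : CRing ℓ) → RingHom (powerSeriesRing A) (laurentSeriesRing A)
toLaurentSeries A = Localization.toLocalization (powerSeriesRing A) (seriesVariable A)

laurentModule : (A : CRing ℓ) → Mod (powerSeriesRing A)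
laurentModule A = restrictScalars (toLaurentSeries A) (regular (laurentSeriesRing A))

constantLaurent : (A : CRing ℓ) → RingHom A (laurentSeriesRing A)
constantLaurent A = composeHom {B = powerSeriesRing A} {C = laurentSeriesRing A}
  (constantSeries A) (toLaurentSeries A)

record IsLaurentTopology {𝕜 A : CRing ℓ} (κ : RingHom 𝕜 A)
    (τA : TopologyOn A) (τ : TopologyOn (laurentSeriesRing A)) : Set (lsuc (lsuc ℓ)) where
  field
    τtruncated : ∀ i → TopologyOnᴹ (truncatedPolynomials A (suc i))
    truncated-fine : ∀ i → IsFineTopology κ τA (truncatedPolynomials A (suc i)) (τtruncated i)
    -- The inverse limit topology is the coarsest one for which all
    -- projections are continuous.
    τpower : TopologyOn (powerSeriesRing A)
    power-continuous : ∀ i → Continuous τpower (τtruncated i) (truncate A (suc i))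
    power-coarsest : ∀ (τ′ : TopologyOn (powerSeriesRing A)) →
      (∀ i → Continuous τ′ (τtruncated i) (truncate A (suc i))) → Open τpower ⊆ Open τ′
    laurent-fine : IsFineTopology (composeHom {C = powerSeriesRing A} κ (constantSeries A))
      τpower (laurentModule A) τ

-- A((t₁,…,tₙ)), where A((t₁,…,tₙ₊₁)) = A((t₂,…,tₙ₊₁))((t₁)).
iteratedLaurent : ℕ → CRing ℓ → CRing ℓ
iteratedLaurent zero A = A
iteratedLaurent (suc n) A = laurentSeriesRing (iteratedLaurent n A)

module _ {𝕜 A : CRing ℓ} (κ : RingHom 𝕜 A) where

  iteratedHom : ∀ n → RingHom 𝕜 (iteratedLaurent n A)
  iteratedHom zero = κ
  iteratedHom (suc n) = composeHom {B = iteratedLaurent n A} {C = iteratedLaurent (suc n) A}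
    (iteratedHom n) (constantLaurent (iteratedLaurent n A))

  IsIteratedLaurentTopology : ∀ n → TopologyOn (iteratedLaurent n A) → Set (lsuc (lsuc ℓ))
  IsIteratedLaurentTopology zero τ = Lift _ (IsDiscrete τ)
  IsIteratedLaurentTopology (suc n) τ = Σ (TopologyOn (iteratedLaurent n A)) λ τ′ →
    IsIteratedLaurentTopology n τ′ × IsLaurentTopology (iteratedHom n) τ′ τ

-- The residue field of B[[t]] is identified with B through the constant
-- coefficient; F̄ is then the map induced by F on residue fields.
RespectsValuations : ∀ {n} {K : CRing ℓ} (lf : LocalField n K) (A : CRing ℓ) →
  (CommutativeRing.Carrier (iteratedLaurent n A) → CommutativeRing.Carrier K) → Set ℓ
RespectsValuations (dim0 _) A F = ⊤
RespectsValuations {n = suc n} {K = K} (step _ O lf) A F =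
  Σ (∀ f → CDVRIn.mem O (F (⟦ toLaurentSeries B ⟧ f))) λ into →
  (∀ x → CDVRIn.mem O x → ∃ λ f → F (⟦ toLaurentSeries B ⟧ f) K.≈ x) ×
  (Σ (CommutativeRing.Carrier B → k₁.Carrier) λ F̄ →
    (∀ f → F̄ (f 0) k₁.≈ ⟦ CDVRIn.toResidueField O ⟧ (F (⟦ toLaurentSeries B ⟧ f) , into f)) ×
    RespectsValuations lf A F̄)
  where
  B = iteratedLaurent n A
  module K = CommutativeRing K
  module k₁ = CommutativeRing (CDVRIn.residueField O)

record Parametrization {𝕜 : CRing ℓ} {n} {K : CRing ℓ} (lf : LocalField n K)
    (ι : IntegralHom 𝕜 lf) (τ : TopologyOn K) : Set (lsuc (lsuc ℓ)) where
  private
    module K = CommutativeRing K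
    𝕜′ : CRing ℓ
    𝕜′ = lastResidueField lf
    κ : RingHom 𝕜 𝕜′
    κ = lastResidueHom lf ι
    S : CRing ℓ
    S = iteratedLaurent n 𝕜′
  field
    τS : TopologyOn S
    isIteratedLaurentTopology : IsIteratedLaurentTopology κ n τS
    F : CommutativeRing.Carrier S → K.Carrier
    isRingIsomorphism : IsRingIsomorphism (CommutativeRing.rawRing S) K.rawRing F
    𝕜-homomorphism : ∀ c → F (⟦ iteratedHom κ n ⟧ c) K.≈ ⟦ IntegralHom.hom ι ⟧ c
    continuous : Continuous τS τ F
    open-map : IsOpenMap τS τ F
    respectsValuations : RespectsValuations lf 𝕜′ F

record TLF (𝕜 : CRing ℓ) (n : ℕ) : Set (lsuc (lsuc ℓ)) where
  field
    underlyingField : CRing ℓ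
    localField : LocalField n underlyingField
    structure : IntegralHom 𝕜 localField
    residue-finite : IsFiniteModule
      (restrictScalars (lastResidueHom localField structure) (regular (lastResidueField localField)))
    topology : TopologyOn underlyingField
    isSTRing : IsSTRing (IntegralHom.hom structure) topology
    parametrization : Parametrization localField structure topology

record Lifting {𝕜 : CRing ℓ} {n} {K : CRing ℓ} {F : IsField K} (O : CDVRIn K)
    {lf : LocalField n (CDVRIn.residueField O)}
    (ι : IntegralHom 𝕜 (step F O lf)) (τ : TopologyOn K) : Set (lsuc ℓ) where
  private
    module O = CDVRIn O
    module O₁ = CommutativeRing O.valuationRing
    module k₁ = CommutativeRing O.residueField
  field
    σ : RingHom O.residueField O.valuationRing
    𝕜-homomorphism : ∀ c → ⟦ σ ⟧ (⟦ IntegralHom.hom (residueHom O ι) ⟧ c) O₁.≈ ⟦ toO₁ O ι ⟧ c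
    continuous : Continuous (residueTopology O τ) (integerTopology O τ) ⟦ σ ⟧
    splits : ∀ x → ⟦ O.toResidueField ⟧ (⟦ σ ⟧ x) k₁.≈ x

Liftings : {𝕜 : CRing ℓ} {n : ℕ} {K : CRing ℓ} (lf : LocalField n K) →
  IntegralHom 𝕜 lf → TopologyOn K → Set (lsuc ℓ)
Liftings (dim0 _) ι τ = ⊤
Liftings (step _ O lf) ι τ =
  Lifting O {lf} ι τ × Liftings lf (residueHom O ι) (residueTopology O τ)

record Homₖ {𝕜 K : CRing ℓ} (ι : RingHom 𝕜 K) (M₁ M₂ : Mod K) : Set ℓ where
  field
    fun : LeftModule.Carrierᴹ M₁ → LeftModule.Carrierᴹ M₂
    isLinear : LeftModuleMorphisms.IsLeftModuleHomomorphism
      (LeftModule.rawLeftModule (restrictScalars ι M₁))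
      (LeftModule.rawLeftModule (restrictScalars ι M₂)) fun

open Homₖ using (fun)

module _ {K : CRing ℓ} (O : CDVRIn K) where
  open CDVRIn O using (subring; valuationRing)

  overO₁ : Mod K → Mod valuationRing
  overO₁ = restrictScalars (inclusion subring)

  record Lattice (M : Mod K) : Set (lsuc ℓ) where
    open LeftModule M
    field
      submodule : Submodule (overO₁ M)
      finite : ∃ λ n → Σ (Vector Carrierᴹ n) λ g → (∀ i → mem submodule (g i)) ×
        (∀ x → mem submodule x → ∃ λ a → x ≈ᴹ linearCombination (overO₁ M) a g)
      spanning : ∀ x → ∃ λ n → ∃ λ a → Σ (Vector Carrierᴹ n) λ g →
        (∀ i → mem submodule (g i)) × x ≈ᴹ linearCombination M a g

  _∈ᴸ_ : {M : Mod K} → LeftModule.Carrierᴹ M → Lattice M → Set ℓ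
  x ∈ᴸ L = mem (Lattice.submodule L) x

  record _≺[_]_ {M₁ M₂ : Mod K} (L′ : Lattice M₁ × Lattice M₂)
      (φ : LeftModule.Carrierᴹ M₁ → LeftModule.Carrierᴹ M₂) (L : Lattice M₁ × Lattice M₂) : Set ℓ where
    field
      shrink : ∀ {x} → x ∈ᴸ proj₁ L′ → x ∈ᴸ proj₁ L
      grow : ∀ {y} → y ∈ᴸ proj₂ L → y ∈ᴸ proj₂ L′
      maps′ : ∀ {x} → x ∈ᴸ proj₁ L′ → φ x ∈ᴸ proj₂ L
      maps : ∀ {x} → x ∈ᴸ proj₁ L → φ x ∈ᴸ proj₂ L′

module _ {𝕜 : CRing ℓ} {n} {K : CRing ℓ} {F : IsField K} (O : CDVRIn K)
    {lf : LocalField n (CDVRIn.residueField O)} {ι : IntegralHom 𝕜 (step F O lf)}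
    {τ : TopologyOn K} (σ₁ : Lifting O ι τ) where
  private
    module σ₁ = Lifting σ₁
    module K = CommutativeRing K

  -- rest_{σ₁}(L′/L) for L ⊆ L′.
  rest : {M : Mod K} → Lattice O M → Lattice O M → Mod (CDVRIn.residueField O)
  rest {M} L′ L = restrictScalars σ₁.σ
    (subquotient (overO₁ O M) (Lattice.submodule L′) (Lattice.submodule L))

  module _ {M₁ M₂ : Mod K} (φ : Homₖ (IntegralHom.hom ι) M₁ M₂)
      {L₁ L₁′ : Lattice O M₁} {L₂ L₂′ : Lattice O M₂}
      (r : _≺[_]_ O (L₁′ , L₂′) (fun φ) (L₁ , L₂)) where
    private
      module M₁ = LeftModule M₁
      module M₂ = LeftModule M₂
      module L₂ = Submodule (Lattice.submodule L₂)
      open LeftModuleMorphisms.IsLeftModuleHomomorphism (Homₖ.isLinear φ)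
      open _≺[_]_ r
      open Congruence (overO₁ O M₂) (Lattice.submodule L₂)

      scalar : ∀ c → proj₁ (⟦ σ₁.σ ⟧ (⟦ IntegralHom.hom (residueHom O ι) ⟧ c)) K.≈ ⟦ IntegralHom.hom ι ⟧ c
      scalar = σ₁.𝕜-homomorphism

    inducedMap : Homₖ (IntegralHom.hom (residueHom O ι)) (rest L₁ L₁′) (rest L₂′ L₂)
    inducedMap = record
      { fun = λ (x , p) → fun φ x , maps p
      ; isLinear = record
        { +ᴹ-isGroupHomomorphism = record
          { isMonoidHomomorphism = record
            { isMagmaHomomorphism = record
              { isRelHomomorphism = record
                { cong = λ p → L₂.mem-resp
                    (M₂.≈ᴹ-trans (+ᴹ-homo _ _) (M₂.+ᴹ-congˡ (-ᴹ-homo _))) (maps′ p)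
                }
              ; homo = λ _ _ → ≈⇒~ (+ᴹ-homo _ _)
              }
            ; ε-homo = ≈⇒~ 0ᴹ-homo
            }
          ; ⁻¹-homo = λ _ → ≈⇒~ (-ᴹ-homo _)
          }
        ; *ₗ-homo = λ c (x , _) → ≈⇒~ (M₂.≈ᴹ-trans (⟦⟧-cong (M₁.*ₗ-congʳ (scalar c)))
            (M₂.≈ᴹ-trans (*ₗ-homo c x) (M₂.*ₗ-congʳ (K.sym (scalar c)))))
        }
      }

module _ {𝕜 : CRing ℓ} where

  -- E^K_σ(M₁,M₂); for dimension 0 it is all of Hom_𝕜(M₁,M₂).
  BT : ∀ {n} {K : CRing ℓ} (lf : LocalField n K) (ι : IntegralHom 𝕜 lf) (τ : TopologyOn K) →
    Liftings lf ι τ → (M₁ M₂ : Mod K) → Pred (Homₖ (IntegralHom.hom ι) M₁ M₂) (lsuc ℓ)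
  BT (dim0 _) ι τ σ M₁ M₂ φ = ⊤
  BT (step _ O lf) ι τ (σ₁ , d₁σ) M₁ M₂ φ =
    (∀ (L : Lattice O M₁ × Lattice O M₂) → ∃ λ L′ → _≺[_]_ O L′ (fun φ) L) ×
    (∀ {L₁ L₁′ : Lattice O M₁} {L₂ L₂′ : Lattice O M₂}
      (r : _≺[_]_ O (L₁′ , L₂′) (fun φ) (L₁ , L₂)) →
      BT lf (residueHom O ι) (residueTopology O τ) d₁σ
        (rest O σ₁ L₁ L₁′) (rest O σ₁ L₂′ L₂)
        (inducedMap O {ι = ι} {τ = τ} σ₁ {M₁} {M₂} φ {L₁} {L₁′} {L₂} {L₂′} r))

  -- E^K_σ(M₁,M₂)ᵢⱼ; indices start at 0, so (zero , zero) stands for (1,1).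
  BTᵢⱼ : ∀ {n} {K : CRing ℓ} (lf : LocalField n K) (ι : IntegralHom 𝕜 lf) (τ : TopologyOn K) →
    Liftings lf ι τ → Fin n → Fin 2 →
    (M₁ M₂ : Mod K) → Pred (Homₖ (IntegralHom.hom ι) M₁ M₂) (lsuc ℓ)
  BTᵢⱼ lf@(step _ O _) ι τ σ zero zero M₁ M₂ φ = BT lf ι τ σ M₁ M₂ φ ×
    (Σ (Lattice O M₂) λ L₂ → ∀ x → _∈ᴸ_ O (fun φ x) L₂)
  BTᵢⱼ lf@(step _ O _) ι τ σ zero (suc zero) M₁ M₂ φ = BT lf ι τ σ M₁ M₂ φ ×
    (Σ (Lattice O M₁) λ L₁ → ∀ x → _∈ᴸ_ O x L₁ → LeftModule._≈ᴹ_ M₂ (fun φ x) (LeftModule.0ᴹ M₂))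
  BTᵢⱼ lf@(step _ O lf₁) ι τ σ@(σ₁ , d₁σ) (suc i) j M₁ M₂ φ = BT lf ι τ σ M₁ M₂ φ ×
    (∀ {L₁ L₁′ : Lattice O M₁} {L₂ L₂′ : Lattice O M₂}
      (r : _≺[_]_ O (L₁′ , L₂′) (fun φ) (L₁ , L₂)) →
      BTᵢⱼ lf₁ (residueHom O ι) (residueTopology O τ) d₁σ i j
        (rest O σ₁ L₁ L₁′) (rest O σ₁ L₂′ L₂)
        (inducedMap O {ι = ι} {τ = τ} σ₁ {M₁} {M₂} φ {L₁} {L₁′} {L₂} {L₂′} r))

module _ {𝕜 : CRing ℓ} {n : ℕ} (K : TLF 𝕜 n) where
  open TLF K

  SystemOfLiftings : Set (lsuc ℓ)
  SystemOfLiftings = Liftings localField structure topology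

  Endₖ : Set ℓ
  Endₖ = Homₖ (IntegralHom.hom structure) (regular underlyingField) (regular underlyingField)

  E : SystemOfLiftings → Pred Endₖ (lsuc ℓ)
  E σ = BT localField structure topology σ (regular underlyingField) (regular underlyingField)

  Eᵢⱼ : Fin n → Fin 2 → SystemOfLiftings → Pred Endₖ (lsuc ℓ)
  Eᵢⱼ i j σ = BTᵢⱼ localField structure topology σ i j (regular underlyingField) (regular underlyingField)

{-# OPTIONS --safe #-}
module Submission where

-- Only the k₁-module structures of the lattice quotients depend on σ, so one has to compare two
-- K-module structures s and s′ on the same 𝕜-module V. For V = L/L′ and the structures given by
-- σ₁ and σ₁′, they commute, the operators s(a) − s′(a) are locally nilpotent because
-- σ₁(a) − σ₁′(a) lies in the maximal ideal, and the two fine topologies on V coincide because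
-- the liftings are continuous. These three properties are stable under passing to subquotients
-- of lattices one level further down.
--
-- They imply that every s-lattice lies in an s′-lattice. If not, there is a vector v and there
-- are aₘ ∈ πᵐO such that s(aₘ)v leaves every s′-lattice; as the s′-fine topology of V has open
-- subgroups missing such a sequence, this contradicts the openness for s. The bound for πᵐO
-- is extended to O by induction on the nilpotency of v. Hence subgroups that are lattices for both
-- s and s′ are cofinal among the lattices of either kind, and the BT conditions can be compared on
-- them: their quotients again carry two such structures, which gives an induction on n. To return
-- to arbitrary lattices one needs that BT operators pass to k₁-linear subquotients of source
-- and target, which is a similar but purely algebraic induction.
--
-- The topological input, namely that every open subgroup of K contains some πᵐO and that sequences
-- with growing poles miss an open subgroup, is checked on Laurent series, where a submodule
-- given by open conditions on the coefficients of t⁰, t⁻¹, t⁻², … is open in the fine topology.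

open import Level using (Level; Lift; lift; lower) renaming (suc to lsuc)
open import Axiom.ExcludedMiddle using (ExcludedMiddle)
open import Algebra.Bundles using (CommutativeMonoid; CommutativeRing)
open import Algebra.Module.Bundles using (LeftModule)
open import Algebra.Module.Morphism.Structures using (module LeftModuleMorphisms)
import Algebra.Module.Properties.LeftModule as LeftModuleProperties
open import Algebra.Morphism.Structures using (IsRingIsomorphism)
import Algebra.Properties.AbelianGroup as AbelianGroupProperties
import Algebra.Properties.CommutativeSemigroup as CommutativeSemigroupProperties
import Algebra.Properties.Group as GroupProperties
import Algebra.Properties.Monoid.Sum as MonoidSum
import Algebra.Properties.Ring as RingProperties
import Algebra.Properties.Semiring.Exp as Exp
open import Data.Fin.Base using (Fin; zero; suc; toℕ; fromℕ<)
import Data.Fin.Properties as Fin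
open import Data.Nat.Base as ℕ using (ℕ; zero; suc; _∸_; _≤_; _<_; s≤s)
import Data.Nat.Properties as ℕ
open import Data.Product.Base using (Σ; ∃; _×_; _,_; proj₁; proj₂)
open import Data.Sum.Base using (_⊎_; inj₁; inj₂; [_,_]′)
open import Data.Unit.Polymorphic.Base using (⊤; tt)
open import Data.Vec.Functional using (Vector; _∷_)
open import Function.Base using (_∘_)
open import Function.Bundles using (_⇔_; Equivalence)
open import Relation.Binary.Core using (Rel)
open import Relation.Binary.Definitions using (_Respects_)
open import Relation.Binary.PropositionalEquality.Core as ≡ using (_≡_)
import Relation.Binary.Reasoning.Setoid as ≈-Reasoning
open import Relation.Nullary.Decidable.Core using (Dec; yes; no; decidable-stable)
open import Relation.Nullary.Negation.Core using (¬_; contradiction)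
open import Relation.Unary using (Pred; _≐_; _⊆_; ⋃)
open import Defs
open RingHom using (⟦_⟧)
open Homₖ using (fun)

-- Multiplication in K is continuous only in each variable separately, so the topology can be used
-- only along orbits b ↦ s(b)v of single vectors. Hence openness on V is phrased orbit by orbit
-- (`FineOpen`), and a lattice is bounded through its finitely many generators.
--
-- The orbit argument reaches only scalars in πᵐO. To return to O one has to divide by s′(πᵐ),
-- because the bounding lattice is an s′-lattice; the error s(πᵐ) - s′(πᵐ) is the reason why
-- nilpotency must be carried through the induction. On K itself the two structures agree, and each
-- passage to a quotient L/L′ adds to the order of nilpotency an exponent e with πᵉL ⊆ L′.
--
-- Fine topologies and inverse limit topologies are available only through their universal
-- properties. Openness in a fine topology is shown by building an ST topology in which the set is
-- open. That all open sets of A[[t]] are large is shown by building a topology on A[[t]] for which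
-- the truncations are continuous, and comparing it with the coarsest one.
--
-- All transfer statements are implications; equality follows because the hypotheses are symmetric
-- in σ and σ′.

private variable
  ℓ : Level

-- Linear algebra

module ModuleProperties (R : CRing ℓ) (M : Mod R) where
  open LeftModule M
  private module R = CommutativeRing R
  open LeftModuleProperties M using (inverseˡ-uniqueᴹ; -ᴹ-involutive) public
  open AbelianGroupProperties +ᴹ-abelianGroup using (⁻¹-∙-comm; x∙y⁻¹≈ε⇒x≈y) public
  open CommutativeSemigroupProperties
    (CommutativeMonoid.commutativeSemigroup +ᴹ-commutativeMonoid) using (interchange) public
  open ≈-Reasoning ≈ᴹ-setoid

  -‿*ˡ : ∀ a x → (R.- a) *ₗ x ≈ᴹ -ᴹ (a *ₗ x)
  -‿*ˡ a x = inverseˡ-uniqueᴹ _ _ (≈ᴹ-trans (≈ᴹ-sym (*ₗ-distribʳ x (R.- a) a))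
    (≈ᴹ-trans (*ₗ-congʳ (R.-‿inverseˡ a)) (*ₗ-zeroˡ x)))

  -‿*ʳ : ∀ a x → a *ₗ (-ᴹ x) ≈ᴹ -ᴹ (a *ₗ x)
  -‿*ʳ a x = inverseˡ-uniqueᴹ _ _ (≈ᴹ-trans (≈ᴹ-sym (*ₗ-distribˡ a (-ᴹ x) x))
    (≈ᴹ-trans (*ₗ-congˡ (-ᴹ‿inverseˡ x)) (*ₗ-zeroʳ a)))

  *-comm-* : ∀ a b x → a *ₗ (b *ₗ x) ≈ᴹ b *ₗ (a *ₗ x)
  *-comm-* a b x = ≈ᴹ-trans (≈ᴹ-sym (*ₗ-assoc a b x))
    (≈ᴹ-trans (*ₗ-congʳ (R.*-comm a b)) (*ₗ-assoc b a x))

  *-cancel : ∀ {a b} → a R.* b R.≈ R.1# → ∀ x → a *ₗ (b *ₗ x) ≈ᴹ x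
  *-cancel ab≈1 x = ≈ᴹ-trans (≈ᴹ-sym (*ₗ-assoc _ _ x)) (≈ᴹ-trans (*ₗ-congʳ ab≈1) (*ₗ-identityˡ x))

  sub-add : ∀ x y → (x +ᴹ -ᴹ y) +ᴹ y ≈ᴹ x
  sub-add x y = ≈ᴹ-trans (+ᴹ-assoc x (-ᴹ y) y)
    (≈ᴹ-trans (+ᴹ-congˡ (-ᴹ‿inverseˡ y)) (+ᴹ-identityʳ x))

  minus-zero : ∀ x → x +ᴹ -ᴹ 0ᴹ ≈ᴹ x
  minus-zero x = ≈ᴹ-trans (≈ᴹ-sym (+ᴹ-identityʳ _)) (sub-add x 0ᴹ)

module LinearCombinations (R : CRing ℓ) (M : Mod R) where
  open LeftModule M
  private module R = CommutativeRing R
  open ModuleProperties R M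
  open ≈-Reasoning ≈ᴹ-setoid

  lc : ∀ {n} → Vector R.Carrier n → Vector Carrierᴹ n → Carrierᴹ
  lc = linearCombination M

  lc-cong : ∀ {n} {a b : Vector R.Carrier n} (g : Vector Carrierᴹ n) →
    (∀ i → a i R.≈ b i) → lc a g ≈ᴹ lc b g
  lc-cong {zero} g p = ≈ᴹ-refl
  lc-cong {suc n} g p = +ᴹ-cong (*ₗ-congʳ (p zero)) (lc-cong (g ∘ suc) (p ∘ suc))

  lc-+ : ∀ {n} (a b : Vector R.Carrier n) (g : Vector Carrierᴹ n) →
    lc (λ i → a i R.+ b i) g ≈ᴹ lc a g +ᴹ lc b g
  lc-+ {zero} a b g = ≈ᴹ-sym (+ᴹ-identityˡ 0ᴹ)
  lc-+ {suc n} a b g = ≈ᴹ-trans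
    (+ᴹ-cong (*ₗ-distribʳ (g zero) (a zero) (b zero)) (lc-+ (a ∘ suc) (b ∘ suc) (g ∘ suc)))
    (interchange _ _ _ _)

  lc-* : ∀ {n} c (a : Vector R.Carrier n) (g : Vector Carrierᴹ n) →
    lc (λ i → c R.* a i) g ≈ᴹ c *ₗ lc a g
  lc-* {zero} c a g = ≈ᴹ-sym (*ₗ-zeroʳ c)
  lc-* {suc n} c a g = ≈ᴹ-trans
    (+ᴹ-cong (*ₗ-assoc c (a zero) (g zero)) (lc-* c (a ∘ suc) (g ∘ suc)))
    (≈ᴹ-sym (*ₗ-distribˡ c _ _))

  lc-scaled : ∀ {n} c (a : Vector R.Carrier n) (g : Vector Carrierᴹ n) →
    lc a (λ i → c *ₗ g i) ≈ᴹ c *ₗ lc a g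
  lc-scaled {zero} c a g = ≈ᴹ-sym (*ₗ-zeroʳ c)
  lc-scaled {suc n} c a g = ≈ᴹ-trans
    (+ᴹ-cong (*-comm-* (a zero) c (g zero)) (lc-scaled c (a ∘ suc) (g ∘ suc)))
    (≈ᴹ-sym (*ₗ-distribˡ c _ _))

  lc-zero : ∀ {n} (g : Vector Carrierᴹ n) → lc (λ _ → R.0#) g ≈ᴹ 0ᴹ
  lc-zero {zero} g = ≈ᴹ-refl
  lc-zero {suc n} g = ≈ᴹ-trans (+ᴹ-cong (*ₗ-zeroˡ _) (lc-zero (g ∘ suc))) (+ᴹ-identityˡ 0ᴹ)

  mem-lc : (P : Submodule M) → ∀ {n} (a : Vector R.Carrier n) (g : Vector Carrierᴹ n) →
    (∀ i → mem P (g i)) → mem P (lc a g)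
  mem-lc P {zero} a g p = Submodule.mem-0 P
  mem-lc P {suc n} a g p =
    Submodule.mem-+ P (Submodule.mem-* P (a zero) (p zero)) (mem-lc P (a ∘ suc) (g ∘ suc) (p ∘ suc))

  infix 4 _∈Span_
  _∈Span_ : ∀ {n} → Carrierᴹ → Vector Carrierᴹ n → Set _
  x ∈Span g = ∃ λ a → x ≈ᴹ lc a g

  Independent : ∀ {n} → Vector Carrierᴹ n → Set _
  Independent g = ∀ a → lc a g ≈ᴹ 0ᴹ → ∀ i → a i R.≈ R.0#

  span : ∀ {n} → Vector Carrierᴹ n → Submodule M
  span g = record
    { mem = _∈Span g
    ; mem-resp = λ x≈y (a , p) → a , ≈ᴹ-trans (≈ᴹ-sym x≈y) p
    ; mem-+ = λ (a , p) (b , q) → (λ i → a i R.+ b i) , ≈ᴹ-trans (+ᴹ-cong p q) (≈ᴹ-sym (lc-+ a b g))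
    ; mem-0 = (λ _ → R.0#) , ≈ᴹ-sym (lc-zero g)
    ; mem-* = λ c (a , p) → (λ i → c R.* a i) , ≈ᴹ-trans (*ₗ-congˡ p) (≈ᴹ-sym (lc-* c a g))
    }

  ∈Span-tail : ∀ {n x} (g : Vector Carrierᴹ (suc n)) → x ∈Span (g ∘ suc) → x ∈Span g
  ∈Span-tail g (a , p) = (R.0# ∷ a) , ≈ᴹ-trans p
    (≈ᴹ-sym (≈ᴹ-trans (+ᴹ-congʳ (*ₗ-zeroˡ (g zero))) (+ᴹ-identityˡ _)))

  generator∈Span : ∀ {n} (g : Vector Carrierᴹ n) i → g i ∈Span g
  generator∈Span g zero = (R.1# ∷ (λ _ → R.0#)) , ≈ᴹ-sym
    (≈ᴹ-trans (+ᴹ-cong (*ₗ-identityˡ (g zero)) (lc-zero (g ∘ suc))) (+ᴹ-identityʳ _))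
  generator∈Span g (suc i) = ∈Span-tail g (generator∈Span (g ∘ suc) i)

  Independent-tail : ∀ {n} (g : Vector Carrierᴹ (suc n)) → Independent g → Independent (g ∘ suc)
  Independent-tail g ind a p i = ind (R.0# ∷ a)
    (≈ᴹ-trans (+ᴹ-congʳ (*ₗ-zeroˡ (g zero))) (≈ᴹ-trans (+ᴹ-identityˡ _) p)) (suc i)

  module _ (em : ExcludedMiddle ℓ)
    (integral : ∀ x y → x R.* y R.≈ R.0# → x R.≈ R.0# ⊎ y R.≈ R.0#)
    (principal : (I : Ideal R) → ∃ λ g → ∀ x → mem I x ⇔ (∃ λ y → x R.≈ y R.* g)) where

    -- Echelon form: the leading coefficients of elements of P form a
    -- principal ideal, and an element with generating leading coefficient
    -- is split off.
    submodule-generators : ∀ {n} (g : Vector Carrierᴹ n) (P : Submodule M) →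
      (∀ x → mem P x → x ∈Span g) →
      ∃ λ m → Σ (Vector Carrierᴹ m) λ h → (∀ i → mem P (h i)) ×
        (∀ x → mem P x → x ∈Span h) × (Independent g → Independent h)
    submodule-generators {zero} g P P⊆g = 0 , g , (λ ()) , P⊆g , (λ ind → ind)
    submodule-generators {suc n} g P P⊆g = conclude em
      where
      module P = Submodule P
      g′ : Vector Carrierᴹ n
      g′ = g ∘ suc

      leading : Ideal R
      leading = record
        { mem = λ a → ∃ λ b → P.mem (a *ₗ g zero +ᴹ lc b g′)
        ; mem-resp = λ a≈a′ (b , p) → b , P.mem-resp (+ᴹ-congʳ (*ₗ-congʳ a≈a′)) p
        ; mem-+ = λ {a} {a′} (b , p) (b′ , p′) → (λ i → b i R.+ b′ i) , P.mem-resp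
            (≈ᴹ-trans (interchange _ _ _ _)
              (+ᴹ-cong (≈ᴹ-sym (*ₗ-distribʳ _ a a′)) (≈ᴹ-sym (lc-+ b b′ g′))))
            (P.mem-+ p p′)
        ; mem-0 = (λ _ → R.0#) , P.mem-resp
            (≈ᴹ-sym (≈ᴹ-trans (+ᴹ-cong (*ₗ-zeroˡ _) (lc-zero g′)) (+ᴹ-identityˡ 0ᴹ))) P.mem-0
        ; mem-* = λ c {a} (b , p) → (λ i → c R.* b i) , P.mem-resp
            (≈ᴹ-trans (*ₗ-distribˡ c _ _)
              (+ᴹ-cong (≈ᴹ-sym (*ₗ-assoc c a _)) (≈ᴹ-sym (lc-* c b g′))))
            (P.mem-* c p)
        }

      a₀ : R.Carrier
      a₀ = proj₁ (principal leading)
      module Principal x = Equivalence (proj₂ (principal leading) x)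

      pivot : ∃ λ b → P.mem (a₀ *ₗ g zero +ᴹ lc b g′)
      pivot = Principal.from a₀ (R.1# , R.sym (R.*-identityˡ a₀))
      b₀ : Vector R.Carrier n
      b₀ = proj₁ pivot
      s₀ : Carrierᴹ
      s₀ = a₀ *ₗ g zero +ᴹ lc b₀ g′

      P′ : Submodule M
      P′ = record
        { mem = λ x → P.mem x × x ∈Span g′
        ; mem-resp = λ e (p , q) → P.mem-resp e p , Submodule.mem-resp (span g′) e q
        ; mem-+ = λ (p , q) (p′ , q′) → P.mem-+ p p′ , Submodule.mem-+ (span g′) q q′
        ; mem-0 = P.mem-0 , Submodule.mem-0 (span g′)
        ; mem-* = λ c (p , q) → P.mem-* c p , Submodule.mem-* (span g′) c q
        }

      rec = submodule-generators g′ P′ (λ x → proj₂)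
      m = proj₁ rec
      h′ : Vector Carrierᴹ m
      h′ = proj₁ (proj₂ rec)
      h′∈P′ = proj₁ (proj₂ (proj₂ rec))
      P′⊆h′ = proj₁ (proj₂ (proj₂ (proj₂ rec)))
      h′-independent = proj₂ (proj₂ (proj₂ (proj₂ rec)))

      coefficient : ∀ {x} → P.mem x → (q : x ∈Span g) → ∃ λ y → proj₁ q zero R.≈ y R.* a₀
      coefficient p (a , e) = Principal.to (a zero) ((a ∘ suc) , P.mem-resp e p)

      conclude : Dec (a₀ R.≈ R.0#) → ∃ λ m → Σ (Vector Carrierᴹ m) λ h → (∀ i → P.mem (h i)) ×
        (∀ x → P.mem x → x ∈Span h) × (Independent g → Independent h)
      conclude (yes a₀≈0) = m , h′ , proj₁ ∘ h′∈P′ ,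
        (λ x p → P′⊆h′ x (p , drop p (P⊆g x p))) ,
        (λ ind → h′-independent (Independent-tail g ind))
        where
        drop : ∀ {x} → P.mem x → x ∈Span g → x ∈Span g′
        drop p q@(a , e) = (a ∘ suc) , ≈ᴹ-trans e (≈ᴹ-trans (+ᴹ-congʳ
          (≈ᴹ-trans (*ₗ-congʳ (R.trans (proj₂ y) (R.trans (R.*-congˡ a₀≈0) (R.zeroʳ _)))) (*ₗ-zeroˡ _)))
          (+ᴹ-identityˡ _))
          where y = coefficient p q
      conclude (no a₀≉0) = suc m , h , h∈P , (λ x p → split p (P⊆g x p)) , independent
        where
        h : Vector Carrierᴹ (suc m)
        h = s₀ ∷ h′
        h∈P : ∀ i → P.mem (h i)
        h∈P zero = proj₂ pivot
        h∈P (suc i) = proj₁ (h′∈P′ i)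
        split : ∀ {x} → P.mem x → x ∈Span g → x ∈Span h
        split {x} p q@(a , e) = (y ∷ proj₁ r) , (begin
          x                        ≈⟨ sub-add x (y *ₗ s₀) ⟨
          (x +ᴹ -ᴹ (y *ₗ s₀)) +ᴹ y *ₗ s₀  ≈⟨ +ᴹ-comm _ _ ⟩
          y *ₗ s₀ +ᴹ (x +ᴹ -ᴹ (y *ₗ s₀))  ≈⟨ +ᴹ-congˡ (proj₂ r) ⟩
          y *ₗ s₀ +ᴹ lc (proj₁ r) h′       ∎)
          where
          y = proj₁ (coefficient p q)
          x-ys₀ : x +ᴹ -ᴹ (y *ₗ s₀) ∈Span g′
          x-ys₀ = (λ i → a (suc i) R.+ (R.- y) R.* b₀ i) , (begin
            x +ᴹ -ᴹ (y *ₗ s₀)           ≈⟨ +ᴹ-cong e (≈ᴹ-sym (-‿*ˡ y s₀)) ⟩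
            lc a g +ᴹ (R.- y) *ₗ s₀      ≈⟨ +ᴹ-congˡ (*ₗ-distribˡ _ _ _) ⟩
            lc a g +ᴹ ((R.- y) *ₗ (a₀ *ₗ g zero) +ᴹ (R.- y) *ₗ lc b₀ g′) ≈⟨ interchange _ _ _ _ ⟩
            (a zero *ₗ g zero +ᴹ (R.- y) *ₗ (a₀ *ₗ g zero)) +ᴹ (lc (a ∘ suc) g′ +ᴹ (R.- y) *ₗ lc b₀ g′)
              ≈⟨ +ᴹ-cong cancelled (+ᴹ-congˡ (≈ᴹ-sym (lc-* (R.- y) b₀ g′))) ⟩
            0ᴹ +ᴹ (lc (a ∘ suc) g′ +ᴹ lc (λ i → (R.- y) R.* b₀ i) g′)
              ≈⟨ ≈ᴹ-trans (+ᴹ-identityˡ _) (≈ᴹ-sym (lc-+ (a ∘ suc) _ g′)) ⟩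
            lc (λ i → a (suc i) R.+ (R.- y) R.* b₀ i) g′ ∎)
            where
            cancelled : a zero *ₗ g zero +ᴹ (R.- y) *ₗ (a₀ *ₗ g zero) ≈ᴹ 0ᴹ
            cancelled = begin
              a zero *ₗ g zero +ᴹ (R.- y) *ₗ (a₀ *ₗ g zero)
                ≈⟨ +ᴹ-cong (≈ᴹ-trans (*ₗ-congʳ (proj₂ (coefficient p q))) (*ₗ-assoc y a₀ _)) (-‿*ˡ y _) ⟩
              y *ₗ (a₀ *ₗ g zero) +ᴹ -ᴹ (y *ₗ (a₀ *ₗ g zero)) ≈⟨ -ᴹ‿inverseʳ _ ⟩
              0ᴹ ∎
          r = P′⊆h′ _ (P.mem-+ p (P.mem-neg (P.mem-* y (proj₂ pivot))) , x-ys₀)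
        independent : Independent g → Independent h
        independent ind c p = λ { zero → c₀≈0 ; (suc i) → h′-independent (Independent-tail g ind) (c ∘ suc) rest≈0 i }
          where
          f = mem-lc (span g′) (c ∘ suc) h′ (proj₂ ∘ h′∈P′)
          -- A relation among the new generators, rewritten in terms of g, has leading coefficient
          -- c₀a₀; this vanishes by independence of g, and then c₀ = 0 because R is a domain and a₀
          -- ≠ 0.
          combined : Vector R.Carrier (suc n)
          combined = (c zero R.* a₀) ∷ (λ i → c zero R.* b₀ i R.+ proj₁ f i)
          expansion : lc combined g ≈ᴹ 0ᴹ
          expansion = begin
            (c zero R.* a₀) *ₗ g zero +ᴹ lc (λ i → c zero R.* b₀ i R.+ proj₁ f i) g′
              ≈⟨ +ᴹ-cong (*ₗ-assoc _ _ _) (≈ᴹ-trans (lc-+ _ (proj₁ f) g′) (+ᴹ-cong (lc-* (c zero) b₀ g′) (≈ᴹ-sym (proj₂ f)))) ⟩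
            c zero *ₗ (a₀ *ₗ g zero) +ᴹ (c zero *ₗ lc b₀ g′ +ᴹ lc (c ∘ suc) h′) ≈⟨ +ᴹ-assoc _ _ _ ⟨
            (c zero *ₗ (a₀ *ₗ g zero) +ᴹ c zero *ₗ lc b₀ g′) +ᴹ lc (c ∘ suc) h′ ≈⟨ +ᴹ-congʳ (*ₗ-distribˡ _ _ _) ⟨
            lc c h ≈⟨ p ⟩
            0ᴹ ∎
          c₀≈0 : c zero R.≈ R.0#
          c₀≈0 = [ (λ q → q) , (λ q → contradiction q a₀≉0) ]′ (integral _ _ (ind combined expansion zero))
          rest≈0 : lc (c ∘ suc) h′ ≈ᴹ 0ᴹ
          rest≈0 = ≈ᴹ-trans (≈ᴹ-sym (≈ᴹ-trans (+ᴹ-congʳ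
            (≈ᴹ-trans (*ₗ-congʳ c₀≈0) (*ₗ-zeroˡ s₀))) (+ᴹ-identityˡ _))) p

  module _ (em : ExcludedMiddle ℓ) (isField : IsField R) where
    open IsField isField

    -- A head generator is dropped if it lies in the span of the basis found for the tail. Otherwise
    -- it can be kept, since a nonzero coefficient in a relation could be inverted to solve for it.
    basis : ∀ {n} (g : Vector Carrierᴹ n) →
      ∃ λ r → Σ (Vector Carrierᴹ r) λ b → Independent b × (∀ x → x ∈Span g → x ∈Span b)
    basis {zero} g = 0 , g , (λ _ _ ()) , (λ _ p → p)
    basis {suc n} g = conclude (basis (g ∘ suc)) em
      where
      conclude : (B : ∃ λ r → Σ (Vector Carrierᴹ r) λ b →
          Independent b × (∀ x → x ∈Span (g ∘ suc) → x ∈Span b)) →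
        Dec (g zero ∈Span proj₁ (proj₂ B)) →
        ∃ λ r → Σ (Vector Carrierᴹ r) λ b → Independent b × (∀ x → x ∈Span g → x ∈Span b)
      conclude (r , b , ind , gen) (yes (g₀∈b)) = r , b , ind ,
        λ x (a , e) → Submodule.mem-resp (span b) (≈ᴹ-sym e)
          (Submodule.mem-+ (span b) (Submodule.mem-* (span b) (a zero) g₀∈b) (gen _ ((a ∘ suc) , ≈ᴹ-refl)))
      conclude (r , b , ind , gen) (no g₀∉b) = suc r , (g zero ∷ b) , independent ,
        λ x (a , e) → (a zero ∷ proj₁ (gen _ ((a ∘ suc) , ≈ᴹ-refl))) ,
          ≈ᴹ-trans e (+ᴹ-congˡ (proj₂ (gen _ ((a ∘ suc) , ≈ᴹ-refl))))
        where
        independent : Independent (g zero ∷ b)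
        independent c p = split em
          where
          split : Dec (c zero R.≈ R.0#) → ∀ i → c i R.≈ R.0#
          split (yes c₀≈0) zero = c₀≈0
          split (yes c₀≈0) (suc i) = ind (c ∘ suc) (≈ᴹ-trans (≈ᴹ-sym (≈ᴹ-trans (+ᴹ-congʳ
            (≈ᴹ-trans (*ₗ-congʳ c₀≈0) (*ₗ-zeroˡ (g zero)))) (+ᴹ-identityˡ _))) p) i
          split (no c₀≉0) = contradiction (Submodule.mem-resp (span b) solved
            (Submodule.mem-* (span b) (R.- proj₁ u) ((c ∘ suc) , ≈ᴹ-refl))) g₀∉b
            where
            u = invertible (c zero) c₀≉0
            solved : (R.- proj₁ u) *ₗ lc (c ∘ suc) b ≈ᴹ g zero
            solved = begin
              (R.- proj₁ u) *ₗ lc (c ∘ suc) b  ≈⟨ -‿*ˡ _ _ ⟩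
              -ᴹ (proj₁ u *ₗ lc (c ∘ suc) b)   ≈⟨ -‿*ʳ _ _ ⟨
              proj₁ u *ₗ -ᴹ (lc (c ∘ suc) b)   ≈⟨ *ₗ-congˡ (inverseˡ-uniqueᴹ _ _ p) ⟨
              proj₁ u *ₗ (c zero *ₗ g zero)    ≈⟨ *-cancel (R.trans (R.*-comm _ _) (proj₂ u)) _ ⟩
              g zero ∎

-- Lattices

-- `absorb` says K = O[π⁻¹], and `uniformizes` says that the maximal ideal lies in πO. The element π
-- will be the image of the Laurent variable, so that π-adic statements can be read off
-- coefficients.
record Uniformizer {K : CRing ℓ} (O : CDVRIn K) : Set ℓ where
  open CommutativeRing K
  open Exp semiring using (_^_; ^-homo-*)
  private module O = CDVRIn O
  field
    π π⁻¹ : Carrier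
    π*π⁻¹ : π * π⁻¹ ≈ 1#
    π∈O : O.mem π
    absorb : ∀ a → ∃ λ m → O.mem (π ^ m * a)
    uniformizes : ∀ x → mem O.maximalIdeal x → O.mem (π⁻¹ * proj₁ x)

  π^ : ℕ → Carrier
  π^ m = π ^ m
  π⁻^ : ℕ → Carrier
  π⁻^ m = π⁻¹ ^ m

  π^∈O : ∀ m → O.mem (π^ m)
  π^∈O zero = Subring.mem-1 O.subring
  π^∈O (suc m) = Subring.mem-* O.subring π∈O (π^∈O m)

  π^-+ : ∀ m n → π^ (m ℕ.+ n) ≈ π^ m * π^ n
  π^-+ = ^-homo-* π

  π^*π⁻^ : ∀ m → π^ m * π⁻^ m ≈ 1#
  π^*π⁻^ zero = *-identityˡ 1#
  π^*π⁻^ (suc m) = begin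
    (π * π^ m) * (π⁻¹ * π⁻^ m)  ≈⟨ interchange _ _ _ _ ⟩
    (π * π⁻¹) * (π^ m * π⁻^ m)  ≈⟨ *-cong π*π⁻¹ (π^*π⁻^ m) ⟩
    1# * 1#                     ≈⟨ *-identityˡ 1# ⟩
    1#                          ∎
    where
    open ≈-Reasoning setoid
    open CommutativeSemigroupProperties *-commutativeSemigroup using (interchange)

  π⁻^*π^ : ∀ m → π⁻^ m * π^ m ≈ 1#
  π⁻^*π^ m = trans (*-comm _ _) (π^*π⁻^ m)

append : ∀ {a} {A : Set a} {m n} → Vector A m → Vector A n → Vector A (m ℕ.+ n)
append {m = zero} a b = b
append {m = suc m} a b = a zero ∷ append (a ∘ suc) b

lc-append : (R : CRing ℓ) (M : Mod R) → let open LeftModule M ; open LinearCombinations R M in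
  ∀ {m n} (a : Vector (CommutativeRing.Carrier R) m) (b : Vector (CommutativeRing.Carrier R) n)
    (g : Vector Carrierᴹ m) (h : Vector Carrierᴹ n) →
  lc (append a b) (append g h) ≈ᴹ lc a g +ᴹ lc b h
lc-append R M {zero} a b g h = ≈ᴹ-sym (+ᴹ-identityˡ _)
  where open LeftModule M
lc-append R M {suc m} a b g h =
  ≈ᴹ-trans (+ᴹ-congˡ (lc-append R M (a ∘ suc) b (g ∘ suc) h)) (≈ᴹ-sym (+ᴹ-assoc _ _ _))
  where open LeftModule M

module Lattices (em : ExcludedMiddle ℓ) {K : CRing ℓ} (isField : IsField K) (O : CDVRIn K)
  (uniformizer : Uniformizer O) where
  private
    module K = CommutativeRing K
    module O = CDVRIn O
  open Uniformizer uniformizer public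

  module _ {M : Mod K} where
    open LeftModule M
    open ModuleProperties K M
    open LinearCombinations K M using (lc; lc-+; lc-*; lc-scaled; _∈Span_)
    private
      module LC₁ = LinearCombinations O.valuationRing (overO₁ O M)

    infix 4 _∈_
    _∈_ : Carrierᴹ → Lattice O M → Set ℓ
    x ∈ L = mem (Lattice.submodule L) x

    -- Since K = O[π⁻¹], this is the condition K·P = M, in a form that is easy to check for
    -- intersections and preimages.
    Absorbing : Submodule (overO₁ O M) → Set ℓ
    Absorbing P = ∀ x → ∃ λ m → mem P (π^ m *ₗ x)

    module _ (P : Submodule (overO₁ O M)) where
      private module P = Submodule P

      raise : ∀ k m {x} → P.mem (π^ m *ₗ x) → P.mem (π^ (k ℕ.+ m) *ₗ x)
      raise k m {x} p = P.mem-resp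
        (≈ᴹ-sym (≈ᴹ-trans (*ₗ-congʳ (π^-+ k m)) (*ₗ-assoc _ _ x))) (P.mem-* (π^ k , π^∈O k) p)

      raise′ : ∀ k m {x} → P.mem (π^ m *ₗ x) → P.mem (π^ (m ℕ.+ k) *ₗ x)
      raise′ k m {x} p = P.mem-resp
        (*-comm-π k m) (raise k m p)
        where
        *-comm-π : ∀ k m → π^ (k ℕ.+ m) *ₗ x ≈ᴹ π^ (m ℕ.+ k) *ₗ x
        *-comm-π k m = *ₗ-congʳ (K.trans (π^-+ k m) (K.trans (K.*-comm _ _) (K.sym (π^-+ m k))))

      absorb-lc : ∀ {n} (a : Vector K.Carrier n) (g : Vector Carrierᴹ n) → (∀ i → P.mem (g i)) →
        ∃ λ m → P.mem (π^ m *ₗ lc a g)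
      absorb-lc {zero} a g p = 0 , P.mem-resp (≈ᴹ-sym (*ₗ-zeroʳ _)) P.mem-0
      absorb-lc {suc n} a g p = m ℕ.+ m′ , P.mem-resp (≈ᴹ-sym (*ₗ-distribˡ _ _ _)) (P.mem-+
        (raise′ m′ m (P.mem-resp (*ₗ-assoc _ _ _) (P.mem-* (_ , proj₂ (absorb (a zero))) (p zero))))
        (raise m m′ (proj₂ rec)))
        where
        m = proj₁ (absorb (a zero))
        rec = absorb-lc (a ∘ suc) (g ∘ suc) (p ∘ suc)
        m′ = proj₁ rec

      absorb-vector : Absorbing P → ∀ {n} (x : Vector Carrierᴹ n) →
        ∃ λ m → ∀ i → P.mem (π^ m *ₗ x i)
      absorb-vector abs {zero} x = 0 , λ ()
      absorb-vector abs {suc n} x = m ℕ.+ m′ , λ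
        { zero → raise′ m′ m (proj₂ (abs (x zero))) ; (suc i) → raise m m′ (proj₂ rec i) }
        where
        m = proj₁ (abs (x zero))
        rec = absorb-vector abs (x ∘ suc)
        m′ = proj₁ rec

    absorbing : (L : Lattice O M) → Absorbing (Lattice.submodule L)
    absorbing L x with Lattice.spanning L x
    ... | n , a , g , g∈L , e with absorb-lc (Lattice.submodule L) a g g∈L
    ... | m , p = m , Submodule.mem-resp (Lattice.submodule L) (*ₗ-congˡ (≈ᴹ-sym e)) p

    spanning-of-absorbing : (P : Submodule (overO₁ O M)) → Absorbing P →
      ∀ x → ∃ λ n → ∃ λ a → Σ (Vector Carrierᴹ n) λ g →
        (∀ i → mem P (g i)) × x ≈ᴹ linearCombination M a g
    spanning-of-absorbing P abs x with abs x
    ... | m , p = 1 , (λ _ → π⁻^ m) , (λ _ → π^ m *ₗ x) , (λ _ → p) ,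
      ≈ᴹ-sym (≈ᴹ-trans (+ᴹ-identityʳ _) (*-cancel (π⁻^*π^ m) x))

    module _ (P : Submodule (overO₁ O M)) (L : Lattice O M) (P⊆L : ∀ x → mem P x → x ∈ L) where
      private
        g = proj₁ (proj₂ (Lattice.finite L))
        gen = proj₂ (proj₂ (proj₂ (Lattice.finite L)))

      generators : ∃ λ m → Σ (Vector Carrierᴹ m) λ h → (∀ i → mem P (h i)) ×
        (∀ x → mem P x → x LC₁.∈Span h) × (LC₁.Independent g → LC₁.Independent h)
      generators = LC₁.submodule-generators em (IsDVR.integral O.isDVR) (IsDVR.principal O.isDVR)
        g P (λ x p → gen x (P⊆L x p))

      -- O is a principal ideal domain, so finite generation is inherited from L.
      sublattice : Absorbing P → Lattice O M
      sublattice abs = record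
        { submodule = P
        ; finite = proj₁ generators , proj₁ (proj₂ generators) , proj₁ (proj₂ (proj₂ generators)) ,
            proj₁ (proj₂ (proj₂ (proj₂ generators)))
        ; spanning = spanning-of-absorbing P abs
        }

    -- Commensurability of lattices: one exponent serves the finitely many generators of L₁.
    absorbs : (L₁ L₂ : Lattice O M) → ∃ λ m → ∀ {x} → x ∈ L₁ → (π^ m *ₗ x) ∈ L₂
    absorbs L₁ L₂ = m , λ {x} p → L₂.mem-resp
        (≈ᴹ-trans (lc-scaled (π^ m) _ g) (*ₗ-congˡ (≈ᴹ-sym (proj₂ (gen x p)))))
        (LC₁.mem-lc (Lattice.submodule L₂) (proj₁ (gen x p)) _ (proj₂ abs))
      where
      module L₂ = Submodule (Lattice.submodule L₂)
      g = proj₁ (proj₂ (Lattice.finite L₁))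
      gen = proj₂ (proj₂ (proj₂ (Lattice.finite L₁)))
      abs = absorb-vector (Lattice.submodule L₂) (absorbing L₂) g
      m = proj₁ abs

    -- The lattice u⁻¹L.
    scaled : ∀ u u⁻¹ → u K.* u⁻¹ K.≈ K.1# → Lattice O M → Lattice O M
    scaled u u⁻¹ inv L = record
      { submodule = P
      ; finite = n , (λ i → u⁻¹ *ₗ g i) ,
          (λ i → L.mem-resp (≈ᴹ-sym (*-cancel inv (g i))) (g∈L i)) ,
          λ x p → proj₁ (gen _ p) , (begin
            x                            ≈⟨ *-cancel (K.trans (K.*-comm _ _) inv) x ⟨
            u⁻¹ *ₗ (u *ₗ x)              ≈⟨ *ₗ-congˡ (proj₂ (gen _ p)) ⟩
            u⁻¹ *ₗ lc (proj₁ ∘ proj₁ (gen _ p)) g ≈⟨ lc-scaled u⁻¹ _ g ⟨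
            lc (proj₁ ∘ proj₁ (gen _ p)) (λ i → u⁻¹ *ₗ g i) ∎)
      ; spanning = spanning-of-absorbing P λ x →
          proj₁ (absorbing L (u *ₗ x)) , L.mem-resp (*-comm-* _ _ x) (proj₂ (absorbing L (u *ₗ x)))
      }
      where
      open ≈-Reasoning ≈ᴹ-setoid
      module L = Submodule (Lattice.submodule L)
      n = proj₁ (Lattice.finite L)
      g = proj₁ (proj₂ (Lattice.finite L))
      g∈L = proj₁ (proj₂ (proj₂ (Lattice.finite L)))
      gen = proj₂ (proj₂ (proj₂ (Lattice.finite L)))
      P : Submodule (overO₁ O M)
      P = record
        { mem = λ x → L.mem (u *ₗ x)
        ; mem-resp = λ e → L.mem-resp (*ₗ-congˡ e)
        ; mem-+ = λ p q → L.mem-resp (≈ᴹ-sym (*ₗ-distribˡ _ _ _)) (L.mem-+ p q)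
        ; mem-0 = L.mem-resp (≈ᴹ-sym (*ₗ-zeroʳ u)) L.mem-0
        ; mem-* = λ (a , a∈O) p → L.mem-resp (*-comm-* a u _) (L.mem-* (a , a∈O) p)
        }

    -- These are π⁻ᵐL and πᵐL.
    enlarged shrunk : ℕ → Lattice O M → Lattice O M
    enlarged m = scaled (π^ m) (π⁻^ m) (π^*π⁻^ m)
    shrunk m = scaled (π⁻^ m) (π^ m) (π⁻^*π^ m)

    ⊆enlarged : ∀ m L {x} → x ∈ L → x ∈ enlarged m L
    ⊆enlarged m L p = Submodule.mem-* (Lattice.submodule L) (π^ m , π^∈O m) p

    shrunk⊆ : ∀ m L {x} → x ∈ shrunk m L → x ∈ L
    shrunk⊆ m L {x} p = Submodule.mem-resp (Lattice.submodule L) (*-cancel (π^*π⁻^ m) x)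
      (Submodule.mem-* (Lattice.submodule L) (π^ m , π^∈O m) p)

    lowerBound : (L₁ L₂ : Lattice O M) → Σ (Lattice O M) λ L →
      (∀ {x} → x ∈ L → x ∈ L₁) × (∀ {x} → x ∈ L → x ∈ L₂)
    lowerBound L₁ L₂ with absorbs L₁ L₂
    ... | m , p = shrunk m L₁ , shrunk⊆ m L₁ ,
      λ {x} q → Submodule.mem-resp (Lattice.submodule L₂) (*-cancel (π^*π⁻^ m) x) (p q)

    upperBound : (L₁ L₂ : Lattice O M) → Σ (Lattice O M) λ L →
      (∀ {x} → x ∈ L₁ → x ∈ L) × (∀ {x} → x ∈ L₂ → x ∈ L)
    upperBound L₁ L₂ with absorbs L₁ L₂
    ... | m , p = enlarged m L₂ , p , ⊆enlarged m L₂

    spanLattice : ∀ {n} (g : Vector Carrierᴹ n) → (∀ x → x ∈Span g) → Lattice O M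
    spanLattice {n} g gen = record
      { submodule = LC₁.span g
      ; finite = n , g , LC₁.generator∈Span g , λ x p → p
      ; spanning = λ x → n , proj₁ (gen x) , g , LC₁.generator∈Span g , proj₂ (gen x)
      }

    someLattice : IsFiniteModule M → Lattice O M
    someLattice (n , g , gen) = spanLattice g gen

    -- A basis of L over O that is at the same time a basis of M over K. It turns membership in L
    -- into integrality of coordinates, so that conditions on elements of K can be imposed on M.
    record LatticeBasis (L : Lattice O M) : Set ℓ where
      field
        {rank} : ℕ
        b : Vector Carrierᴹ rank
        b∈L : ∀ i → b i ∈ L
        coord : Carrierᴹ → Vector K.Carrier rank
        expansion : ∀ x → x ≈ᴹ lc (coord x) b
        unique : ∀ {x} a → x ≈ᴹ lc a b → ∀ i → coord x i K.≈ a i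
        integral : ∀ {x} → x ∈ L → ∀ i → O.mem (coord x i)

      coord-cong : ∀ {x y} → x ≈ᴹ y → ∀ i → coord x i K.≈ coord y i
      coord-cong {x} {y} e = unique (coord y) (≈ᴹ-trans e (expansion y))

      coord-+ : ∀ x y i → coord (x +ᴹ y) i K.≈ coord x i K.+ coord y i
      coord-+ x y = unique _ (≈ᴹ-trans (+ᴹ-cong (expansion x) (expansion y)) (≈ᴹ-sym (lc-+ _ _ b)))

      coord-* : ∀ a x i → coord (a *ₗ x) i K.≈ a K.* coord x i
      coord-* a x = unique _ (≈ᴹ-trans (*ₗ-congˡ (expansion x)) (≈ᴹ-sym (lc-* a _ b)))

      integral⇒∈ : ∀ x → (∀ i → O.mem (coord x i)) → x ∈ L
      integral⇒∈ x p = Submodule.mem-resp (Lattice.submodule L) (≈ᴹ-sym (expansion x))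
        (LC₁.mem-lc (Lattice.submodule L) (λ i → coord x i , p i) b b∈L)

    -- A K-basis b₀ is divided by a power of π until its O-span contains L. The echelon form then
    -- gives generators of L that are independent over O, and clearing denominators makes them
    -- independent over K.
    latticeBasis : IsFiniteModule M → (L : Lattice O M) → LatticeBasis L
    latticeBasis (_ , g , gen) L = record
      { b = h
      ; b∈L = h∈L
      ; coord = coord
      ; expansion = expansion
      ; unique = λ {x} a e → unique x a e
      ; integral = λ {x} p i → Subring.mem-resp O.subring
          (K.sym (unique x (proj₁ ∘ proj₁ (h-gen x p)) (proj₂ (h-gen x p)) i))
          (proj₂ (proj₁ (h-gen x p) i))
      }
      where
      open ≈-Reasoning ≈ᴹ-setoid
      module LCₖ = LinearCombinations K M
      B = LCₖ.basis em isField g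
      b₀ = proj₁ (proj₂ B)
      b₀-independent = proj₁ (proj₂ (proj₂ B))
      L₀ : Lattice O M
      L₀ = spanLattice b₀ (λ x → proj₂ (proj₂ (proj₂ B)) x (gen x))
      m = proj₁ (absorbs L L₀)
      b₁ : Vector Carrierᴹ (proj₁ B)
      b₁ i = π⁻^ m *ₗ b₀ i
      L⊆b₁ : ∀ x → x ∈ L → x LC₁.∈Span b₁
      L⊆b₁ x p = proj₁ q , (begin
        x                                ≈⟨ *-cancel (π⁻^*π^ m) x ⟨
        π⁻^ m *ₗ (π^ m *ₗ x)             ≈⟨ *ₗ-congˡ (proj₂ q) ⟩
        π⁻^ m *ₗ lc (proj₁ ∘ proj₁ q) b₀ ≈⟨ lc-scaled (π⁻^ m) _ b₀ ⟨
        lc (proj₁ ∘ proj₁ q) b₁          ∎)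
        where q = proj₂ (absorbs L L₀) p
      b₁-independent : LC₁.Independent b₁
      b₁-independent a e = b₀-independent (proj₁ ∘ a) (begin
        lc (proj₁ ∘ a) b₀                  ≈⟨ *-cancel (π^*π⁻^ m) _ ⟨
        π^ m *ₗ (π⁻^ m *ₗ lc (proj₁ ∘ a) b₀) ≈⟨ *ₗ-congˡ (lc-scaled (π⁻^ m) _ b₀) ⟨
        π^ m *ₗ lc (proj₁ ∘ a) b₁          ≈⟨ *ₗ-congˡ e ⟩
        π^ m *ₗ 0ᴹ                         ≈⟨ *ₗ-zeroʳ _ ⟩
        0ᴹ                                 ∎)
      H = LC₁.submodule-generators em (IsDVR.integral O.isDVR) (IsDVR.principal O.isDVR)
        b₁ (Lattice.submodule L) L⊆b₁
      h : Vector Carrierᴹ (proj₁ H)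
      h = proj₁ (proj₂ H)
      h∈L = proj₁ (proj₂ (proj₂ H))
      h-gen = proj₁ (proj₂ (proj₂ (proj₂ H)))
      h-independent₁ : LC₁.Independent h
      h-independent₁ = proj₂ (proj₂ (proj₂ (proj₂ H))) b₁-independent
      absorb-scalars : ∀ {n} (a : Vector K.Carrier n) → ∃ λ m → ∀ i → O.mem (π^ m K.* a i)
      absorb-scalars {zero} a = 0 , λ ()
      absorb-scalars {suc n} a = k ℕ.+ k′ , λ
        { zero → Subring.mem-resp O.subring (split k k′ (a zero)) (Subring.mem-* O.subring (π^∈O k′) (proj₂ (absorb (a zero))))
        ; (suc i) → Subring.mem-resp O.subring
            (K.trans (K.sym (K.*-assoc _ _ _)) (K.*-congʳ (K.sym (π^-+ k k′))))
            (Subring.mem-* O.subring (π^∈O k) (proj₂ rec i)) }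
        where
        k = proj₁ (absorb (a zero))
        rec = absorb-scalars (a ∘ suc)
        k′ = proj₁ rec
        split : ∀ k k′ x → π^ k′ K.* (π^ k K.* x) K.≈ π^ (k ℕ.+ k′) K.* x
        split k k′ x = K.trans (K.sym (K.*-assoc _ _ _))
          (K.*-congʳ (K.trans (K.*-comm _ _) (K.sym (π^-+ k k′))))
      h-independent : LCₖ.Independent h
      h-independent a e i = K.trans (K.sym (K.*-identityˡ _))
        (K.trans (K.*-congʳ (K.sym (π⁻^*π^ k))) (K.trans (K.*-assoc _ _ _)
          (K.trans (K.*-congˡ (h-independent₁ (λ i → π^ k K.* a i , proj₂ (absorb-scalars a) i)
            (≈ᴹ-trans (lc-* (π^ k) a h) (≈ᴹ-trans (*ₗ-congˡ e) (*ₗ-zeroʳ _))) i)) (K.zeroʳ _))))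
        where k = proj₁ (absorb-scalars a)
      expand : ∀ x → ∃ λ a → x ≈ᴹ lc a h
      expand x = (λ i → π⁻^ k K.* proj₁ (proj₁ q i)) , (begin
        x                               ≈⟨ *-cancel (π⁻^*π^ k) x ⟨
        π⁻^ k *ₗ (π^ k *ₗ x)            ≈⟨ *ₗ-congˡ (proj₂ q) ⟩
        π⁻^ k *ₗ lc (proj₁ ∘ proj₁ q) h ≈⟨ lc-* (π⁻^ k) _ h ⟨
        lc _ h                          ∎)
        where
        k = proj₁ (absorbing L x)
        q = h-gen _ (proj₂ (absorbing L x))
      coord = λ x → proj₁ (expand x)
      expansion = λ x → proj₂ (expand x)
      unique : ∀ x a → x ≈ᴹ lc a h → ∀ i → coord x i K.≈ a i
      unique x a e i = GroupProperties.x∙y⁻¹≈ε⇒x≈y K.+-group _ _ (K.trans (K.+-congˡ (K.sym minus)) (h-independent d d≈0 i))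
        where
        minus : ∀ {y} → (K.- K.1#) K.* y K.≈ K.- y
        minus {y} = RingProperties.-1*x≈-x K.ring y
        d : Vector K.Carrier (proj₁ H)
        d i = coord x i K.+ (K.- K.1#) K.* a i
        d≈0 : lc d h ≈ᴹ 0ᴹ
        d≈0 = begin
          lc d h                               ≈⟨ lc-+ (coord x) _ h ⟩
          lc (coord x) h +ᴹ lc (λ i → (K.- K.1#) K.* a i) h ≈⟨ +ᴹ-cong (≈ᴹ-trans (≈ᴹ-sym (expansion x)) e)
               (≈ᴹ-trans (lc-* _ a h) (≈ᴹ-trans (-‿*ˡ K.1# _) (-ᴹ‿cong (*ₗ-identityˡ _)))) ⟩
          lc a h +ᴹ -ᴹ lc a h                  ≈⟨ -ᴹ‿inverseʳ _ ⟩
          0ᴹ ∎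

-- Transfer of BT operators along linear subquotients

-- The graph of a surjection onto M′ from a submodule of M; it makes M′ a subquotient of M.
record LinearRelation {K : CRing ℓ} (M M′ : Mod K) : Set (lsuc ℓ) where
  private
    module M = LeftModule M
    module M′ = LeftModule M′
    module K = CommutativeRing K
  field
    rel : M.Carrierᴹ → M′.Carrierᴹ → Set ℓ
    rel-resp : ∀ {x y x′ y′} → x M.≈ᴹ y → x′ M′.≈ᴹ y′ → rel x x′ → rel y y′
    rel-+ : ∀ {x y x′ y′} → rel x x′ → rel y y′ → rel (x M.+ᴹ y) (x′ M′.+ᴹ y′)
    rel-* : ∀ a {x x′} → rel x x′ → rel (a M.*ₗ x) (a M′.*ₗ x′)
    onto : ∀ x′ → ∃ λ x → rel x x′
    zero-image : ∀ {x x′} → x M.≈ᴹ M.0ᴹ → rel x x′ → x′ M′.≈ᴹ M′.0ᴹ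

  rel-lc : ∀ {n} (a : Vector K.Carrier n) {g : Vector M.Carrierᴹ n} {g′ : Vector M′.Carrierᴹ n} →
    (∀ i → rel (g i) (g′ i)) → rel (linearCombination M a g) (linearCombination M′ a g′)
  -- That 0 is related to 0 is not a field of the record: any element over 0 is multiplied by the
  -- scalar 0.
  rel-lc {zero} a p = rel-resp (M.*ₗ-zeroˡ _) (M′.*ₗ-zeroˡ _) (rel-* K.0# (proj₂ (onto M′.0ᴹ)))
  rel-lc {suc n} a p = rel-+ (rel-* (a zero) (p zero)) (rel-lc (a ∘ suc) (p ∘ suc))

  rel-neg : ∀ {x x′} → rel x x′ → rel (M.-ᴹ x) (M′.-ᴹ x′)
  rel-neg {x} {x′} p = rel-resp
    (M.≈ᴹ-trans (ModuleProperties.-‿*ˡ K M K.1# x) (M.-ᴹ‿cong (M.*ₗ-identityˡ x)))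
    (M′.≈ᴹ-trans (ModuleProperties.-‿*ˡ K M′ K.1# x′) (M′.-ᴹ‿cong (M′.*ₗ-identityˡ x′)))
    (rel-* (K.- K.1#) p)

identityRelation : {K : CRing ℓ} (M : Mod K) → LinearRelation {K = K} M M
identityRelation M = record
  { rel = _≈ᴹ_
  ; rel-resp = λ p q r → ≈ᴹ-trans (≈ᴹ-sym p) (≈ᴹ-trans r q)
  ; rel-+ = +ᴹ-cong
  ; rel-* = λ a → *ₗ-congˡ
  ; onto = λ x → x , ≈ᴹ-refl
  ; zero-image = λ p q → ≈ᴹ-trans (≈ᴹ-sym q) p
  }
  where open LeftModule M

module _ {K : CRing ℓ} (O : CDVRIn K) where

  -- What is needed to move lattice conditions from M to M′. No linearity is asked, because the
  -- relation may also be the additive identification of two different module structures. `Lifts`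
  -- means L′ ⊆ R(L), `MapsInto` means R(L) ⊆ L′; each is required once with L′ given and once with
  -- L given.
  record Tame {M M′ : Mod K} (R : LeftModule.Carrierᴹ M → LeftModule.Carrierᴹ M′ → Set ℓ) : Set (lsuc ℓ) where
    private
      module M = LeftModule M
      module M′ = LeftModule M′

    Lifts : Lattice O M → Lattice O M′ → Set ℓ
    Lifts L L′ = ∀ {x′} → _∈ᴸ_ O x′ L′ → ∃ λ x → _∈ᴸ_ O x L × R x x′

    MapsInto : Lattice O M → Lattice O M′ → Set ℓ
    MapsInto L L′ = ∀ {x x′} → _∈ᴸ_ O x L → R x x′ → _∈ᴸ_ O x′ L′

    field
      onto : ∀ x′ → ∃ λ x → R x x′
      zero-image : ∀ {x x′} → x M.≈ᴹ M.0ᴹ → R x x′ → x′ M′.≈ᴹ M′.0ᴹ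
      cover : ∀ L′ → ∃ λ L → Lifts L L′
      covered : ∀ L → ∃ λ L′ → Lifts L L′
      domain : ∀ L′ → ∃ λ L → MapsInto L L′
      codomain : ∀ L → ∃ λ L′ → MapsInto L L′

module _ {𝕜 : CRing ℓ} {n} {K : CRing ℓ} {lf : LocalField n K} {ι : IntegralHom 𝕜 lf} {τ : TopologyOn K}
  where

  -- E and the Eᵢⱼ are treated together because Eᵢⱼ with i ≥ 2 descends to the same lattice
  -- quotients as E. Source and target may carry different modules, since the modules do change on
  -- the quotients.
  record Transfer (σ σ′ : Liftings lf ι τ) {M₁ M₂ M₁′ M₂′ : Mod K}
      (φ : Homₖ (IntegralHom.hom ι) M₁ M₂) (φ′ : Homₖ (IntegralHom.hom ι) M₁′ M₂′) : Set (lsuc ℓ) where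
    field
      bt : BT lf ι τ σ M₁ M₂ φ → BT lf ι τ σ′ M₁′ M₂′ φ′
      btᵢⱼ : ∀ i j → BTᵢⱼ lf ι τ σ i j M₁ M₂ φ → BTᵢⱼ lf ι τ σ′ i j M₁′ M₂′ φ′

  transfer-trans : {σ σ′ σ″ : Liftings lf ι τ} {M₁ M₂ M₁′ M₂′ M₁″ M₂″ : Mod K}
    {φ : Homₖ (IntegralHom.hom ι) M₁ M₂} {φ′ : Homₖ (IntegralHom.hom ι) M₁′ M₂′}
    {φ″ : Homₖ (IntegralHom.hom ι) M₁″ M₂″} →
    Transfer σ σ′ {M₁} {M₂} {M₁′} {M₂′} φ φ′ → Transfer σ′ σ″ {M₁′} {M₂′} {M₁″} {M₂″} φ′ φ″ →
    Transfer σ σ″ {M₁} {M₂} {M₁″} {M₂″} φ φ″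
  transfer-trans t u = record
    { bt = u.bt ∘ t.bt
    ; btᵢⱼ = λ i j → u.btᵢⱼ i j ∘ t.btᵢⱼ i j
    }
    where
    module t = Transfer t
    module u = Transfer u

module TransferStep (em : ExcludedMiddle ℓ) {𝕜 : CRing ℓ} {n} {K : CRing ℓ} {F : IsField K} (O : CDVRIn K)
  (uniformizer : Uniformizer O)
  {lf : LocalField n (CDVRIn.residueField O)} {ι : IntegralHom 𝕜 (step F O lf)} {τ : TopologyOn K}
  (σ₁ σ₁′ : Lifting O {lf} ι τ) (dσ dσ′ : Liftings lf (residueHom O ι) (residueTopology O τ))
  {M₁ M₂ M₁′ M₂′ : Mod K}
  (φ : Homₖ (IntegralHom.hom ι) M₁ M₂) (φ′ : Homₖ (IntegralHom.hom ι) M₁′ M₂′) where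
  open Lattices em F O uniformizer

  Refinable : Set (lsuc ℓ)
  Refinable = ∀ (L : Lattice O M₁ × Lattice O M₂) → ∃ λ L′ → _≺[_]_ O L′ (fun φ) L

  -- The induction step shared by `linear-transfer` and `comparison-transfer`. Conditions on whole
  -- lattices, that is (i) and the cases (1,1) and (1,2), move by tameness. Conditions on quotients
  -- are left to `reduce`, which must exhibit a φ-refinement over a given φ′-refinement and may use
  -- (i) for φ to find it.
  transfer-step :
    {R₁ : LeftModule.Carrierᴹ M₁ → LeftModule.Carrierᴹ M₁′ → Set ℓ}
    {R₂ : LeftModule.Carrierᴹ M₂ → LeftModule.Carrierᴹ M₂′ → Set ℓ}
    (tame₁ : Tame O {M₁} {M₁′} R₁) (tame₂ : Tame O {M₂} {M₂′} R₂) →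
    (∀ {x x′} → R₁ x x′ → R₂ (fun φ x) (fun φ′ x′)) →
    (Refinable → ∀ {C′ A′ : Lattice O M₁′} {D′ B′ : Lattice O M₂′}
      (r′ : _≺[_]_ O (A′ , B′) (fun φ′) (C′ , D′)) →
      ∃ λ (C : Lattice O M₁) → ∃ λ (A : Lattice O M₁) → ∃ λ (D : Lattice O M₂) → ∃ λ (B : Lattice O M₂) →
      Σ (_≺[_]_ O (A , B) (fun φ) (C , D)) λ r →
      Transfer {lf = lf} {ι = residueHom O ι} {τ = residueTopology O τ} dσ dσ′
        {rest O σ₁ C A} {rest O σ₁ B D} {rest O σ₁′ C′ A′} {rest O σ₁′ B′ D′}
        (inducedMap O {ι = ι} {τ = τ} σ₁ {M₁} {M₂} φ {C} {A} {D} {B} r)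
        (inducedMap O {ι = ι} {τ = τ} σ₁′ {M₁′} {M₂′} φ′ {C′} {A′} {D′} {B′} r′)) →
    Transfer {lf = step F O lf} {ι = ι} {τ = τ} (σ₁ , dσ) (σ₁′ , dσ′) {M₁} {M₂} {M₁′} {M₂′} φ φ′
  transfer-step {R₁} {R₂} tame₁ tame₂ compatible reduce = record { bt = bt′ ; btᵢⱼ = btᵢⱼ′ }
    where
    module R₁ = Tame tame₁
    module R₂ = Tame tame₂
    BT₁ = BT (step F O lf) ι τ (σ₁ , dσ) M₁ M₂ φ
    BT₁′ = BT (step F O lf) ι τ (σ₁′ , dσ′) M₁′ M₂′ φ′

    refinable : Refinable → ∀ (L : Lattice O M₁′ × Lattice O M₂′) → ∃ λ L′ → _≺[_]_ O L′ (fun φ′) L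
    refinable ref (C′ , D′) = (proj₁ A′ , proj₁ B′) , record
      { shrink = proj₁ (proj₂ A′)
      ; grow = proj₁ (proj₂ B′)
      ; maps′ = λ p → let (x , x∈A , q) = A-lifts (proj₂ (proj₂ A′) p) in
          proj₂ (R₂.domain D′) (r.maps′ x∈A) (compatible q)
      ; maps = λ p → let (x , x∈C , q) = proj₂ (R₁.cover C′) p in
          proj₂ (proj₂ B′) (B-maps (r.maps x∈C) (compatible q))
      }
      where
      refinement = ref (proj₁ (R₁.cover C′) , proj₁ (R₂.domain D′))
      module r = _≺[_]_ (proj₂ refinement)
      A = proj₁ (proj₁ refinement)
      B = proj₂ (proj₁ refinement)
      A-lifts = proj₂ (R₁.covered A)
      B-maps = proj₂ (R₂.codomain B)
      A′ = lowerBound C′ (proj₁ (R₁.covered A))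
      B′ = upperBound D′ (proj₁ (R₂.codomain B))

    bt′ : BT₁ → BT₁′
    bt′ (ref , ind) = refinable ref , λ {L₁} {L₁′} {L₂} {L₂′} r′ →
      let (C , A , D , B , r , t) = reduce ref {L₁} {L₁′} {L₂} {L₂′} r′
      in Transfer.bt t (ind {C} {A} {D} {B} r)

    btᵢⱼ′ : ∀ i j → BTᵢⱼ (step F O lf) ι τ (σ₁ , dσ) i j M₁ M₂ φ →
      BTᵢⱼ (step F O lf) ι τ (σ₁′ , dσ′) i j M₁′ M₂′ φ′
    btᵢⱼ′ zero zero (b , L₂ , p) = bt′ b , proj₁ (R₂.codomain L₂) , λ x′ →
      let (x , q) = R₁.onto x′ in proj₂ (R₂.codomain L₂) (p x) (compatible q)
    btᵢⱼ′ zero (suc zero) (b , L₁ , p) = bt′ b , proj₁ (R₁.covered L₁) , λ x′ x′∈L₁′ →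
      let (x , x∈L₁ , q) = proj₂ (R₁.covered L₁) x′∈L₁′ in R₂.zero-image (p x x∈L₁) (compatible q)
    btᵢⱼ′ (suc i) j (b , ind) = bt′ b , λ {L₁} {L₁′} {L₂} {L₂′} r′ →
      let (C , A , D , B , r , t) = reduce (proj₁ b) {L₁} {L₁′} {L₂} {L₂′} r′
      in Transfer.btᵢⱼ t i j (ind {C} {A} {D} {B} r)

module LinearRelationLattices (em : ExcludedMiddle ℓ) {K : CRing ℓ} (isField : IsField K) (O : CDVRIn K)
  (uniformizer : Uniformizer O) {M M′ : Mod K} (R : LinearRelation {K = K} M M′) where
  open Lattices em isField O uniformizer
  open LinearRelation R
  private
    module M = LeftModule M
    module M′ = LeftModule M′
    module O = CDVRIn O

  module _ (L : Lattice O M) where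
    private
      module L = Submodule (Lattice.submodule L)

      domain∩L : Submodule (overO₁ O M)
      domain∩L = record
        { mem = λ x → L.mem x × ∃ λ x′ → rel x x′
        ; mem-resp = λ e (p , x′ , r) → L.mem-resp e p , x′ , rel-resp e M′.≈ᴹ-refl r
        ; mem-+ = λ (p , _ , r) (q , _ , s) → L.mem-+ p q , _ , rel-+ r s
        ; mem-0 = L.mem-0 , _ , rel-lc {zero} (λ ()) {λ ()} {λ ()} (λ ())
        ; mem-* = λ (a , a∈O) (p , _ , r) → L.mem-* (a , a∈O) p , _ , rel-* a r
        }
      gens = generators {M = M} domain∩L L (λ x → proj₁)
      h = proj₁ (proj₂ gens)
      h∈ = proj₁ (proj₂ (proj₂ gens))
      h-gen = proj₁ (proj₂ (proj₂ (proj₂ gens)))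

      imageSubmodule : Submodule (overO₁ O M′)
      imageSubmodule = record
        { mem = λ x′ → ∃ λ x → L.mem x × rel x x′
        ; mem-resp = λ e (x , p , r) → x , p , rel-resp M.≈ᴹ-refl e r
        ; mem-+ = λ (_ , p , r) (_ , q , s) → _ , L.mem-+ p q , rel-+ r s
        ; mem-0 = _ , L.mem-0 , rel-lc {zero} (λ ()) {λ ()} {λ ()} (λ ())
        ; mem-* = λ (a , a∈O) (_ , p , r) → _ , L.mem-* (a , a∈O) p , rel-* a r
        }

      difference : ∀ {x x′ y y′} → x M.≈ᴹ y → rel x x′ → rel y y′ → x′ M′.≈ᴹ y′
      difference {x} {x′} {y} {y′} e r s = ModuleProperties.x∙y⁻¹≈ε⇒x≈y K M′ x′ y′
        (zero-image (M.≈ᴹ-trans (M.+ᴹ-congʳ e) (M.-ᴹ‿inverseʳ y)) (rel-+ r (rel-neg s)))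

    -- L meets the domain of the relation in a finitely generated module, as O is principal. The
    -- images of its generators generate, because `zero-image` makes the relation single-valued.
    image : Lattice O M′
    image = record
      { submodule = imageSubmodule
      ; finite = proj₁ gens , (λ i → proj₁ (proj₂ (h∈ i))) ,
          (λ i → h i , proj₁ (h∈ i) , proj₂ (proj₂ (h∈ i))) ,
          λ x′ (x , p , r) → let (a , e) = h-gen x (p , x′ , r) in
            a , difference e r (rel-lc (proj₁ ∘ a) (λ i → proj₂ (proj₂ (h∈ i))))
      ; spanning = spanning-of-absorbing {M = M′} imageSubmodule λ x′ →
          let (x , r) = onto x′ ; (m , p) = absorbing L x in m , _ , p , rel-* (π^ m) r
      }

  -- A fixed lattice L₀ is enlarged until it contains lifts of the generators of L′, which gives
  -- `cover`, and shrunk until its image falls into L′, which gives `domain`. The image lattice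
  -- serves for the other two.
  tame : IsFiniteModule M → Tame O {M} {M′} rel
  tame fin = record
    { onto = onto
    ; zero-image = zero-image
    ; cover = λ L′ → covering L′ , λ {x′} p →
        let (n , g′ , g′∈L′ , gen) = Lattice.finite L′ ; (a , e) = gen x′ p in
        linearCombination (overO₁ O M) a (λ i → proj₁ (onto (g′ i))) ,
        LinearCombinations.mem-lc O.valuationRing (overO₁ O M) (Lattice.submodule (covering L′)) a _
          (proj₂ (absorb-vector {M = M} (Lattice.submodule L₀) (absorbing L₀) (λ i → proj₁ (onto (g′ i))))) ,
        rel-resp M.≈ᴹ-refl (M′.≈ᴹ-sym e) (rel-lc (proj₁ ∘ a) (λ i → proj₂ (onto (g′ i))))
    ; covered = λ L → image L , λ p → p
    ; domain = λ L′ → let (m , abs) = absorbs (image L₀) L′ in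
        shrunk m L₀ , λ {x} {x′} p r → Submodule.mem-resp (Lattice.submodule L′)
          (ModuleProperties.*-cancel K M′ (π^*π⁻^ m) x′) (abs (_ , p , rel-* (π⁻^ m) r))
    ; codomain = λ L → image L , λ p r → _ , p , r
    }
    where
    L₀ : Lattice O M
    L₀ = someLattice {M = M} fin
    covering : Lattice O M′ → Lattice O M
    covering L′ = let (n , g′ , g′∈L′ , gen) = Lattice.finite L′ in
      enlarged (proj₁ (absorb-vector {M = M} (Lattice.submodule L₀) (absorbing L₀) (λ i → proj₁ (onto (g′ i))))) L₀

module LiftingProperties (em : ExcludedMiddle ℓ) {𝕜 : CRing ℓ} {d} {K : CRing ℓ} {F : IsField K} (O : CDVRIn K)
  (uniformizer : Uniformizer O)
  {lf : LocalField d (CDVRIn.residueField O)} {ι : IntegralHom 𝕜 (step F O lf)} {τ : TopologyOn K}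
  (σ₁ : Lifting O {lf} ι τ) where
  open Lattices em F O uniformizer
  private
    module K = CommutativeRing K
    module O = CDVRIn O
    module k₁ = CommutativeRing O.residueField
    module 𝒪 = CommutativeRing O.valuationRing

  σ : k₁.Carrier → K.Carrier
  σ a = proj₁ (⟦ Lifting.σ σ₁ ⟧ a)

  σ∈O : ∀ a → O.mem (σ a)
  σ∈O a = proj₂ (⟦ Lifting.σ σ₁ ⟧ a)

  quotient∈O : ∀ {c} (p : O.mem c) → O.mem (π⁻¹ K.* (c K.+ K.- σ (c , p)))
  quotient∈O {c} p = uniformizes ((c , p) 𝒪.- ⟦ Lifting.σ σ₁ ⟧ (c , p)) (k₁.sym {⟦ Lifting.σ σ₁ ⟧ (c , p)} {c , p} (Lifting.splits σ₁ (c , p)))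

  -- One step of the π-adic expansion with digits in σ(k₁): the remainder lies in πO because σ
  -- splits the residue map.
  decompose : ∀ {c} (p : O.mem c) → c K.≈ σ (c , p) K.+ π K.* (π⁻¹ K.* (c K.+ K.- σ (c , p)))
  decompose {c} p = begin
    c                                      ≈⟨ sub-add c (σ (c , p)) ⟨
    (c K.+ K.- σ (c , p)) K.+ σ (c , p)    ≈⟨ K.+-comm _ _ ⟩
    σ (c , p) K.+ (c K.+ K.- σ (c , p))    ≈⟨ K.+-congˡ (*-cancel π*π⁻¹ _) ⟨
    σ (c , p) K.+ π K.* (π⁻¹ K.* (c K.+ K.- σ (c , p))) ∎
    where
    open ≈-Reasoning K.setoid
    open ModuleProperties K (regular K)

  module _ {M : Mod K} (L L° : Lattice O M) where
    open LeftModule M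
    open LinearCombinations K M
    private
      module P = ModuleProperties K M
      module L = Submodule (Lattice.submodule L)
      module L° = Submodule (Lattice.submodule L°)
      N : Mod O.residueField
      N = rest O σ₁ L L°
      g = proj₁ (proj₂ (Lattice.finite L))
      g∈L = proj₁ (proj₂ (proj₂ (Lattice.finite L)))
      gen = proj₂ (proj₂ (proj₂ (Lattice.finite L)))

      -- Expansion cut off at order e: modulo πᵉL, the σ(k₁)-span of the products πⁱgⱼ with i < e is
      -- all of L. If πᵉL ⊆ L°, these products generate the quotient over k₁, which proves
      -- `rest-finite`.
      Generated : ℕ → Set ℓ
      Generated e = ∃ λ n → Σ (Vector Carrierᴹ n) λ h → (∀ i → L.mem (h i)) ×
        (∀ x → L.mem x → Σ (Vector k₁.Carrier n) λ a → ∃ λ y → L.mem y × x ≈ᴹ lc (λ i → σ (a i)) h +ᴹ π^ e *ₗ y)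

      generated : ∀ e → Generated e
      generated zero = 0 , (λ ()) , (λ ()) , λ x p → (λ ()) , x , p ,
        ≈ᴹ-sym (≈ᴹ-trans (+ᴹ-identityˡ _) (*ₗ-identityˡ x))
      generated (suc e) = r ℕ.+ m , append h (λ i → π^ e *ₗ g i) , inL ,
        λ x p → let (a , y , q , eq) = hgen x p in append a (proj₁ (gen y q)) ,
          lc (λ i → π⁻¹ K.* (proj₁ (proj₁ (gen y q) i) K.+ K.- σ (proj₁ (gen y q) i))) g ,
          LinearCombinations.mem-lc O.valuationRing (overO₁ O M) (Lattice.submodule L)
            (λ i → _ , quotient∈O (proj₂ (proj₁ (gen y q) i))) g g∈L ,
          eq′ x a y (proj₁ (gen y q)) eq (proj₂ (gen y q))
        where
        m = proj₁ (Lattice.finite L)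
        r = proj₁ (generated e)
        h = proj₁ (proj₂ (generated e))
        h∈L = proj₁ (proj₂ (proj₂ (generated e)))
        hgen = proj₂ (proj₂ (proj₂ (generated e)))
        inL-append : ∀ {m n} (a : Vector Carrierᴹ m) (b : Vector Carrierᴹ n) →
          (∀ i → L.mem (a i)) → (∀ i → L.mem (b i)) → ∀ i → L.mem (append a b i)
        inL-append {zero} a b p q i = q i
        inL-append {suc m} a b p q zero = p zero
        inL-append {suc m} a b p q (suc i) = inL-append (a ∘ suc) b (p ∘ suc) q i
        inL = inL-append h _ h∈L (λ i → L.mem-* (π^ e , π^∈O e) (g∈L i))
        σ-append : ∀ {m n} (a : Vector k₁.Carrier m) (b : Vector k₁.Carrier n) i →
          σ (append a b i) K.≈ append (λ i → σ (a i)) (λ i → σ (b i)) i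
        σ-append {zero} a b i = K.refl
        σ-append {suc m} a b zero = K.refl
        σ-append {suc m} a b (suc i) = σ-append (a ∘ suc) b i
        open ≈-Reasoning ≈ᴹ-setoid
        eq′ : ∀ x a y (c : Vector k₁.Carrier m) → x ≈ᴹ lc (λ i → σ (a i)) h +ᴹ π^ e *ₗ y →
          y ≈ᴹ lc (proj₁ ∘ c) g →
          x ≈ᴹ lc (λ i → σ (append a c i)) (append h (λ i → π^ e *ₗ g i)) +ᴹ
            π^ (suc e) *ₗ lc (λ i → π⁻¹ K.* (proj₁ (c i) K.+ K.- σ (c i))) g
        eq′ x a y c p q = begin
          x                                         ≈⟨ p ⟩
          lc (λ i → σ (a i)) h +ᴹ π^ e *ₗ y         ≈⟨ +ᴹ-congˡ (begin
            π^ e *ₗ y                   ≈⟨ *ₗ-congˡ q ⟩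
            π^ e *ₗ lc (proj₁ ∘ c) g    ≈⟨ *ₗ-congˡ (lc-cong g (λ i → decompose (proj₂ (c i)))) ⟩
            π^ e *ₗ lc (λ i → σ (c i) K.+ π K.* c′ i) g ≈⟨ *ₗ-congˡ (≈ᴹ-trans (lc-+ _ _ g) (+ᴹ-congˡ (lc-* π c′ g))) ⟩
            π^ e *ₗ (lc (λ i → σ (c i)) g +ᴹ π *ₗ lc c′ g) ≈⟨ *ₗ-distribˡ _ _ _ ⟩
            π^ e *ₗ lc (λ i → σ (c i)) g +ᴹ π^ e *ₗ (π *ₗ lc c′ g)
              ≈⟨ +ᴹ-cong (≈ᴹ-sym (lc-scaled (π^ e) _ g)) (≈ᴹ-trans (P.*-comm-* _ _ _) (≈ᴹ-sym (*ₗ-assoc _ _ _))) ⟩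
            lc (λ i → σ (c i)) (λ i → π^ e *ₗ g i) +ᴹ π^ (suc e) *ₗ lc c′ g ∎) ⟩
          lc (λ i → σ (a i)) h +ᴹ (lc (λ i → σ (c i)) (λ i → π^ e *ₗ g i) +ᴹ π^ (suc e) *ₗ lc c′ g) ≈⟨ +ᴹ-assoc _ _ _ ⟨
          (lc (λ i → σ (a i)) h +ᴹ lc (λ i → σ (c i)) (λ i → π^ e *ₗ g i)) +ᴹ π^ (suc e) *ₗ lc c′ g
            ≈⟨ +ᴹ-congʳ (≈ᴹ-trans (lc-cong _ (σ-append a c)) (lc-append K M _ _ h _)) ⟨
          lc (λ i → σ (append a c i)) (append h (λ i → π^ e *ₗ g i)) +ᴹ π^ (suc e) *ₗ lc c′ g ∎
          where
          c′ : Vector K.Carrier m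
          c′ i = π⁻¹ K.* (proj₁ (c i) K.+ K.- σ (c i))

      proj₁-lc : ∀ {n} (a : Vector k₁.Carrier n) (h : Vector (LeftModule.Carrierᴹ N) n) →
        proj₁ (linearCombination N a h) ≈ᴹ lc (λ i → σ (a i)) (proj₁ ∘ h)
      proj₁-lc {zero} a h = ≈ᴹ-refl
      proj₁-lc {suc n} a h = +ᴹ-congˡ (proj₁-lc (a ∘ suc) (h ∘ suc))

    rest-finite : IsFiniteModule (rest O σ₁ L L°)
    rest-finite = r , (λ i → h i , h∈L i) , λ (x , p) →
      let (a , y , q , eq) = hgen x p in a , L°.mem-resp
        (≈ᴹ-sym (≈ᴹ-trans (+ᴹ-cong eq (-ᴹ‿cong (proj₁-lc a (λ i → h i , h∈L i))))
          (≈ᴹ-trans (+ᴹ-congʳ (+ᴹ-comm _ _)) (≈ᴹ-trans (+ᴹ-assoc _ _ _)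
            (≈ᴹ-trans (+ᴹ-congˡ (-ᴹ‿inverseʳ _)) (+ᴹ-identityʳ _))))))
        (proj₂ (absorbs L L°) q)
      where
      e = proj₁ (absorbs L L°)
      r = proj₁ (generated e)
      h = proj₁ (proj₂ (generated e))
      h∈L = proj₁ (proj₂ (proj₂ (generated e)))
      hgen = proj₂ (proj₂ (proj₂ (generated e)))

  module _ {M M′ : Mod K} (R : LinearRelation {K = K} M M′)
    (C A : Lattice O M) (C′ A′ : Lattice O M′)
    (lifts : ∀ {x′} → x′ ∈ C′ → ∃ λ x → x ∈ C × LinearRelation.rel R x x′)
    (maps : ∀ {x x′} → x ∈ A → LinearRelation.rel R x x′ → x′ ∈ A′) where
    open LinearRelation R
    private
      module M = LeftModule M
      module M′ = LeftModule M′
      module A = Congruence (overO₁ O M) (Lattice.submodule A)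
      module A′ = Congruence (overO₁ O M′) (Lattice.submodule A′)

    -- The relation is saturated by both congruences so that it respects the equalities of the
    -- quotients. `lifts` makes it onto and `maps` gives `zero-image`; k₁-linearity holds because
    -- one lifting acts on both sides.
    subquotientRelation : LinearRelation {K = O.residueField} (rest O σ₁ C A) (rest O σ₁ C′ A′)
    subquotientRelation = record
      { rel = λ (x , _) (x′ , _) → ∃ λ y → ∃ λ y′ → x A.~ y × y′ A′.~ x′ × rel y y′
      ; rel-resp = λ p p′ (y , y′ , q , q′ , r) → y , y′ , A.~-trans (A.~-sym p) q , A′.~-trans q′ p′ , r
      ; rel-+ = λ (y , y′ , q , q′ , r) (z , z′ , s , s′ , t) →
          y M.+ᴹ z , y′ M′.+ᴹ z′ , A.~-+ q s , A′.~-+ q′ s′ , rel-+ r t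
      ; rel-* = λ a (y , y′ , q , q′ , r) → σ a M.*ₗ y , σ a M′.*ₗ y′ ,
          A.~-* (⟦ Lifting.σ σ₁ ⟧ a) q , A′.~-* (⟦ Lifting.σ σ₁ ⟧ a) q′ , rel-* (σ a) r
      ; onto = λ (x′ , p) → let (x , q , r) = lifts p in
          (x , q) , x , x′ , A.≈⇒~ M.≈ᴹ-refl , A′.≈⇒~ M′.≈ᴹ-refl , r
      ; zero-image = λ p (y , y′ , q , q′ , r) → A′.~-trans (A′.~-sym q′)
          (Submodule.mem-resp (Lattice.submodule A′) (M′.≈ᴹ-sym (ModuleProperties.minus-zero K M′ y′))
            (maps (Submodule.mem-resp (Lattice.submodule A) (ModuleProperties.minus-zero K M y)
              (A.~-trans (A.~-sym q) p)) r))
      }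

Uniformizers : ∀ {n} {K : CRing ℓ} → LocalField n K → Set ℓ
Uniformizers (dim0 _) = ⊤
Uniformizers (step _ O lf) = Uniformizer O × Uniformizers lf

module _ {𝕜 K : CRing ℓ} (ι : RingHom 𝕜 K) {M₁ M₂ M₁′ M₂′ : Mod K} where

  Compatible : (LeftModule.Carrierᴹ M₁ → LeftModule.Carrierᴹ M₁′ → Set ℓ) →
    (LeftModule.Carrierᴹ M₂ → LeftModule.Carrierᴹ M₂′ → Set ℓ) →
    Homₖ ι M₁ M₂ → Homₖ ι M₁′ M₂′ → Set ℓ
  Compatible R₁ R₂ φ φ′ = ∀ {x x′} → R₁ x x′ → R₂ (fun φ x) (fun φ′ x′)

module _ {𝕜 K : CRing ℓ} {ι : RingHom 𝕜 K} {M₁ M₂ : Mod K} (φ : Homₖ ι M₁ M₂) where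
  private
    module M₁ = LeftModule M₁
    module M₂ = LeftModule M₂
  open LeftModuleMorphisms.IsLeftModuleHomomorphism (Homₖ.isLinear φ)

  fun-minus : ∀ x y → fun φ (x M₁.+ᴹ M₁.-ᴹ y) M₂.≈ᴹ fun φ x M₂.+ᴹ M₂.-ᴹ fun φ y
  fun-minus x y = M₂.≈ᴹ-trans (+ᴹ-homo x (M₁.-ᴹ y)) (M₂.+ᴹ-congˡ (-ᴹ-homo y))

module _ (em : ExcludedMiddle ℓ) {𝕜 : CRing ℓ} where

  -- Stability of BT operators under K-linear subquotients of source and target. Lattice quotients
  -- of a subquotient are k₁-linear subquotients of lattice quotients of the original modules, so
  -- the statement reproduces itself one dimension lower.
  linear-transfer : ∀ {n} {K : CRing ℓ} (lf : LocalField n K) (ι : IntegralHom 𝕜 lf) (τ : TopologyOn K) →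
    Uniformizers lf → (σ : Liftings lf ι τ) → {M₁ M₂ M₁′ M₂′ : Mod K} →
    IsFiniteModule M₁ → IsFiniteModule M₂ →
    (R₁ : LinearRelation {K = K} M₁ M₁′) (R₂ : LinearRelation {K = K} M₂ M₂′) →
    (φ : Homₖ (IntegralHom.hom ι) M₁ M₂) (φ′ : Homₖ (IntegralHom.hom ι) M₁′ M₂′) →
    Compatible (IntegralHom.hom ι) {M₁} {M₂} {M₁′} {M₂′} (LinearRelation.rel R₁) (LinearRelation.rel R₂) φ φ′ →
    Transfer {lf = lf} {ι = ι} {τ = τ} σ σ {M₁} {M₂} {M₁′} {M₂′} φ φ′
  linear-transfer (dim0 _) ι τ us σ fin₁ fin₂ R₁ R₂ φ φ′ compatible = record
    { bt = λ _ → tt ; btᵢⱼ = λ () }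
  linear-transfer (step F O lf) ι τ (u , us) (σ₁ , dσ) {M₁} {M₂} {M₁′} {M₂′} fin₁ fin₂ R₁ R₂ φ φ′ compatible =
    transfer-step tame₁ tame₂ compatible reduce
    where
    open Lattices em F O u
    open LiftingProperties em O u {lf} {ι} {τ} σ₁
    open TransferStep em O u {lf} {ι} {τ} σ₁ σ₁ dσ dσ {M₁} {M₂} {M₁′} {M₂′} φ φ′
    tame₁ = LinearRelationLattices.tame em F O u {M₁} {M₁′} R₁ fin₁
    tame₂ = LinearRelationLattices.tame em F O u {M₂} {M₂′} R₂ fin₂
    module R₁ = Tame tame₁
    module R₂ = Tame tame₂

    reduce : Refinable → ∀ {C′ A′ : Lattice O M₁′} {D′ B′ : Lattice O M₂′}
      (r′ : _≺[_]_ O (A′ , B′) (fun φ′) (C′ , D′)) →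
      ∃ λ (C : Lattice O M₁) → ∃ λ (A : Lattice O M₁) → ∃ λ (D : Lattice O M₂) → ∃ λ (B : Lattice O M₂) →
      Σ (_≺[_]_ O (A , B) (fun φ) (C , D)) λ r →
      Transfer {lf = lf} {ι = residueHom O ι} {τ = residueTopology O τ} dσ dσ
        {rest O σ₁ C A} {rest O σ₁ B D} {rest O σ₁ C′ A′} {rest O σ₁ B′ D′}
        (inducedMap O {ι = ι} {τ = τ} σ₁ {M₁} {M₂} φ {C} {A} {D} {B} r)
        (inducedMap O {ι = ι} {τ = τ} σ₁ {M₁′} {M₂′} φ′ {C′} {A′} {D′} {B′} r′)
    reduce refinable {C′} {A′} {D′} {B′} r′ = C , A , D , B , r ,
      linear-transfer lf (residueHom O ι) (residueTopology O τ) us dσ {rest O σ₁ C A} {rest O σ₁ B D} {rest O σ₁ C′ A′} {rest O σ₁ B′ D′}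
        (rest-finite {M₁} C A) (rest-finite {M₂} B D)
        (subquotientRelation R₁ C A C′ A′ C-lifts A-maps) (subquotientRelation R₂ B D B′ D′ B-lifts D-maps)
        (inducedMap O {ι = ι} {τ = τ} σ₁ {M₁} {M₂} φ {C} {A} {D} {B} r)
        (inducedMap O {ι = ι} {τ = τ} σ₁ {M₁′} {M₂′} φ′ {C′} {A′} {D′} {B′} r′) (λ {x} {x′} → compatible′ {x} {x′})
      where
      C = proj₁ (R₁.cover C′)
      C-lifts = proj₂ (R₁.cover C′)
      D = proj₁ (R₂.domain D′)
      D-maps = proj₂ (R₂.domain D′)
      A₁ = R₁.domain A′
      B₁ = R₂.cover B′
      refinement = refinable (C , D)
      module r₀ = _≺[_]_ (proj₂ refinement)
      -- C and D are fixed before refining. A refinement of (C, D) remains one when A shrinks and B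
      -- grows, which leaves room to adapt A to A′ and B to B′.
      A₂ = lowerBound (proj₁ (proj₁ refinement)) (proj₁ A₁)
      B₂ = upperBound (proj₂ (proj₁ refinement)) (proj₁ B₁)
      A = proj₁ A₂
      B = proj₁ B₂
      A-maps : ∀ {x x′} → x ∈ A → LinearRelation.rel R₁ x x′ → x′ ∈ A′
      A-maps p = proj₂ A₁ (proj₂ (proj₂ A₂) p)
      B-lifts : ∀ {x′} → x′ ∈ B′ → ∃ λ x → x ∈ B × LinearRelation.rel R₂ x x′
      B-lifts p = let (x , q , s) = proj₂ B₁ p in x , proj₂ (proj₂ B₂) q , s
      r : _≺[_]_ O (A , B) (fun φ) (C , D)
      r = record
        { shrink = λ p → r₀.shrink (proj₁ (proj₂ A₂) p)
        ; grow = λ p → proj₁ (proj₂ B₂) (r₀.grow p)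
        ; maps′ = λ p → r₀.maps′ (proj₁ (proj₂ A₂) p)
        ; maps = λ p → proj₁ (proj₂ B₂) (r₀.maps p)
        }
      compatible′ : Compatible (IntegralHom.hom (residueHom O ι))
        {rest O σ₁ C A} {rest O σ₁ B D} {rest O σ₁ C′ A′} {rest O σ₁ B′ D′}
        (LinearRelation.rel (subquotientRelation R₁ C A C′ A′ C-lifts A-maps))
        (LinearRelation.rel (subquotientRelation R₂ B D B′ D′ B-lifts D-maps))
        (inducedMap O {ι = ι} {τ = τ} σ₁ {M₁} {M₂} φ {C} {A} {D} {B} r)
        (inducedMap O {ι = ι} {τ = τ} σ₁ {M₁′} {M₂′} φ′ {C′} {A′} {D′} {B′} r′)
      compatible′ {x , _} {x′ , _} (y , y′ , p , p′ , s) = fun φ y , fun φ′ y′ ,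
        Submodule.mem-resp (Lattice.submodule D) (fun-minus φ x y) (_≺[_]_.maps′ r p) ,
        Submodule.mem-resp (Lattice.submodule D′) (fun-minus φ′ y′ x′) (_≺[_]_.maps′ r′ p′) ,
        compatible s

-- Commuting structures and common lattices

module Submodules {R : CRing ℓ} (M : Mod R) where
  open LeftModule M

  wholeSubmodule : Submodule M
  wholeSubmodule = record
    { mem = λ _ → ⊤ ; mem-resp = λ _ _ → tt ; mem-+ = λ _ _ → tt ; mem-0 = tt ; mem-* = λ _ _ → tt }

  infixl 6 _∩ˢ_
  _∩ˢ_ : Submodule M → Submodule M → Submodule M
  N ∩ˢ N′ = record
    { mem = λ x → N.mem x × N′.mem x
    ; mem-resp = λ e (p , q) → N.mem-resp e p , N′.mem-resp e q
    ; mem-+ = λ (p , q) (p′ , q′) → N.mem-+ p p′ , N′.mem-+ q q′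
    ; mem-0 = N.mem-0 , N′.mem-0
    ; mem-* = λ c (p , q) → N.mem-* c p , N′.mem-* c q
    }
    where
    module N = Submodule N
    module N′ = Submodule N′

module _ {𝕜 R : CRing ℓ} (κ : RingHom 𝕜 R) (M : Mod R) where
  open LeftModule M

  preimage* : CommutativeRing.Carrier R → Submodule (restrictScalars κ M) → Submodule (restrictScalars κ M)
  preimage* a N = record
    { mem = λ x → N.mem (a *ₗ x)
    ; mem-resp = λ e → N.mem-resp (*ₗ-congˡ e)
    ; mem-+ = λ p q → N.mem-resp (≈ᴹ-sym (*ₗ-distribˡ a _ _)) (N.mem-+ p q)
    ; mem-0 = N.mem-resp (≈ᴹ-sym (*ₗ-zeroʳ a)) N.mem-0
    ; mem-* = λ c p → N.mem-resp (ModuleProperties.*-comm-* R M (⟦ κ ⟧ c) a _) (N.mem-* c p)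
    }
    where module N = Submodule N

module _ {𝕜 K : CRing ℓ} (κ : RingHom 𝕜 K) (τ : TopologyOn K) where
  private module K = CommutativeRing K

  record OpenSubmodule : Set (lsuc ℓ) where
    field
      submodule : Submodule (restrictScalars κ (regular K))
      isOpen : Open τ (mem submodule)
    open Submodule submodule public

  -- The consequences of the ST axioms that are carried down to the residue fields.
  record LinearRing : Set (lsuc ℓ) where
    field
      translate : ∀ c → Continuous τ τ (c K.+_)
      multiply : ∀ a → Continuous τ τ (a K.*_)
      linear-basis : ∀ U → Open τ U → U K.0# → Σ OpenSubmodule λ N → OpenSubmodule.mem N ⊆ U

    scaleOpen : ∀ a (N : OpenSubmodule) → Σ OpenSubmodule λ N′ →
      ∀ {x} → OpenSubmodule.mem N′ x → OpenSubmodule.mem N (a K.* x)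
    scaleOpen a N = record
      { submodule = preimage* κ (regular K) a N.submodule
      ; isOpen = multiply a N.mem N.isOpen
      } , λ p → p
      where module N = OpenSubmodule N

  intersectOpen : (N N′ : OpenSubmodule) → Σ OpenSubmodule λ P →
    ∀ {x} → OpenSubmodule.mem P x → OpenSubmodule.mem N x × OpenSubmodule.mem N′ x
  intersectOpen N N′ = record
    { submodule = Submodules._∩ˢ_ {R = 𝕜} (restrictScalars κ (regular K)) N.submodule N′.submodule
    ; isOpen = Topology.Open-∩ τ N.isOpen N′.isOpen
    } , λ p → p
    where
    module N = OpenSubmodule N
    module N′ = OpenSubmodule N′

  wholeOpen : OpenSubmodule
  wholeOpen = record
    { submodule = Submodules.wholeSubmodule {R = 𝕜} (restrictScalars κ (regular K))
    ; isOpen = Topology.Open-whole τ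
    }

  intersectVector : ∀ {r} (N : Vector OpenSubmodule r) → Σ OpenSubmodule λ P →
    ∀ {x} → OpenSubmodule.mem P x → ∀ i → OpenSubmodule.mem (N i) x
  intersectVector {zero} N = wholeOpen , λ _ ()
  intersectVector {suc r} N = proj₁ P , λ p →
    λ { zero → proj₁ (proj₂ P p) ; (suc i) → proj₂ (intersectVector (N ∘ suc)) (proj₂ (proj₂ P p)) i }
    where P = intersectOpen (N zero) (proj₁ (intersectVector (N ∘ suc)))

module _ {𝕜 K : CRing ℓ} (κ : RingHom 𝕜 K) (τ : TopologyOn K) (O : CDVRIn K) (u : Uniformizer O) where
  private
    module K = CommutativeRing K
    module O = CDVRIn O
  open Uniformizer u

  record AdaptedTopology : Set (lsuc ℓ) where
    field
      linearRing : LinearRing κ τ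
      adic : (N : OpenSubmodule κ τ) → ∃ λ m → ∀ {a} → O.mem a → OpenSubmodule.mem N (π^ m K.* a)
      -- Makes unboundedness visible to the topology: a sequence whose m-th term has a pole of
      -- order more than m misses some open submodule.
      separates : (c : ℕ → K.Carrier) → Σ (OpenSubmodule κ τ) λ N →
        ∀ m → OpenSubmodule.mem N (c m) → O.mem (π^ m K.* c m)
    open LinearRing linearRing public

module _ {R : CRing ℓ} (M : Mod R) where
  open LeftModule M

  -- Only the addition enters, so the notion is common to two module structures on one group.
  record IsAdditive (U : Pred Carrierᴹ ℓ) : Set ℓ where
    field
      U-resp : U Respects _≈ᴹ_
      U-+ : ∀ {x y} → U x → U y → U (x +ᴹ y)

module _ {𝕜 K : CRing ℓ} (κ : RingHom 𝕜 K) (τ : TopologyOn K) (M : Mod K) where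
  open LeftModule M

  -- For an additive subgroup this is openness in the fine topology of M.
  FineOpen : Pred Carrierᴹ ℓ → Set (lsuc ℓ)
  FineOpen U = ∀ x → Σ (OpenSubmodule κ τ) λ N → ∀ {b} → OpenSubmodule.mem N b → U (b *ₗ x)

module _ {K : CRing ℓ} (M M′ : Mod K) where
  private
    module K = CommutativeRing K
    module M = LeftModule M
    module M′ = LeftModule M′

  -- Two commuting K-module structures on one abelian group, written s(a) x = a *ₗ x and
  -- s′(b) x = b • x, the second one being transported from the isomorphic copy M′.
  record CommutingStructures : Set ℓ where
    field
      to : M.Carrierᴹ → M′.Carrierᴹ
      from : M′.Carrierᴹ → M.Carrierᴹ
      to-cong : ∀ {x y} → x M.≈ᴹ y → to x M′.≈ᴹ to y
      from-cong : ∀ {x y} → x M′.≈ᴹ y → from x M.≈ᴹ from y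
      to-+ : ∀ x y → to (x M.+ᴹ y) M′.≈ᴹ to x M′.+ᴹ to y
      from-+ : ∀ x y → from (x M′.+ᴹ y) M.≈ᴹ from x M.+ᴹ from y
      to-from : ∀ y → to (from y) M′.≈ᴹ y
      from-to : ∀ x → from (to x) M.≈ᴹ x
      commute : ∀ a b x → a M.*ₗ from (b M′.*ₗ to x) M.≈ᴹ from (b M′.*ₗ to (a M.*ₗ x))

    infixr 7 _•_
    _•_ : K.Carrier → M.Carrierᴹ → M.Carrierᴹ
    b • x = from (b M′.*ₗ to x)

    difference : K.Carrier → M.Carrierᴹ → M.Carrierᴹ
    difference a x = a M.*ₗ x M.+ᴹ M.-ᴹ (a • x)

    -- x is killed by all products of N operators s(a) − s′(a).
    Nil : ℕ → Pred M.Carrierᴹ ℓ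
    Nil zero x = x M.≈ᴹ M.0ᴹ
    Nil (suc N) x = ∀ a → Nil N (difference a x)

    to-0 : to M.0ᴹ M′.≈ᴹ M′.0ᴹ
    to-0 = GroupProperties.identityʳ-unique M′.+ᴹ-group _ _
      (M′.≈ᴹ-trans (M′.≈ᴹ-sym (to-+ M.0ᴹ M.0ᴹ)) (to-cong (M.+ᴹ-identityˡ M.0ᴹ)))

    to-neg : ∀ x → to (M.-ᴹ x) M′.≈ᴹ M′.-ᴹ to x
    to-neg x = ModuleProperties.inverseˡ-uniqueᴹ K M′ _ _
      (M′.≈ᴹ-trans (M′.≈ᴹ-sym (to-+ _ _)) (M′.≈ᴹ-trans (to-cong (M.-ᴹ‿inverseˡ x)) to-0))

    •-cong : ∀ b {x y} → x M.≈ᴹ y → b • x M.≈ᴹ b • y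
    •-cong b e = from-cong (M′.*ₗ-congˡ (to-cong e))

    •-+ : ∀ b x y → b • (x M.+ᴹ y) M.≈ᴹ b • x M.+ᴹ b • y
    •-+ b x y = M.≈ᴹ-trans (from-cong (M′.≈ᴹ-trans (M′.*ₗ-congˡ (to-+ x y)) (M′.*ₗ-distribˡ b _ _))) (from-+ _ _)

    to-• : ∀ b x → to (b • x) M′.≈ᴹ b M′.*ₗ to x
    to-• b x = to-from _

    •-from : ∀ b y → b • from y M.≈ᴹ from (b M′.*ₗ y)
    •-from b y = from-cong (M′.*ₗ-congˡ (to-from y))

    •-assoc : ∀ b a x → (b K.* a) • x M.≈ᴹ b • a • x
    •-assoc b a x = from-cong (M′.≈ᴹ-trans (M′.*ₗ-assoc b a _) (M′.*ₗ-congˡ (M′.≈ᴹ-sym (to-• a x))))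

    Nil-resp : ∀ N {x y} → x M.≈ᴹ y → Nil N x → Nil N y
    Nil-resp zero e p = M.≈ᴹ-trans (M.≈ᴹ-sym e) p
    Nil-resp (suc N) e p a = Nil-resp N (M.+ᴹ-cong (M.*ₗ-congˡ e) (M.-ᴹ‿cong (•-cong a e))) (p a)

  module _ (T : CommutingStructures) where
    open CommutingStructures T

    •-zero : ∀ b {x} → x M.≈ᴹ M.0ᴹ → b • x M.≈ᴹ M.0ᴹ
    •-zero b p = M.≈ᴹ-trans (•-cong b p) (M.≈ᴹ-trans (from-cong
      (M′.≈ᴹ-trans (M′.*ₗ-congˡ to-0) (M′.≈ᴹ-trans (M′.*ₗ-zeroʳ b) (M′.≈ᴹ-sym to-0)))) (from-to _))

    difference-+ : ∀ a x y → difference a (x M.+ᴹ y) M.≈ᴹ difference a x M.+ᴹ difference a y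
    difference-+ a x y = M.≈ᴹ-trans (M.+ᴹ-cong (M.*ₗ-distribˡ a x y)
        (M.≈ᴹ-trans (M.-ᴹ‿cong (•-+ a x y)) (M.≈ᴹ-sym (P.⁻¹-∙-comm _ _))))
      (P.interchange _ _ _ _)
      where module P = ModuleProperties K M

    -- Commutation makes s(a) - s′(a) linear for s, and likewise for s′ in `difference-•`. Therefore
    -- the vectors in `Nil N` are stable under both structures.
    difference-* : ∀ a b x → difference a (b M.*ₗ x) M.≈ᴹ b M.*ₗ difference a x
    difference-* a b x = M.≈ᴹ-trans (M.+ᴹ-cong (P.*-comm-* a b x)
        (M.≈ᴹ-trans (M.-ᴹ‿cong (M.≈ᴹ-sym (commute b a x))) (M.≈ᴹ-sym (P.-‿*ʳ b _))))
      (M.≈ᴹ-sym (M.*ₗ-distribˡ b _ _))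
      where module P = ModuleProperties K M

    difference-neg : ∀ a x → difference a (M.-ᴹ x) M.≈ᴹ M.-ᴹ (difference a x)
    difference-neg a x = begin
      difference a (M.-ᴹ x)              ≈⟨ M.+ᴹ-cong (M.*ₗ-congˡ -x) (M.-ᴹ‿cong (•-cong a -x)) ⟩
      difference a ((K.- K.1#) M.*ₗ x)   ≈⟨ difference-* a (K.- K.1#) x ⟩
      (K.- K.1#) M.*ₗ difference a x     ≈⟨ P.-‿*ˡ K.1# _ ⟩
      M.-ᴹ (K.1# M.*ₗ difference a x)    ≈⟨ M.-ᴹ‿cong (M.*ₗ-identityˡ _) ⟩
      M.-ᴹ (difference a x)              ∎
      where
      open ≈-Reasoning M.≈ᴹ-setoid
      module P = ModuleProperties K M
      -x : M.-ᴹ x M.≈ᴹ (K.- K.1#) M.*ₗ x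
      -x = M.≈ᴹ-sym (M.≈ᴹ-trans (P.-‿*ˡ K.1# x) (M.-ᴹ‿cong (M.*ₗ-identityˡ x)))

    Nil-+ : ∀ N {x y} → Nil N x → Nil N y → Nil N (x M.+ᴹ y)
    Nil-+ zero p q = M.≈ᴹ-trans (M.+ᴹ-cong p q) (M.+ᴹ-identityˡ _)
    Nil-+ (suc N) p q a = Nil-resp N (M.≈ᴹ-sym (difference-+ a _ _)) (Nil-+ N (p a) (q a))

    Nil-zero : ∀ N {x} → x M.≈ᴹ M.0ᴹ → Nil N x
    Nil-zero zero p = p
    Nil-zero (suc N) p a = Nil-zero N (M.≈ᴹ-trans
      (M.+ᴹ-cong (M.≈ᴹ-trans (M.*ₗ-congˡ p) (M.*ₗ-zeroʳ a)) (M.-ᴹ‿cong (•-zero a p))) (M.-ᴹ‿inverseʳ _))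

    Nil-neg : ∀ N {x} → Nil N x → Nil N (M.-ᴹ x)
    Nil-neg zero p = M.≈ᴹ-trans (M.-ᴹ‿cong p) (GroupProperties.ε⁻¹≈ε M.+ᴹ-group)
    Nil-neg (suc N) p a = Nil-resp N (M.≈ᴹ-sym (difference-neg a _)) (Nil-neg N (p a))

    Nil-* : ∀ N b {x} → Nil N x → Nil N (b M.*ₗ x)
    Nil-* zero b p = M.≈ᴹ-trans (M.*ₗ-congˡ p) (M.*ₗ-zeroʳ b)
    Nil-* (suc N) b p a = Nil-resp N (M.≈ᴹ-sym (difference-* a b _)) (Nil-* N b (p a))

    difference-• : ∀ a b x → difference a (b • x) M.≈ᴹ b • difference a x
    difference-• a b x = M.≈ᴹ-trans (M.+ᴹ-cong (commute a b x) (begin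
        M.-ᴹ (a • b • x)       ≈⟨ M.-ᴹ‿cong (•-comm a b x) ⟩
        M.-ᴹ (b • a • x)       ≈⟨ P.inverseˡ-uniqueᴹ _ _ (M.≈ᴹ-trans (M.≈ᴹ-sym (•-+ b _ _))
             (•-zero b (M.-ᴹ‿inverseˡ _))) ⟨
        b • M.-ᴹ (a • x)       ∎)) (M.≈ᴹ-sym (•-+ b _ _))
      where
      open ≈-Reasoning M.≈ᴹ-setoid
      module P = ModuleProperties K M
      •-comm : ∀ a b x → a • b • x M.≈ᴹ b • a • x
      •-comm a b x = from-cong (M′.≈ᴹ-trans (M′.*ₗ-congˡ (to-• b x))
        (M′.≈ᴹ-trans (ModuleProperties.*-comm-* K M′ a b (to x)) (M′.*ₗ-congˡ (M′.≈ᴹ-sym (to-• a x)))))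

    Nil-• : ∀ N b {x} → Nil N x → Nil N (b • x)
    Nil-• zero b p = •-zero b p
    Nil-• (suc N) b p a = Nil-resp N (M.≈ᴹ-sym (difference-• a b _)) (Nil-• N b (p a))

flipStructures : {K : CRing ℓ} {M M′ : Mod K} → CommutingStructures {K = K} M M′ → CommutingStructures {K = K} M′ M
flipStructures {K = K} {M} {M′} T = record
  { to = from
  ; from = to
  ; to-cong = from-cong
  ; from-cong = to-cong
  ; to-+ = from-+
  ; from-+ = to-+
  ; to-from = from-to
  ; from-to = to-from
  ; commute = λ a b y → M′.≈ᴹ-trans (M′.≈ᴹ-sym (to-• a (b M.*ₗ from y)))
      (to-cong (M.≈ᴹ-trans (M.≈ᴹ-sym (commute b a (from y))) (M.*ₗ-congˡ (•-from a y))))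
  }
  where
  open CommutingStructures T
  module M = LeftModule M
  module M′ = LeftModule M′

module _ {K : CRing ℓ} {M M′ : Mod K} (T : CommutingStructures {K = K} M M′) where
  open CommutingStructures T
  private
    module M = LeftModule M
    module M′ = LeftModule M′
    module T′ = CommutingStructures (flipStructures T)

  -- Exchanging the structures only changes the sign of each difference operator.
  Nil-flip : ∀ N {x} → Nil N x → T′.Nil N (to x)
  Nil-flip zero p = M′.≈ᴹ-trans (to-cong p) to-0
  Nil-flip (suc N) {x} p a = T′.Nil-resp N (begin
    to (M.-ᴹ (difference a x))                         ≈⟨ to-neg _ ⟩
    M′.-ᴹ to (difference a x)                          ≈⟨ M′.-ᴹ‿cong (to-+ _ _) ⟩
    M′.-ᴹ (to (a M.*ₗ x) M′.+ᴹ to (M.-ᴹ (a • x)))      ≈⟨ M′.-ᴹ‿cong (M′.+ᴹ-congˡ (M′.≈ᴹ-trans (to-neg _) (M′.-ᴹ‿cong (to-• a x)))) ⟩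
    M′.-ᴹ (to (a M.*ₗ x) M′.+ᴹ M′.-ᴹ (a M′.*ₗ to x))   ≈⟨ P.⁻¹-∙-comm _ _ ⟨
    M′.-ᴹ to (a M.*ₗ x) M′.+ᴹ M′.-ᴹ (M′.-ᴹ (a M′.*ₗ to x)) ≈⟨ M′.+ᴹ-cong (M′.-ᴹ‿cong (to-cong (M.*ₗ-congˡ (M.≈ᴹ-sym (from-to x))))) (P.-ᴹ-involutive _) ⟩
    M′.-ᴹ to (a M.*ₗ from (to x)) M′.+ᴹ a M′.*ₗ to x   ≈⟨ M′.+ᴹ-comm _ _ ⟩
    T′.difference a (to x)                             ∎)
    (Nil-flip N (Nil-neg M M′ T N (p a)))
    where
    open ≈-Reasoning M′.≈ᴹ-setoid
    module P = ModuleProperties K M′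

module _ {𝕜 K : CRing ℓ} (κ : RingHom 𝕜 K) (τ : TopologyOn K) where

  -- The invariant of the induction on the dimension. `fine-to` and `fine-from` express that the two
  -- fine topologies agree, tested on additive subsets.
  record Comparison (M M′ : Mod K) : Set (lsuc ℓ) where
    field
      structures : CommutingStructures {K = K} M M′
      finite : IsFiniteModule M
      finite′ : IsFiniteModule M′
    open CommutingStructures structures public
    field
      nilpotent : ∀ x → ∃ λ N → Nil N x
      fine-to : ∀ U → IsAdditive {R = K} M U → FineOpen κ τ M U → FineOpen κ τ M′ (U ∘ from)
      fine-from : ∀ U → IsAdditive {R = K} M′ U → FineOpen κ τ M′ U → FineOpen κ τ M (U ∘ to)

  flip : {M M′ : Mod K} → Comparison M M′ → Comparison M′ M
  flip {M} {M′} C = record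
    { structures = flipStructures structures
    ; finite = finite′
    ; finite′ = finite
    ; nilpotent = λ y → proj₁ (nilpotent (from y)) , CommutingStructures.Nil-resp (flipStructures structures) (proj₁ (nilpotent (from y))) (to-from y)
        (Nil-flip structures (proj₁ (nilpotent (from y))) (proj₂ (nilpotent (from y))))
    ; fine-to = fine-from
    ; fine-from = fine-to
    }
    where open Comparison C

-- Boundedness of lattices with respect to the other structure

module TopologicalCoordinates (em : ExcludedMiddle ℓ) {𝕜 K : CRing ℓ} (κ : RingHom 𝕜 K) (τ : TopologyOn K)
  (F : IsField K) (O : CDVRIn K) (u : Uniformizer O) (linearRing : LinearRing κ τ) {M : Mod K} where
  open Lattices em F O u
  open LinearRing linearRing
  private
    module K = CommutativeRing K
    module M = LeftModule M

  module CoordinateBox {L : Lattice O M} (B : LatticeBasis L) where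
    private module B = LatticeBasis B

    module _ (N : Vector (OpenSubmodule κ τ) B.rank) where
      private module N j = OpenSubmodule (N j)

      box : Pred M.Carrierᴹ ℓ
      box y = ∀ j → N.mem j (B.coord y j)

      box-additive : IsAdditive {R = K} M box
      box-additive = record
        { U-resp = λ e p j → N.mem-resp j (B.coord-cong e j) (p j)
        ; U-+ = λ p q j → N.mem-resp j (K.sym (B.coord-+ _ _ j)) (N.mem-+ j (p j) (q j))
        }

      -- The coordinates of by are b times those of y, so b has to lie in finitely many preimages of
      -- open submodules under multiplication by a fixed element.
      box-open : FineOpen κ τ M box
      box-open y = proj₁ N′ , λ p j → N.mem-resp j (K.trans (K.*-comm _ _) (K.sym (B.coord-* _ y j)))
          (proj₂ (scaleOpen (B.coord y j) (N j)) (proj₂ N′ p j))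
        where N′ = intersectVector κ τ (λ j → proj₁ (scaleOpen (B.coord y j) (N j)))

module Boundedness (em : ExcludedMiddle ℓ) {𝕜 K : CRing ℓ} (κ : RingHom 𝕜 K) (τ : TopologyOn K)
  (F : IsField K) (O : CDVRIn K) (u : Uniformizer O) (adapted : AdaptedTopology κ τ O u)
  {M M′ : Mod K} (C : Comparison κ τ M M′) where
  open Lattices em F O u
  open AdaptedTopology adapted
  open Comparison C
  open TopologicalCoordinates em κ τ F O u linearRing {M′}
  private
    module K = CommutativeRing K
    module O = CDVRIn O
    module M = LeftModule M
    module M′ = LeftModule M′
    module P = ModuleProperties K M
    module P′ = ModuleProperties K M′

    L₀ : Lattice O M′
    L₀ = someLattice {M = M′} finite′
    module L₀ = Submodule (Lattice.submodule L₀)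
    B₀ : LatticeBasis L₀
    B₀ = latticeBasis {M = M′} finite′ L₀
    module B = LatticeBasis B₀

    open CoordinateBox B₀ renaming (box to B-box)

    Bounded : M.Carrierᴹ → ℕ → Set ℓ
    Bounded v m = ∀ {a} → O.mem a → π^ m M′.*ₗ to (a M.*ₗ v) ∈ L₀

    -- One m measures both how small the scalars are and how large a pole is allowed. Failure for
    -- every m then yields a single sequence of the kind that `separates` handles.
    FirstStep : M.Carrierᴹ → ℕ → Set ℓ
    FirstStep v m = ∀ a → O.mem a → π^ m M′.*ₗ to ((π^ m K.* a) M.*ₗ v) ∈ L₀

    Escapes : M.Carrierᴹ → ℕ → Set ℓ
    Escapes v m = ∃ λ a → ∃ λ j → O.mem a × ¬ O.mem (π^ m K.* B.coord (to ((π^ m K.* a) M.*ₗ v)) j)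

    firstStep-or-escapes : ∀ v m → ¬ Escapes v m → FirstStep v m
    firstStep-or-escapes v m ¬e a a∈O = B.integral⇒∈ _ λ j → Subring.mem-resp O.subring
      (K.sym (B.coord-* (π^ m) _ j)) (decidable-stable em λ ¬p → ¬e (a , j , a∈O , ¬p))

    -- A box missing the escaping coordinates is open for s′, hence for s, so it contains s(πᵐO)v
    -- for some m. At exactly this m the escaping coordinate lies in the excluded submodule and its
    -- pole is too small.
    not-all-escape : ∀ v → ¬ (∀ m → Escapes v m)
    not-all-escape v e = proj₂ (proj₂ (proj₂ (e m))) (proj₂ (separates c) m
      (proj₂ N-nbhd (proj₂ (adic (proj₁ N-nbhd)) (proj₁ (proj₂ (proj₂ (e m))))) (proj₁ (proj₂ (e m)))))
      where
      c : ℕ → K.Carrier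
      c m = B.coord (to ((π^ m K.* proj₁ (e m)) M.*ₗ v)) (proj₁ (proj₂ (e m)))
      -- The same submodule in all coordinates, because the coordinate that escapes varies with m.
      box = λ (_ : Fin B.rank) → proj₁ (separates c)
      N-nbhd = fine-from (B-box box) (box-additive box) (box-open box) v
      m = proj₁ (adic (proj₁ N-nbhd))

    firstStep : ∀ v → ∃ λ m → FirstStep v m
    firstStep v = decidable-stable em λ ¬s → not-all-escape v λ m →
      decidable-stable em λ ¬e → ¬s (m , firstStep-or-escapes v m ¬e)

    -- By nilpotency the claim is known for w = (s(πᵐ) − s′(πᵐ)) v, and
    -- s(a) v = s′(π⁻ᵐ) (s(a πᵐ) v − s(a) w).
    bounded-orbit : ∀ N {v} → Nil N v → ∃ λ m → Bounded v m
    bounded-orbit zero p = 0 , λ _ → L₀.mem-resp (M′.≈ᴹ-sym (M′.≈ᴹ-trans (M′.*ₗ-congˡ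
      (M′.≈ᴹ-trans (to-cong (M.≈ᴹ-trans (M.*ₗ-congˡ p) (M.*ₗ-zeroʳ _))) to-0)) (M′.*ₗ-zeroʳ _))) L₀.mem-0
    -- One m pays for applying s′(πᵐ), the other one is the bound of `FirstStep`, and m′ bounds the
    -- orbit of w.
    bounded-orbit (suc N) {v} p = m′ ℕ.+ (m ℕ.+ m) , bounded
      where
      open ≈-Reasoning M′.≈ᴹ-setoid
      m = proj₁ (firstStep v)
      w = difference (π^ m) v
      m′ = proj₁ (bounded-orbit N (p (π^ m)))
      identity : ∀ a → π^ m M′.*ₗ to (a M.*ₗ v) M′.≈ᴹ to ((π^ m K.* a) M.*ₗ v) M′.+ᴹ M′.-ᴹ to (a M.*ₗ w)
      identity a = begin
        π^ m M′.*ₗ to (a M.*ₗ v)                       ≈⟨ to-• _ _ ⟨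
        to (π^ m • (a M.*ₗ v))                         ≈⟨ to-cong (commute a (π^ m) v) ⟨
        to (a M.*ₗ (π^ m • v))                         ≈⟨ to-cong (M.*ₗ-congˡ π•v) ⟩
        to (a M.*ₗ (π^ m M.*ₗ v M.+ᴹ M.-ᴹ w))          ≈⟨ to-cong (M.≈ᴹ-trans (M.*ₗ-distribˡ a _ _)
             (M.+ᴹ-cong (M.≈ᴹ-trans (P.*-comm-* a _ v) (M.≈ᴹ-sym (M.*ₗ-assoc _ _ v))) (P.-‿*ʳ a w))) ⟩
        to ((π^ m K.* a) M.*ₗ v M.+ᴹ M.-ᴹ (a M.*ₗ w))  ≈⟨ M′.≈ᴹ-trans (to-+ _ _) (M′.+ᴹ-congˡ (to-neg _)) ⟩
        to ((π^ m K.* a) M.*ₗ v) M′.+ᴹ M′.-ᴹ to (a M.*ₗ w) ∎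
        where
        π•v : π^ m • v M.≈ᴹ π^ m M.*ₗ v M.+ᴹ M.-ᴹ w
        π•v = M.≈ᴹ-sym (M.≈ᴹ-trans (M.+ᴹ-congˡ (M.≈ᴹ-sym (P.⁻¹-∙-comm _ _)))
          (M.≈ᴹ-trans (M.≈ᴹ-sym (M.+ᴹ-assoc _ _ _)) (M.≈ᴹ-trans (M.+ᴹ-cong (M.-ᴹ‿inverseʳ _) (P.-ᴹ-involutive _))
            (M.+ᴹ-identityˡ _))))
      bounded : Bounded v (m′ ℕ.+ (m ℕ.+ m))
      bounded {a} a∈O = L₀.mem-resp (begin
          π^ m′ M′.*ₗ (π^ m M′.*ₗ to ((π^ m K.* a) M.*ₗ v)) M′.+ᴹ M′.-ᴹ (π^ m M′.*ₗ (π^ m′ M′.*ₗ to (a M.*ₗ w)))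
            ≈⟨ M′.+ᴹ-congˡ (M′.≈ᴹ-trans (M′.-ᴹ‿cong (P′.*-comm-* _ _ _)) (M′.≈ᴹ-sym
                 (M′.≈ᴹ-trans (M′.*ₗ-congˡ (P′.-‿*ʳ _ _)) (P′.-‿*ʳ _ _)))) ⟩
          π^ m′ M′.*ₗ (π^ m M′.*ₗ to ((π^ m K.* a) M.*ₗ v)) M′.+ᴹ π^ m′ M′.*ₗ (π^ m M′.*ₗ (M′.-ᴹ to (a M.*ₗ w)))
            ≈⟨ M′.≈ᴹ-trans (M′.*ₗ-congˡ (M′.*ₗ-distribˡ _ _ _)) (M′.*ₗ-distribˡ _ _ _) ⟨
          π^ m′ M′.*ₗ (π^ m M′.*ₗ (to ((π^ m K.* a) M.*ₗ v) M′.+ᴹ M′.-ᴹ to (a M.*ₗ w)))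
            ≈⟨ M′.*ₗ-congˡ (M′.*ₗ-congˡ (identity a)) ⟨
          π^ m′ M′.*ₗ (π^ m M′.*ₗ (π^ m M′.*ₗ to (a M.*ₗ v)))
            ≈⟨ M′.*ₗ-congˡ (M′.≈ᴹ-trans (M′.*ₗ-congʳ (π^-+ m m)) (M′.*ₗ-assoc _ _ _)) ⟨
          π^ m′ M′.*ₗ (π^ (m ℕ.+ m) M′.*ₗ to (a M.*ₗ v))
            ≈⟨ M′.≈ᴹ-trans (M′.*ₗ-congʳ (π^-+ m′ (m ℕ.+ m))) (M′.*ₗ-assoc _ _ _) ⟨
          π^ (m′ ℕ.+ (m ℕ.+ m)) M′.*ₗ to (a M.*ₗ v) ∎)
        (L₀.mem-+ (L₀.mem-* (π^ m′ , π^∈O m′) (proj₂ (firstStep v) a a∈O))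
          (L₀.mem-neg (L₀.mem-* (π^ m , π^∈O m) (proj₂ (bounded-orbit N (p (π^ m))) a∈O))))

    bounded-span : ∀ {n} (g : Vector M.Carrierᴹ n) → ∃ λ m →
      ∀ (a : Vector (Σ K.Carrier O.mem) n) → π^ m M′.*ₗ to (linearCombination M (proj₁ ∘ a) g) ∈ L₀
    bounded-span {zero} g = 0 , λ a →
      L₀.mem-resp (M′.≈ᴹ-sym (M′.≈ᴹ-trans (M′.*ₗ-congˡ to-0) (M′.*ₗ-zeroʳ _))) L₀.mem-0
    bounded-span {suc n} g = m ℕ.+ m′ , λ a → L₀.mem-resp
      (M′.≈ᴹ-sym (M′.≈ᴹ-trans (M′.*ₗ-congˡ (to-+ _ _)) (M′.*ₗ-distribˡ _ _ _)))
      (L₀.mem-+ (raise′ {M = M′} (Lattice.submodule L₀) m′ m (proj₂ orbit (proj₂ (a zero))))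
        (raise {M = M′} (Lattice.submodule L₀) m m′ (proj₂ rest′ (a ∘ suc))))
      where
      orbit = bounded-orbit (proj₁ (nilpotent (g zero))) (proj₂ (nilpotent (g zero)))
      m = proj₁ orbit
      rest′ = bounded-span (g ∘ suc)
      m′ = proj₁ rest′

  bounded : (L : Lattice O M) → ∃ λ (L′ : Lattice O M′) → ∀ {x} → x ∈ L → to x ∈ L′
  bounded L = enlarged {M = M′} (proj₁ (bounded-span g)) L₀ , λ {x} p →
      L₀.mem-resp (M′.*ₗ-congˡ (to-cong (M.≈ᴹ-sym (proj₂ (gen x p)))))
        (proj₂ (bounded-span g) (proj₁ (gen x p)))
    where
    g = proj₁ (proj₂ (Lattice.finite L))
    gen = proj₂ (proj₂ (proj₂ (Lattice.finite L)))

-- Common lattices of two structures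

module _ {𝕜 K : CRing ℓ} {κ : RingHom 𝕜 K} {τ : TopologyOn K} (O : CDVRIn K) {M M′ : Mod K} where

  -- A single subgroup that is a lattice for both structures, recorded on either side of the
  -- identification.
  record Bilattice (C : Comparison κ τ M M′) : Set (lsuc ℓ) where
    open Comparison C
    field
      left : Lattice O M
      right : Lattice O M′
      to-right : ∀ {x} → _∈ᴸ_ O x left → _∈ᴸ_ O (to x) right
      to-left : ∀ {y} → _∈ᴸ_ O y right → _∈ᴸ_ O (from y) left

module _ {𝕜 K : CRing ℓ} {κ : RingHom 𝕜 K} {τ : TopologyOn K} (O : CDVRIn K) {M M′ : Mod K}
  (C : Comparison κ τ M M′) where
  open Comparison C

  left-• : (B : Bilattice O {M} {M′} C) → ∀ {a x} → CDVRIn.mem O a →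
    _∈ᴸ_ O x (Bilattice.left B) → _∈ᴸ_ O (a • x) (Bilattice.left B)
  left-• B {a} a∈O p = B.to-left (Submodule.mem-* (Lattice.submodule B.right) (a , a∈O) (B.to-right p))
    where module B = Bilattice B

module BilatticeConstructions (em : ExcludedMiddle ℓ) {𝕜 K : CRing ℓ} {κ : RingHom 𝕜 K} {τ : TopologyOn K}
  (F : IsField K) (O : CDVRIn K) (u : Uniformizer O) (adapted : AdaptedTopology κ τ O u)
  {M M′ : Mod K} (C : Comparison κ τ M M′) where
  open Lattices em F O u
  open Comparison C
  open Boundedness em κ τ F O u adapted C using (bounded)
  open Boundedness em κ τ F O u adapted (flip κ τ C) using () renaming (bounded to bounded′)
  private
    module K = CommutativeRing K
    module O = CDVRIn O
    module M = LeftModule M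
    module M′ = LeftModule M′
    module P = ModuleProperties K M

  module _ (P : Submodule (overO₁ O M)) (P-• : ∀ {a x} → O.mem a → mem P x → mem P (a • x))
    (L : Lattice O M) (P⊆L : ∀ x → mem P x → x ∈ L) (absorbing₁ : Absorbing {M = M} P)
    (absorbing₂ : ∀ x → ∃ λ m → mem P (π^ m • x)) where
    private
      module P₁ = Submodule P
      P′₁ : Submodule (overO₁ O M′)
      P′₁ = record
        { mem = P₁.mem ∘ from
        ; mem-resp = λ e → P₁.mem-resp (from-cong e)
        ; mem-+ = λ p q → P₁.mem-resp (M.≈ᴹ-sym (from-+ _ _)) (P₁.mem-+ p q)
        ; mem-0 = P₁.mem-resp (M.≈ᴹ-trans (M.≈ᴹ-sym (from-to M.0ᴹ)) (from-cong to-0)) P₁.mem-0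
        ; mem-* = λ (a , a∈O) p → P₁.mem-resp (•-from a _) (P-• a∈O p)
        }
      L′ = bounded L

    -- Finite generation over the second structure is free of charge: L lies in a lattice of M′ by
    -- boundedness, and submodules of lattices are finitely generated.
    bilattice : Bilattice O C
    bilattice = record
      { left = sublattice {M = M} P L P⊆L absorbing₁
      ; right = sublattice {M = M′} P′₁ (proj₁ L′)
          (λ y p → Submodule.mem-resp (Lattice.submodule (proj₁ L′)) (to-from y) (proj₂ L′ (P⊆L _ p)))
          (λ y → proj₁ (absorbing₂ (from y)) , P₁.mem-resp (•-from _ y) (proj₂ (absorbing₂ (from y))))
      ; to-right = λ {x} → P₁.mem-resp (M.≈ᴹ-sym (from-to x))
      ; to-left = λ p → p
      }

  -- The preimage of B under s(v) stays stable under s′(O) because the structures commute.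
  scaledBilattice : ∀ v v⁻¹ → v K.* v⁻¹ K.≈ K.1# → Bilattice O C → Bilattice O C
  scaledBilattice v v⁻¹ inv B = bilattice (Lattice.submodule (scaled v v⁻¹ inv B.left))
      (λ a∈O p → left.mem-resp (M.≈ᴹ-sym (commute v _ _)) (left-• O C B a∈O p))
      (scaled v v⁻¹ inv B.left) (λ x p → p) (absorbing (scaled v v⁻¹ inv B.left))
      λ x → let (m , p) = absorbing B.right (to (v M.*ₗ x)) in
        m , left.mem-resp (M.≈ᴹ-sym (commute v (π^ m) x)) (B.to-left p)
    where
    module B = Bilattice B
    module left = Submodule (Lattice.submodule B.left)

  -- L₀, L₀′, L₁ are lattices for s, s′, s in turn, each inside the next. P consists of the x with
  -- s′(O)x ⊆ L₁; it contains the s′-lattice L₀′, hence also L₀, which makes it absorbing for both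
  -- structures. It is s(O)-stable because the structures commute.
  someBilattice : Bilattice O C
  someBilattice = bilattice P (λ a∈O p b∈O → L₁.mem-resp (•-assoc _ _ _) (p (Subring.mem-* O.subring b∈O a∈O)))
      L₁ (λ x p → L₁.mem-resp (•-identity x) (p (Subring.mem-1 O.subring)))
      (λ x → let (m , p) = absorbing L₀ x in m , λ b∈O →
        proj₂ (bounded′ L₀′) (Submodule.mem-* (Lattice.submodule L₀′) (_ , b∈O) (proj₂ (bounded L₀) p)))
      (λ x → let (m , p) = absorbing L₀′ (to x) in m , λ b∈O →
        proj₂ (bounded′ L₀′) (Submodule.mem-* (Lattice.submodule L₀′) (_ , b∈O)
          (Submodule.mem-resp (Lattice.submodule L₀′) (M′.≈ᴹ-sym (to-• _ _)) p)))
    where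
    L₀ : Lattice O M
    L₀ = someLattice {M = M} finite
    L₀′ : Lattice O M′
    L₀′ = proj₁ (bounded L₀)
    L₁ : Lattice O M
    L₁ = proj₁ (bounded′ L₀′)
    module L₁ = Submodule (Lattice.submodule L₁)
    •-identity : ∀ x → K.1# • x M.≈ᴹ x
    •-identity x = M.≈ᴹ-trans (from-cong (M′.*ₗ-identityˡ _)) (from-to x)
    P : Submodule (overO₁ O M)
    P = record
      { mem = λ x → ∀ {b} → O.mem b → b • x ∈ L₁
      ; mem-resp = λ e p b∈O → L₁.mem-resp (•-cong _ e) (p b∈O)
      ; mem-+ = λ p q b∈O → L₁.mem-resp (M.≈ᴹ-sym (•-+ _ _ _)) (L₁.mem-+ (p b∈O) (q b∈O))
      ; mem-0 = λ _ → L₁.mem-resp (M.≈ᴹ-sym (Nil-• M M′ structures 0 _ M.≈ᴹ-refl)) L₁.mem-0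
      ; mem-* = λ (a , a∈O) p b∈O → L₁.mem-resp (commute a _ _) (L₁.mem-* (a , a∈O) (p b∈O))
      }

  above : (B : Bilattice O C) (L : Lattice O M) → Σ (Bilattice O C) λ B⁺ →
    (∀ {x} → x ∈ Bilattice.left B → x ∈ Bilattice.left B⁺) × (∀ {x} → x ∈ L → x ∈ Bilattice.left B⁺)
  above B L = let (m , abs) = absorbs L (Bilattice.left B) in
    scaledBilattice (π^ m) (π⁻^ m) (π^*π⁻^ m) B , ⊆enlarged m (Bilattice.left B) , abs

  below : (B : Bilattice O C) (L : Lattice O M) → Σ (Bilattice O C) λ B⁻ →
    (∀ {x} → x ∈ Bilattice.left B⁻ → x ∈ Bilattice.left B) × (∀ {x} → x ∈ Bilattice.left B⁻ → x ∈ L)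
  below B L = let (m , abs) = absorbs (Bilattice.left B) L in
    scaledBilattice (π⁻^ m) (π^ m) (π⁻^*π^ m) B , shrunk⊆ m (Bilattice.left B) ,
    λ {x} p → Submodule.mem-resp (Lattice.submodule L) (P.*-cancel (π^*π⁻^ m) x) (abs p)

module _ {𝕜 K : CRing ℓ} {κ : RingHom 𝕜 K} {τ : TopologyOn K} (O : CDVRIn K) {M M′ : Mod K}
  (C : Comparison κ τ M M′) where

  flipBilattice : Bilattice O {M} {M′} C → Bilattice O {M′} {M} (flip κ τ C)
  flipBilattice B = record { left = right ; right = left ; to-right = to-left ; to-left = to-right }
    where open Bilattice B

  unflipBilattice : Bilattice O {M′} {M} (flip κ τ C) → Bilattice O {M} {M′} C
  unflipBilattice B = record { left = right ; right = left ; to-right = to-left ; to-left = to-right }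
    where open Bilattice B

module _ {𝕜 K : CRing ℓ} {κ : RingHom 𝕜 K} {τ : TopologyOn K} (O : CDVRIn K) {M M′ : Mod K}
  (C : Comparison κ τ M M′) (X Y : Bilattice O {M} {M′} C) where

  right-⊆ : (∀ {x} → _∈ᴸ_ O x (Bilattice.left X) → _∈ᴸ_ O x (Bilattice.left Y)) →
    ∀ {y} → _∈ᴸ_ O y (Bilattice.right X) → _∈ᴸ_ O y (Bilattice.right Y)
  right-⊆ f {y} p = Submodule.mem-resp (Lattice.submodule (Bilattice.right Y)) (Comparison.to-from C y)
    (Bilattice.to-right Y (f (Bilattice.to-left X p)))

-- Two liftings on the quotients of common lattices

module LiftingTopology {𝕜 : CRing ℓ} {d} {K : CRing ℓ} {F : IsField K} (O : CDVRIn K)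
  {lf : LocalField d (CDVRIn.residueField O)} {ι : IntegralHom 𝕜 (step F O lf)} {τ : TopologyOn K}
  (linearRing : LinearRing (IntegralHom.hom ι) τ) where
  private
    module K = CommutativeRing K
    module O = CDVRIn O
    κ = IntegralHom.hom ι
    κ₁ = IntegralHom.hom (residueHom O ι)
    τ₁ = residueTopology O τ

  residue-continuous : (N : OpenSubmodule κ₁ τ₁) → Σ (OpenSubmodule κ τ) λ N′ →
    ∀ {b} (p : O.mem b) → OpenSubmodule.mem N′ b → OpenSubmodule.mem N (b , p)
  residue-continuous N = proj₁ N′ , λ p q → V⊆N (proj₂ N′ q)
    where
    module N = OpenSubmodule N
    V = proj₁ (proj₂ N.isOpen)
    N⊆V = proj₁ (proj₂ (proj₂ (proj₂ N.isOpen)))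
    V⊆N = proj₂ (proj₂ (proj₂ (proj₂ N.isOpen)))
    N′ = LinearRing.linear-basis linearRing V (proj₁ (proj₂ (proj₂ N.isOpen))) (N⊆V N.mem-0)

  lifting-continuous : (σ₁ : Lifting O {lf} ι τ) (N : OpenSubmodule κ τ) → Σ (OpenSubmodule κ₁ τ₁) λ N′ →
    ∀ {a} → OpenSubmodule.mem N′ a → OpenSubmodule.mem N (proj₁ (⟦ Lifting.σ σ₁ ⟧ a))
  lifting-continuous σ₁ N = record
    { submodule = record
      { mem = λ a → N.mem (proj₁ (⟦ σ ⟧ a))
      ; mem-resp = λ {x} {y} e → N.mem-resp (σ.⟦⟧-cong {x} {y} e)
      ; mem-+ = λ {x} {y} p q → N.mem-resp (K.sym (σ.+-homo x y)) (N.mem-+ p q)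
      ; mem-0 = N.mem-resp (K.sym σ.0#-homo) N.mem-0
      ; mem-* = λ c {x} p → N.mem-resp (K.sym (K.trans (σ.*-homo (⟦ κ₁ ⟧ c) x)
          (K.*-congʳ (Lifting.𝕜-homomorphism σ₁ c)))) (N.mem-* c p)
      }
    ; isOpen = Lifting.continuous σ₁ (λ x → N.mem (proj₁ x)) (N.mem , N.isOpen , (λ p → p) , λ p → p)
    } , λ p → p
    where
    σ = Lifting.σ σ₁
    module σ = RingHom σ
    module N = OpenSubmodule N

module QuotientFine (em : ExcludedMiddle ℓ) {𝕜 : CRing ℓ} {d} {K : CRing ℓ} {F : IsField K} (O : CDVRIn K)
  (u : Uniformizer O) {lf : LocalField d (CDVRIn.residueField O)} {ι : IntegralHom 𝕜 (step F O lf)}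
  {τ : TopologyOn K} (linearRing : LinearRing (IntegralHom.hom ι) τ)
  (σ₁ σ₁′ : Lifting O {lf} ι τ) {M M′ : Mod K} (C : Comparison (IntegralHom.hom ι) τ M M′)
  (Λ Λ° : Bilattice O {M} {M′} C) where
  private
    module K = CommutativeRing K
    module O = CDVRIn O
    module M′ = LeftModule M′
    module P′ = ModuleProperties K M′
    κ = IntegralHom.hom ι
    κ₁ = IntegralHom.hom (residueHom O ι)
    τ₁ = residueTopology O τ
    module Λ = Bilattice Λ
    module Λ° = Bilattice Λ°
    module Λ′ = Submodule (Lattice.submodule Λ.right)
    module Λ°′ = Submodule (Lattice.submodule Λ°.right)
    N N′ : Mod O.residueField
    N = rest O σ₁ Λ.left Λ°.left
    N′ = rest O σ₁′ Λ.right Λ°.right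
    module N′ = LeftModule N′
  open Lattices em F O u
  open Comparison C
  open LinearRing linearRing
  open LiftingTopology O {lf} {ι} {τ} linearRing
  open LiftingProperties em O u {lf} {ι} {τ} σ₁′ using (quotient∈O; decompose) renaming (σ to σ′)
  open TopologicalCoordinates em κ τ F O u linearRing {M′}

  toQuotient : LeftModule.Carrierᴹ N → N′.Carrierᴹ
  toQuotient (x , p) = to x , Λ.to-right p

  -- U is pulled back to U₀ inside Λ′. A box Ũ in the coordinates of a basis of Λ′ satisfies Ũ ∩ Λ′
  -- ⊆ U₀. It is fine-open in M′, therefore fine-open in M by `fine-from`, and continuity of σ₁
  -- converts this into a condition on scalars from k₁.
  fineQuotient : ∀ U → IsAdditive {R = O.residueField} N′ U → FineOpen κ₁ τ₁ N′ U → FineOpen κ₁ τ₁ N (U ∘ toQuotient)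
  fineQuotient U additive open′ (x , p) = proj₁ N₇ , λ {a} q →
      let a*x = σ.σ∈O a ; v = Ũ⇒U₀ (Λ.to-right (Submodule.mem-* (Lattice.submodule Λ.left) (_ , a*x) p)) (proj₂ N₆ (proj₂ N₇ q))
      in U-irr (proj₁ v) _ (proj₂ v)
    where
    open IsAdditive additive
    module σ = LiftingProperties em O u {lf} {ι} {τ} σ₁

    U₀ : Pred M′.Carrierᴹ ℓ
    U₀ y = Σ (Λ′.mem y) λ p → U (y , p)

    U-irr : ∀ {y} (p q : Λ′.mem y) → U (y , p) → U (y , q)
    U-irr p q = U-resp (Λ°′.mem-resp (M′.≈ᴹ-sym (M′.-ᴹ‿inverseʳ _)) Λ°′.mem-0)

    U₀-resp : ∀ {y z} → y M′.≈ᴹ z → U₀ y → U₀ z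
    U₀-resp e (p , r) = Λ′.mem-resp e p ,
      U-resp (Λ°′.mem-resp (M′.≈ᴹ-sym (M′.≈ᴹ-trans (M′.+ᴹ-congʳ e) (M′.-ᴹ‿inverseʳ _))) Λ°′.mem-0) r

    U₀-+ : ∀ {y z} → U₀ y → U₀ z → U₀ (y M′.+ᴹ z)
    U₀-+ (p , r) (q , s) = Λ′.mem-+ p q , U-+ r s

    U₀-0 : ∀ {y} → Λ°′.mem y → Λ′.mem y → U₀ y
    U₀-0 {y} p q = q , U-resp (Congruence.~-trans (overO₁ O M′) (Lattice.submodule Λ°.right) (N′.*ₗ-zeroˡ (y , q))
        (Λ°′.mem-resp (M′.≈ᴹ-sym (M′.+ᴹ-identityˡ _)) (Λ°′.mem-neg p)))
      (proj₂ (open′ (y , q)) (OpenSubmodule.mem-0 (proj₁ (open′ (y , q)))))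

    -- Expands b ∈ O as σ′(b̄) + π b₁, where both b̄ and b₁ depend continuously on b.
    nearby : ∀ e {v} → Λ°′.mem (π^ e M′.*ₗ v) → Λ′.mem v →
      Σ (OpenSubmodule κ τ) λ N → ∀ {b} → O.mem b → OpenSubmodule.mem N b → U₀ (b M′.*ₗ v)
    nearby zero {v} v∈Λ° v∈Λ = wholeOpen κ τ , λ {b} b∈O _ → U₀-0
      (Λ°′.mem-* (b , b∈O) (Λ°′.mem-resp (M′.*ₗ-identityˡ v) v∈Λ°)) (Λ′.mem-* (b , b∈O) v∈Λ)
    nearby (suc e) {v} v∈Λ° v∈Λ = proj₁ N₆ , λ {b} b∈O q →
        let q₁ = proj₁ (proj₂ N₆ q) ; q₄ = proj₁ (proj₂ N₅₆ (proj₂ (proj₂ N₆ q))) ; q₅ = proj₂ (proj₂ N₅₆ (proj₂ (proj₂ N₆ q)))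
            b̄ = (b , b∈O)
        in U₀-resp (b*v b b∈O) (U₀-+
          (Λ′.mem-* (⟦ Lifting.σ σ₁′ ⟧ b̄) v∈Λ , proj₂ N₂ (proj₂ N₄ b∈O q₄))
          (proj₂ N₁ (quotient∈O b∈O) (OpenSubmodule.mem-resp (proj₁ N₁) (K.sym (K.trans (K.distribˡ π⁻¹ b _) (K.+-congˡ (π⁻¹*- _))))
            (OpenSubmodule.mem-+ (proj₁ N₁) (proj₂ N₁′ q₁)
              (OpenSubmodule.mem-neg (proj₁ N₁) (proj₂ N₁′ (proj₂ N₃ (proj₂ N₅ b∈O q₅))))))))
      where
      N₁ = nearby e {π M′.*ₗ v}
        (Λ°′.mem-resp (M′.≈ᴹ-trans (M′.*ₗ-assoc π (π^ e) v) (P′.*-comm-* _ _ _)) v∈Λ°) (Λ′.mem-* (π , π∈O) v∈Λ)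
      N₁′ = scaleOpen π⁻¹ (proj₁ N₁)
      N₂ = open′ (v , v∈Λ)
      N₃ = lifting-continuous σ₁′ (proj₁ N₁′)
      N₄ = residue-continuous (proj₁ N₂)
      N₅ = residue-continuous (proj₁ N₃)
      N₅₆ = intersectOpen κ τ (proj₁ N₄) (proj₁ N₅)
      N₆ = intersectOpen κ τ (proj₁ N₁′) (proj₁ N₅₆)
      π⁻¹*- : ∀ x → π⁻¹ K.* (K.- x) K.≈ K.- (π⁻¹ K.* x)
      π⁻¹*- = ModuleProperties.-‿*ʳ K (regular K) π⁻¹
      b*v : ∀ b (b∈O : O.mem b) → σ′ (b , b∈O) M′.*ₗ v M′.+ᴹ (π⁻¹ K.* (b K.+ K.- σ′ (b , b∈O))) M′.*ₗ (π M′.*ₗ v) M′.≈ᴹ b M′.*ₗ v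
      b*v b b∈O = M′.≈ᴹ-trans (M′.+ᴹ-congˡ (M′.≈ᴹ-trans (P′.*-comm-* _ _ _) (M′.≈ᴹ-sym (M′.*ₗ-assoc _ _ _))))
        (M′.≈ᴹ-trans (M′.≈ᴹ-sym (M′.*ₗ-distribʳ v _ _)) (M′.*ₗ-congʳ (K.sym (decompose b∈O))))

    B₀ = latticeBasis {M = M′} finite′ Λ.right
    module B = LatticeBasis B₀
    open CoordinateBox B₀

    exponent = proj₁ (absorbs Λ.right Λ°.right)
    Nᵢ : ∀ j → Σ (OpenSubmodule κ τ) λ N → ∀ {b} → O.mem b → OpenSubmodule.mem N b → U₀ (b M′.*ₗ B.b j)
    Nᵢ j = nearby exponent (proj₂ (absorbs Λ.right Λ°.right) (B.b∈L j)) (B.b∈L j)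
    Ũ : Pred M′.Carrierᴹ ℓ
    Ũ = box (proj₁ ∘ Nᵢ)

    U₀-lc : ∀ {n} (a : Vector K.Carrier n) (g : Vector M′.Carrierᴹ n) → (∀ i → U₀ (a i M′.*ₗ g i)) →
      U₀ (linearCombination M′ a g)
    U₀-lc {zero} a g p = U₀-0 Λ°′.mem-0 Λ′.mem-0
    U₀-lc {suc n} a g p = U₀-+ (p zero) (U₀-lc (a ∘ suc) (g ∘ suc) (p ∘ suc))

    Ũ⇒U₀ : ∀ {y} → Λ′.mem y → Ũ y → U₀ y
    Ũ⇒U₀ {y} p q = U₀-resp (M′.≈ᴹ-sym (B.expansion y)) (U₀-lc (B.coord y) B.b (λ j → proj₂ (Nᵢ j) (B.integral p j) (q j)))

    N₆ = fine-from Ũ (box-additive (proj₁ ∘ Nᵢ)) (box-open (proj₁ ∘ Nᵢ)) x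
    N₇ = lifting-continuous σ₁ (proj₁ N₆)

module QuotientComparison (em : ExcludedMiddle ℓ) {𝕜 : CRing ℓ} {d} {K : CRing ℓ} {F : IsField K} (O : CDVRIn K)
  (u : Uniformizer O) {lf : LocalField d (CDVRIn.residueField O)} {ι : IntegralHom 𝕜 (step F O lf)}
  {τ : TopologyOn K} (linearRing : LinearRing (IntegralHom.hom ι) τ)
  (σ₁ σ₁′ : Lifting O {lf} ι τ) {M M′ : Mod K} (C : Comparison (IntegralHom.hom ι) τ M M′)
  (Λ Λ° : Bilattice O {M} {M′} C) where
  private
    module K = CommutativeRing K
    module O = CDVRIn O
    module k₁ = CommutativeRing O.residueField
    module 𝒪 = CommutativeRing O.valuationRing
    module M = LeftModule M
    module M′ = LeftModule M′
    module P = ModuleProperties K M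
    module P′ = ModuleProperties K M′
    κ = IntegralHom.hom ι
    κ₁ = IntegralHom.hom (residueHom O ι)
    τ₁ = residueTopology O τ
    module Λ = Bilattice Λ
    module Λ° = Bilattice Λ°
    module left = Submodule (Lattice.submodule Λ.left)
    module left° = Submodule (Lattice.submodule Λ°.left)
    module right° = Submodule (Lattice.submodule Λ°.right)
    N N′ : Mod O.residueField
    N = rest O σ₁ Λ.left Λ°.left
    N′ = rest O σ₁′ Λ.right Λ°.right
    module N = LeftModule N
  open Lattices em F O u
  open Comparison C
  open LiftingProperties em O u {lf} {ι} {τ} σ₁ using (σ; σ∈O; rest-finite)
  open LiftingProperties em O u {lf} {ι} {τ} σ₁′ using () renaming (σ to σ′; rest-finite to rest-finite′)
  private
    module C° = Congruence (overO₁ O M) (Lattice.submodule Λ°.left)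
    module C°′ = Congruence (overO₁ O M′) (Lattice.submodule Λ°.right)
    module from′ = CommutingStructures (flipStructures structures)

    quotientStructures : CommutingStructures {K = O.residueField} N N′
    quotientStructures = record
      { to = λ (x , p) → to x , Λ.to-right p
      ; from = λ (y , p) → from y , Λ.to-left p
      ; to-cong = λ {x} {y} p → right°.mem-resp
          (M′.≈ᴹ-trans (to-+ _ _) (M′.+ᴹ-congˡ (to-neg _))) (Λ°.to-right p)
      ; from-cong = λ {x} {y} p → left°.mem-resp
          (M.≈ᴹ-trans (from-+ _ _) (M.+ᴹ-congˡ (from′.to-neg _))) (Λ°.to-left p)
      ; to-+ = λ _ _ → C°′.≈⇒~ (to-+ _ _)
      ; from-+ = λ _ _ → C°.≈⇒~ (from-+ _ _)
      ; to-from = λ _ → C°′.≈⇒~ (to-from _)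
      ; from-to = λ _ → C°.≈⇒~ (from-to _)
      ; commute = λ a b x → C°.≈⇒~ (commute (σ a) (σ′ b) (proj₁ x))
      }
    module Q = CommutingStructures quotientStructures

    difference∈ : (B : Bilattice O {M} {M′} C) → ∀ {a x} → O.mem a → x ∈ Bilattice.left B → difference a x ∈ Bilattice.left B
    difference∈ B {a} a∈O p = L.mem-+ (L.mem-* (a , a∈O) p) (L.mem-neg (left-• O C B a∈O p))
      where module L = Submodule (Lattice.submodule (Bilattice.left B))

    variation : k₁.Carrier → K.Carrier
    variation a = π⁻¹ K.* (σ a K.+ K.- σ′ a)

    variation∈O : ∀ a → O.mem (variation a)
    variation∈O a = uniformizes (⟦ Lifting.σ σ₁ ⟧ a 𝒪.- ⟦ Lifting.σ σ₁′ ⟧ a)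
      (k₁.trans {⟦ Lifting.σ σ₁ ⟧ a} {a} {⟦ Lifting.σ σ₁′ ⟧ a} (Lifting.splits σ₁ a)
        (k₁.sym {⟦ Lifting.σ σ₁′ ⟧ a} {a} (Lifting.splits σ₁′ a)))

    -- s(σ a) − s′(σ′ a) = (s(σ a) − s′(σ a)) + s′(σ a − σ′ a); the first summand is
    -- nilpotent on M and the second one lies in s′(π O).
    quotient-difference : ∀ a x → σ a M.*ₗ x M.+ᴹ M.-ᴹ (σ′ a • x) M.≈ᴹ difference (σ a) x M.+ᴹ (π K.* variation a) • x
    quotient-difference a x = M.≈ᴹ-sym (begin
      difference (σ a) x M.+ᴹ (π K.* variation a) • x ≈⟨ M.+ᴹ-congˡ (from-cong (M′.≈ᴹ-trans
          (M′.*ₗ-congʳ (ModuleProperties.*-cancel K (regular K) π*π⁻¹ _))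
          (M′.≈ᴹ-trans (M′.*ₗ-distribʳ _ _ _) (M′.+ᴹ-congˡ (P′.-‿*ˡ _ _))))) ⟩
      difference (σ a) x M.+ᴹ from (σ a M′.*ₗ to x M′.+ᴹ M′.-ᴹ (σ′ a M′.*ₗ to x))
        ≈⟨ M.+ᴹ-congˡ (M.≈ᴹ-trans (from-+ _ _) (M.+ᴹ-congˡ (from′.to-neg _))) ⟩
      (σ a M.*ₗ x M.+ᴹ M.-ᴹ (σ a • x)) M.+ᴹ (σ a • x M.+ᴹ M.-ᴹ (σ′ a • x)) ≈⟨ M.+ᴹ-assoc _ _ _ ⟨
      ((σ a M.*ₗ x M.+ᴹ M.-ᴹ (σ a • x)) M.+ᴹ σ a • x) M.+ᴹ M.-ᴹ (σ′ a • x) ≈⟨ M.+ᴹ-congʳ (P.sub-add _ _) ⟩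
      σ a M.*ₗ x M.+ᴹ M.-ᴹ (σ′ a • x) ∎)
      where open ≈-Reasoning M.≈ᴹ-setoid

    quotient-zero : ∀ {x} (p : left.mem x) → left°.mem x → (x , p) N.≈ᴹ N.0ᴹ
    quotient-zero {x} p q = left°.mem-resp (M.≈ᴹ-sym (P.minus-zero x)) q

    -- Each difference operator of the quotient splits into a summand that lowers n and one, coming
    -- from s′(πO), that lowers e. Both commute with what has been assumed of x, so n + e
    -- applications suffice; x vanishes in the quotient once n or e reaches 0.
    quotient-nil : ∀ n e {x} (p : left.mem x) → Nil n x → left°.mem (π^ e • x) → Q.Nil (n ℕ.+ e) (x , p)
    quotient-nil zero e p x-nil q =
      Nil-zero N N′ quotientStructures e (quotient-zero p (left°.mem-resp (M.≈ᴹ-sym x-nil) left°.mem-0))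
    quotient-nil (suc n) zero {x} p x-nil q = Nil-zero N N′ quotientStructures (suc n ℕ.+ 0) (quotient-zero p
      (left°.mem-resp (M.≈ᴹ-trans (from-cong (M′.*ₗ-identityˡ _)) (from-to x)) q))
    quotient-nil (suc n) (suc e) {x} p x-nil q a = Q.Nil-resp (n ℕ.+ suc e)
      {(difference (σ a) x M.+ᴹ (π K.* variation a) • x) , left.mem-+ p₁ p₂} {Q.difference a (x , p)}
      (C°.≈⇒~ (M.≈ᴹ-sym (quotient-difference a x)))
      (Nil-+ N N′ quotientStructures (n ℕ.+ suc e) {_ , p₁} {_ , p₂}
        (quotient-nil n (suc e) p₁ (x-nil (σ a))
          (left°.mem-resp (difference-• M M′ structures (σ a) (π^ (suc e)) x) (difference∈ Λ° (σ∈O a) q)))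
        (≡.subst (λ k → Q.Nil k (_ , p₂)) (≡.sym (ℕ.+-suc n e))
          (quotient-nil (suc n) e p₂ (Nil-• M M′ structures (suc n) _ x-nil)
            (left°.mem-resp rearranged (left-• O C Λ° (variation∈O a) q)))))
      where
      p₁ : left.mem (difference (σ a) x)
      p₁ = difference∈ Λ (σ∈O a) p
      p₂ : left.mem ((π K.* variation a) • x)
      p₂ = left-• O C Λ (Subring.mem-* O.subring π∈O (variation∈O a)) p
      rearranged : variation a • (π^ (suc e) • x) M.≈ᴹ π^ e • ((π K.* variation a) • x)
      rearranged = begin
        variation a • (π^ (suc e) • x)           ≈⟨ •-assoc _ _ x ⟨
        (variation a K.* (π K.* π^ e)) • x       ≈⟨ from-cong (M′.*ₗ-congʳ (K.trans (K.sym (K.*-assoc _ _ _))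
            (K.trans (K.*-comm _ _) (K.*-congˡ (K.*-comm _ _))))) ⟩
        (π^ e K.* (π K.* variation a)) • x       ≈⟨ •-assoc _ _ x ⟩
        π^ e • ((π K.* variation a) • x)         ∎
        where open ≈-Reasoning M.≈ᴹ-setoid

  quotientComparison : Comparison κ₁ τ₁ N N′
  quotientComparison = record
    { structures = quotientStructures
    ; finite = rest-finite {M} Λ.left Λ°.left
    ; finite′ = rest-finite′ {M′} Λ.right Λ°.right
    ; nilpotent = λ (x , p) → let (e , abs) = absorbs Λ.right Λ°.right ; (n , x-nil) = nilpotent x in
        n ℕ.+ e , quotient-nil n e p x-nil (Λ°.to-left (abs (Λ.to-right p)))
    ; fine-to = QuotientFine.fineQuotient em O u {lf} {ι} {τ} linearRing σ₁′ σ₁ {M′} {M} (flip κ τ C)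
        (flipBilattice O C Λ) (flipBilattice O C Λ°)
    ; fine-from = QuotientFine.fineQuotient em O u {lf} {ι} {τ} linearRing σ₁ σ₁′ {M} {M′} C Λ Λ°
    }

-- Transfer of BT operators between two systems of liftings

module ComparisonTame (em : ExcludedMiddle ℓ) {𝕜 K : CRing ℓ} {κ : RingHom 𝕜 K} {τ : TopologyOn K}
  (F : IsField K) (O : CDVRIn K) (u : Uniformizer O) (adapted : AdaptedTopology κ τ O u)
  {M M′ : Mod K} (C : Comparison κ τ M M′) where
  open Lattices em F O u
  open Comparison C
  open BilatticeConstructions em F O u adapted C public
  module Flipped = BilatticeConstructions em F O u adapted (flip κ τ C)
  private
    module M = LeftModule M
    module M′ = LeftModule M′

  Under : M.Carrierᴹ → M′.Carrierᴹ → Set ℓ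
  Under x x′ = to x M′.≈ᴹ x′

  aboveRight : (L : Lattice O M′) → Σ (Bilattice O C) λ B → ∀ {y} → y ∈ L → y ∈ Bilattice.right B
  aboveRight L = unflipBilattice O C (proj₁ B) , proj₂ (proj₂ B)
    where B = Flipped.above (flipBilattice O C someBilattice) L

  belowRight : (L : Lattice O M′) → Σ (Bilattice O C) λ B → ∀ {y} → y ∈ Bilattice.right B → y ∈ L
  belowRight L = unflipBilattice O C (proj₁ B) , proj₂ (proj₂ B)
    where B = Flipped.below (flipBilattice O C someBilattice) L

  -- An s-lattice need not correspond to an s′-lattice, so every choice passes through a common
  -- lattice above or below the given one.
  tame : Tame O {M} {M′} Under
  tame = record
    { onto = λ y → from y , to-from y
    ; zero-image = λ p q → M′.≈ᴹ-trans (M′.≈ᴹ-sym q) (M′.≈ᴹ-trans (to-cong p) to-0)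
    ; cover = λ L′ → let (B , p) = aboveRight L′ in
        Bilattice.left B , λ {y} q → from y , Bilattice.to-left B (p q) , to-from y
    ; covered = λ L → let (B , _ , p) = below someBilattice L in
        Bilattice.right B , λ {y} q → from y , p (Bilattice.to-left B q) , to-from y
    ; domain = λ L′ → let (B , p) = belowRight L′ in
        Bilattice.left B , λ q e → Submodule.mem-resp (Lattice.submodule L′) e (p (Bilattice.to-right B q))
    ; codomain = λ L → let (B , _ , p) = above someBilattice L in
        Bilattice.right B , λ q e → Submodule.mem-resp (Lattice.submodule (Bilattice.right B)) e (Bilattice.to-right B (p q))
    }

AdaptedTopologies : {𝕜 : CRing ℓ} → ∀ {n} {K : CRing ℓ} (lf : LocalField n K) → IntegralHom 𝕜 lf → TopologyOn K →
  Uniformizers lf → Set (lsuc ℓ)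
AdaptedTopologies (dim0 _) ι τ us = ⊤
AdaptedTopologies (step _ O lf) ι τ (u , us) = AdaptedTopology (IntegralHom.hom ι) τ O u ×
  AdaptedTopologies lf (residueHom O ι) (residueTopology O τ) us

ComparisonTransfer : {𝕜 : CRing ℓ} → ∀ {n} {K : CRing ℓ} (lf : LocalField n K) (ι : IntegralHom 𝕜 lf) (τ : TopologyOn K)
  (σ σ′ : Liftings lf ι τ) → Set (lsuc ℓ)
ComparisonTransfer {K = K} lf ι τ σ σ′ = {M₁ M₂ M₁′ M₂′ : Mod K}
  (C₁ : Comparison (IntegralHom.hom ι) τ M₁ M₁′) (C₂ : Comparison (IntegralHom.hom ι) τ M₂ M₂′)
  (φ : Homₖ (IntegralHom.hom ι) M₁ M₂) (φ′ : Homₖ (IntegralHom.hom ι) M₁′ M₂′) →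
  (∀ x → LeftModule._≈ᴹ_ M₂′ (fun φ′ (Comparison.to C₁ x)) (Comparison.to C₂ (fun φ x))) →
  Transfer {lf = lf} {ι = ι} {τ = τ} σ σ′ {M₁} {M₂} {M₁′} {M₂′} φ φ′

module BilatticeReduction (em : ExcludedMiddle ℓ) {𝕜 : CRing ℓ} {n} {K : CRing ℓ} {F : IsField K} (O : CDVRIn K)
  {lf : LocalField n (CDVRIn.residueField O)} {ι : IntegralHom 𝕜 (step F O lf)} {τ : TopologyOn K}
  (u : Uniformizer O) (us : Uniformizers lf) (linearRing : LinearRing (IntegralHom.hom ι) τ)
  (σ₁ σ₁′ : Lifting O {lf} ι τ) (dσ dσ′ : Liftings lf (residueHom O ι) (residueTopology O τ))
  (transfer : ComparisonTransfer lf (residueHom O ι) (residueTopology O τ) dσ dσ′)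
  {M₁ M₂ M₁′ M₂′ : Mod K}
  (C₁ : Comparison (IntegralHom.hom ι) τ M₁ M₁′) (C₂ : Comparison (IntegralHom.hom ι) τ M₂ M₂′)
  (φ : Homₖ (IntegralHom.hom ι) M₁ M₂) (φ′ : Homₖ (IntegralHom.hom ι) M₁′ M₂′)
  (square : ∀ x → LeftModule._≈ᴹ_ M₂′ (fun φ′ (Comparison.to C₁ x)) (Comparison.to C₂ (fun φ x))) where
  open Lattices em F O u
  private
    module M₂′ = LeftModule M₂′
    module M₁′ = LeftModule M₁′
    module C₁ = Comparison C₁
    module L′ = LiftingProperties em O u {lf} {ι} {τ} σ₁′
  φ′-cong : ∀ {x y} → x M₁′.≈ᴹ y → fun φ′ x M₂′.≈ᴹ fun φ′ y
  φ′-cong = LeftModuleMorphisms.IsLeftModuleHomomorphism.⟦⟧-cong (Homₖ.isLinear φ′)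

  module _ {C A : Bilattice O {M₁} {M₁′} C₁} {D B : Bilattice O {M₂} {M₂′} C₂}
    {C′ A′ : Lattice O M₁′} {D′ B′ : Lattice O M₂′}
    (C′⊆C : ∀ {y} → y ∈ C′ → y ∈ Bilattice.right C) (A⊆A′ : ∀ {y} → y ∈ Bilattice.right A → y ∈ A′)
    (D⊆D′ : ∀ {y} → y ∈ Bilattice.right D → y ∈ D′) (B′⊆B : ∀ {y} → y ∈ B′ → y ∈ Bilattice.right B)
    (r : _≺[_]_ O (Bilattice.left A , Bilattice.left B) (fun φ) (Bilattice.left C , Bilattice.left D))
    (r′ : _≺[_]_ O (A′ , B′) (fun φ′) (C′ , D′)) where
    private
      module C = Bilattice C
      module A = Bilattice A
      module D = Bilattice D
      module B = Bilattice B

      right-of : (X : Bilattice O {M₁} {M₁′} C₁) (Y : Bilattice O {M₂} {M₂′} C₂) →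
        (∀ {x} → x ∈ Bilattice.left X → fun φ x ∈ Bilattice.left Y) →
        ∀ {y} → y ∈ Bilattice.right X → fun φ′ y ∈ Bilattice.right Y
      right-of X Y f {y} p = Submodule.mem-resp (Lattice.submodule (Bilattice.right Y))
        (M₂′.≈ᴹ-trans (M₂′.≈ᴹ-sym (square (C₁.from y))) (φ′-cong (C₁.to-from y)))
        (Bilattice.to-right Y (f (Bilattice.to-left X p)))
      r″ : _≺[_]_ O (A.right , B.right) (fun φ′) (C.right , D.right)
      r″ = record
        { shrink = right-⊆ O C₁ A C (_≺[_]_.shrink r)
        ; grow = right-⊆ O C₂ D B (_≺[_]_.grow r)
        ; maps′ = right-of A D (_≺[_]_.maps′ r)
        ; maps = right-of C B (_≺[_]_.maps r)
        }
      φr = inducedMap O {ι = ι} {τ = τ} σ₁ {M₁} {M₂} φ {C.left} {A.left} {D.left} {B.left} r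
      φ″ = inducedMap O {ι = ι} {τ = τ} σ₁′ {M₁′} {M₂′} φ′ {C.right} {A.right} {D.right} {B.right} r″
      φr′ = inducedMap O {ι = ι} {τ = τ} σ₁′ {M₁′} {M₂′} φ′ {C′} {A′} {D′} {B′} r′
      R₁ : LinearRelation {K = CDVRIn.residueField O} (rest O σ₁′ C.right A.right) (rest O σ₁′ C′ A′)
      R₁ = L′.subquotientRelation (identityRelation M₁′) C.right A.right C′ A′
        (λ {x′} p → x′ , C′⊆C p , M₁′.≈ᴹ-refl)
        (λ p e → Submodule.mem-resp (Lattice.submodule A′) e (A⊆A′ p))
      R₂ : LinearRelation {K = CDVRIn.residueField O} (rest O σ₁′ B.right D.right) (rest O σ₁′ B′ D′)
      R₂ = L′.subquotientRelation (identityRelation M₂′) B.right D.right B′ D′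
        (λ {x′} p → x′ , B′⊆B p , M₂′.≈ᴹ-refl)
        (λ p e → Submodule.mem-resp (Lattice.submodule D′) e (D⊆D′ p))
      compatible : Compatible (IntegralHom.hom (residueHom O ι))
        {rest O σ₁′ C.right A.right} {rest O σ₁′ B.right D.right} {rest O σ₁′ C′ A′} {rest O σ₁′ B′ D′}
        (LinearRelation.rel R₁) (LinearRelation.rel R₂) φ″ φr′
      compatible {x , _} {x′ , _} (y , y′ , p , p′ , s) = fun φ′ y , fun φ′ y′ ,
        Submodule.mem-resp (Lattice.submodule D.right) (fun-minus φ′ x y) (_≺[_]_.maps′ r″ p) ,
        Submodule.mem-resp (Lattice.submodule D′) (fun-minus φ′ y′ x′) (_≺[_]_.maps′ r′ p′) ,
        φ′-cong s
      step₁ : Transfer {lf = lf} {ι = residueHom O ι} {τ = residueTopology O τ} dσ dσ′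
        {rest O σ₁ C.left A.left} {rest O σ₁ B.left D.left}
        {rest O σ₁′ C.right A.right} {rest O σ₁′ B.right D.right} φr φ″
      step₁ = transfer
        {rest O σ₁ C.left A.left} {rest O σ₁ B.left D.left}
        {rest O σ₁′ C.right A.right} {rest O σ₁′ B.right D.right}
        (QuotientComparison.quotientComparison em O u {lf} {ι} {τ} linearRing σ₁ σ₁′ {M₁} {M₁′} C₁ C A)
        (QuotientComparison.quotientComparison em O u {lf} {ι} {τ} linearRing σ₁ σ₁′ {M₂} {M₂′} C₂ B D)
        φr φ″ (λ (x , p) → Congruence.≈⇒~ (overO₁ O M₂′) (Lattice.submodule D.right) (square x))
      step₂ : Transfer {lf = lf} {ι = residueHom O ι} {τ = residueTopology O τ} dσ′ dσ′
        {rest O σ₁′ C.right A.right} {rest O σ₁′ B.right D.right} {rest O σ₁′ C′ A′} {rest O σ₁′ B′ D′} φ″ φr′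
      step₂ = linear-transfer em lf (residueHom O ι) (residueTopology O τ) us dσ′
        {rest O σ₁′ C.right A.right} {rest O σ₁′ B.right D.right} {rest O σ₁′ C′ A′} {rest O σ₁′ B′ D′}
        (L′.rest-finite {M₁′} C.right A.right) (L′.rest-finite {M₂′} B.right D.right)
        R₁ R₂ φ″ φr′ (λ {x} {x′} → compatible {x} {x′})

    -- Two changes in succession. On quotients of common lattices the structure is changed from σ₁
    -- to σ₁′ by the induction hypothesis. Afterwards C′/A′ and B′/D′ are σ₁′-linear subquotients of
    -- those quotients, and `linear-transfer` applies.
    bilattice-transfer : Transfer {lf = lf} {ι = residueHom O ι} {τ = residueTopology O τ} dσ dσ′
      {rest O σ₁ (Bilattice.left C) (Bilattice.left A)} {rest O σ₁ (Bilattice.left B) (Bilattice.left D)}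
      {rest O σ₁′ C′ A′} {rest O σ₁′ B′ D′}
      (inducedMap O {ι = ι} {τ = τ} σ₁ {M₁} {M₂} φ {Bilattice.left C} {Bilattice.left A} {Bilattice.left D} {Bilattice.left B} r)
      (inducedMap O {ι = ι} {τ = τ} σ₁′ {M₁′} {M₂′} φ′ {C′} {A′} {D′} {B′} r′)
    bilattice-transfer = transfer-trans {lf = lf} {ι = residueHom O ι} {τ = residueTopology O τ} {dσ} {dσ′} {dσ′}
      {rest O σ₁ C.left A.left} {rest O σ₁ B.left D.left}
      {rest O σ₁′ C.right A.right} {rest O σ₁′ B.right D.right}
      {rest O σ₁′ C′ A′} {rest O σ₁′ B′ D′} {φr} {φ″} {φr′} step₁ step₂

module _ (em : ExcludedMiddle ℓ) {𝕜 : CRing ℓ} where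

  comparison-transfer : ∀ {n} {K : CRing ℓ} (lf : LocalField n K) (ι : IntegralHom 𝕜 lf) (τ : TopologyOn K)
    (us : Uniformizers lf) → AdaptedTopologies lf ι τ us → (σ σ′ : Liftings lf ι τ) →
    ComparisonTransfer lf ι τ σ σ′
  comparison-transfer (dim0 _) ι τ us adapted σ σ′ C₁ C₂ φ φ′ square = record
    { bt = λ _ → tt ; btᵢⱼ = λ () }
  comparison-transfer (step F O lf) ι τ (u , us) (adapted , adapteds) (σ₁ , dσ) (σ₁′ , dσ′) {M₁} {M₂} {M₁′} {M₂′}
    C₁ C₂ φ φ′ square = transfer-step T₁.tame T₂.tame
      (λ {x} {x′} p → M₂′.≈ᴹ-trans (M₂′.≈ᴹ-sym (square x)) (φ′-cong p)) reduce
    where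
    open Lattices em F O u
    open TransferStep em O u {lf} {ι} {τ} σ₁ σ₁′ dσ dσ′ {M₁} {M₂} {M₁′} {M₂′} φ φ′
    residue-transfer : ComparisonTransfer lf (residueHom O ι) (residueTopology O τ) dσ dσ′
    residue-transfer = comparison-transfer lf (residueHom O ι) (residueTopology O τ) us adapteds dσ dσ′
    open BilatticeReduction em O {lf} {ι} {τ} u us (AdaptedTopology.linearRing adapted) σ₁ σ₁′ dσ dσ′
      residue-transfer {M₁} {M₂} {M₁′} {M₂′} C₁ C₂ φ φ′ square
    module M₂′ = LeftModule M₂′
    module T₁ = ComparisonTame em F O u adapted C₁
    module T₂ = ComparisonTame em F O u adapted C₂

    reduce : Refinable → ∀ {C′ A′ : Lattice O M₁′} {D′ B′ : Lattice O M₂′}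
      (r′ : _≺[_]_ O (A′ , B′) (fun φ′) (C′ , D′)) →
      ∃ λ (C : Lattice O M₁) → ∃ λ (A : Lattice O M₁) → ∃ λ (D : Lattice O M₂) → ∃ λ (B : Lattice O M₂) →
      Σ (_≺[_]_ O (A , B) (fun φ) (C , D)) λ r →
      Transfer {lf = lf} {ι = residueHom O ι} {τ = residueTopology O τ} dσ dσ′
        {rest O σ₁ C A} {rest O σ₁ B D} {rest O σ₁′ C′ A′} {rest O σ₁′ B′ D′}
        (inducedMap O {ι = ι} {τ = τ} σ₁ {M₁} {M₂} φ {C} {A} {D} {B} r)
        (inducedMap O {ι = ι} {τ = τ} σ₁′ {M₁′} {M₂′} φ′ {C′} {A′} {D′} {B′} r′)
    reduce refinable {C′} {A′} {D′} {B′} r′ =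
      Bilattice.left C , Bilattice.left A , Bilattice.left D , Bilattice.left B , r ,
      bilattice-transfer {C} {A} {D} {B} {C′} {A′} {D′} {B′} C′⊆C A⊆A′ D⊆D′ B′⊆B r r′
      where
      C = proj₁ (T₁.aboveRight C′)
      D = proj₁ (T₂.belowRight D′)
      C′⊆C = proj₂ (T₁.aboveRight C′)
      D⊆D′ = proj₂ (T₂.belowRight D′)
      refinement = refinable (Bilattice.left C , Bilattice.left D)
      module r₀ = _≺[_]_ (proj₂ refinement)
      -- A has to be a common lattice both below A′ and below the lattice that φ supplies for (C,
      -- D); dually for B.
      A₁ = T₁.belowRight A′
      A₀ = T₁.below (proj₁ A₁) (proj₁ (proj₁ refinement))
      A = proj₁ A₀
      B₁ = T₂.aboveRight B′
      B₀ = T₂.above (proj₁ B₁) (proj₂ (proj₁ refinement))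
      B = proj₁ B₀
      A⊆A′ : ∀ {y} → y ∈ Bilattice.right A → y ∈ A′
      A⊆A′ p = proj₂ A₁ (right-⊆ O C₁ A (proj₁ A₁) (proj₁ (proj₂ A₀)) p)
      B′⊆B : ∀ {y} → y ∈ B′ → y ∈ Bilattice.right B
      B′⊆B p = right-⊆ O C₂ (proj₁ B₁) B (proj₁ (proj₂ B₀)) (proj₂ B₁ p)
      r : _≺[_]_ O (Bilattice.left A , Bilattice.left B) (fun φ) (Bilattice.left C , Bilattice.left D)
      r = record
        { shrink = λ p → r₀.shrink (proj₂ (proj₂ A₀) p)
        ; grow = λ p → proj₂ (proj₂ B₀) (r₀.grow p)
        ; maps′ = λ p → r₀.maps′ (proj₂ (proj₂ A₀) p)
        ; maps = λ p → proj₂ (proj₂ B₀) (r₀.maps p)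
        }

-- The topology of iterated Laurent series

open-from-neighbourhoods : {A : Set ℓ} {_≈_ : Rel A ℓ} (τ : Topology _≈_) (U : Pred A ℓ) →
  (∀ x → U x → ∃ λ V → Open τ V × V x × V ⊆ U) → Open τ U
open-from-neighbourhoods {A = A} τ U nbhd = Topology.Open-≐ τ
  ((λ (i , p) → proj₂ (proj₂ (proj₂ (near i))) p) , λ {x} p → (x , p) , proj₁ (proj₂ (proj₂ (near (x , p)))))
  (Topology.Open-⋃ τ (Σ A U) (λ i → proj₁ (near i)) (λ i → proj₁ (proj₂ (near i))))
  where
  near : (i : Σ A U) → ∃ λ V → Open τ V × V (proj₁ i) × V ⊆ U
  near (x , p) = nbhd x p

-- The fine topology is described by the submodules Q such that, for every v, some basic
-- neighbourhood G of 0 in R satisfies G v ⊆ Q.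
module FineTopology {𝕜 R : CRing ℓ} (κ : RingHom 𝕜 R) (τR : TopologyOn R)
  (I : Set (lsuc ℓ)) (G : I → Pred (CommutativeRing.Carrier R) ℓ)
  (G-resp : ∀ i → G i Respects CommutativeRing._≈_ R) (G-0 : ∀ i → G i (CommutativeRing.0# R))
  (someIndex : I)
  (meet : ∀ i j → Σ I λ k → ∀ {h} → G k h → G i h × G j h)
  (translates-open : ∀ i c → Open τR (λ x → G i (CommutativeRing._-_ R x c)))
  (M : Mod R) where
  open LeftModule M
  private
    module R = CommutativeRing R
    Mₖ = restrictScalars κ M
    module P = ModuleProperties R M

  Basic : Submodule Mₖ → Set (lsuc ℓ)
  Basic Q = ∀ v → Σ I λ i → ∀ {h} → G i h → mem Q (h *ₗ v)

  basic-∩ : ∀ {Q Q′} → Basic Q → Basic Q′ → Basic (Submodules._∩ˢ_ {R = 𝕜} Mₖ Q Q′)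
  basic-∩ b b′ v = proj₁ k , λ p → proj₂ (b v) (proj₁ (proj₂ k p)) , proj₂ (b′ v) (proj₂ (proj₂ k p))
    where k = meet (proj₁ (b v)) (proj₁ (b′ v))

  basic-whole : Basic (Submodules.wholeSubmodule {R = 𝕜} Mₖ)
  basic-whole v = someIndex , λ _ → tt

  basic-preimage : ∀ a {Q} → Basic Q → Basic (preimage* κ M a Q)
  basic-preimage a {Q} b v = proj₁ (b (a *ₗ v)) , λ p →
    Submodule.mem-resp Q (P.*-comm-* _ a v) (proj₂ (b (a *ₗ v)) p)

  basicTopology : TopologyOnᴹ M
  basicTopology = record
    { Open = λ U → U Respects _≈ᴹ_ × (∀ x → U x → Σ (Submodule Mₖ) λ Q → Basic Q × (∀ {y} → mem Q y → U (x +ᴹ y)))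
    ; Open-saturated = proj₁
    ; Open-≐ = λ (U⊆V , V⊆U) (r , o) → (λ e p → U⊆V (r e (V⊆U p))) ,
        λ x p → let (Q , b , q) = o x (V⊆U p) in Q , b , λ y∈Q → U⊆V (q y∈Q)
    ; Open-whole = (λ _ _ → tt) , λ _ _ → Submodules.wholeSubmodule {R = 𝕜} Mₖ , basic-whole , λ _ → tt
    ; Open-∩ = λ (r , o) (r′ , o′) → (λ e (p , p′) → r e p , r′ e p′) , λ x (p , p′) →
        let (Q , b , q) = o x p ; (Q′ , b′ , q′) = o′ x p′ in
        Submodules._∩ˢ_ {R = 𝕜} Mₖ Q Q′ , basic-∩ {Q} {Q′} b b′ , λ (s , s′) → q s , q′ s′
    ; Open-⋃ = λ J U os → (λ e (j , p) → j , proj₁ (os j) e p) , λ x (j , p) →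
        let (Q , b , q) = proj₂ (os j) x p in Q , b , λ s → j , q s
    }

  private
    shift : ∀ x c y → (x +ᴹ -ᴹ c) +ᴹ y ≈ᴹ (x +ᴹ y) +ᴹ -ᴹ c
    shift x c y = ≈ᴹ-trans (+ᴹ-assoc _ _ _) (≈ᴹ-trans (+ᴹ-congˡ (+ᴹ-comm _ _)) (≈ᴹ-sym (+ᴹ-assoc _ _ _)))

    recentre : ∀ x y → x +ᴹ (y +ᴹ -ᴹ x) ≈ᴹ y
    recentre x y = ≈ᴹ-trans (+ᴹ-comm _ _) (P.sub-add y x)

    translate-basic : ∀ Q → Basic Q → ∀ c → Open basicTopology (λ x → mem Q (x +ᴹ -ᴹ c))
    translate-basic Q b c = (λ e → Q.mem-resp (+ᴹ-congʳ e)) , λ x p → Q , b , λ {y} q →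
      Q.mem-resp (shift x c y) (Q.mem-+ p q)
      where module Q = Submodule Q

    at-centre : ∀ (Q : Submodule Mₖ) x → mem Q (x +ᴹ -ᴹ x)
    at-centre Q x = Submodule.mem-resp Q (≈ᴹ-sym (-ᴹ‿inverseʳ x)) (Submodule.mem-0 Q)

    *-continuous-basic : ∀ a → Continuous basicTopology basicTopology (a *ₗ_)
    *-continuous-basic a V (r , o) = (λ e → r (*ₗ-congˡ e)) , λ x p →
      let (Q , b , q) = o (a *ₗ x) p in preimage* κ M a Q , basic-preimage a {Q} b ,
      λ s → r (≈ᴹ-sym (*ₗ-distribˡ a _ _)) (q s)

  -- `Basic` is tailored to the continuity of a ↦ am; the remaining axioms come from stability of
  -- basic submodules under intersection and under preimages by scalars.
  basicTopology-ST : IsSTModule κ τR M basicTopology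
  basicTopology-ST = record
    { isLinearTopology = record
      { +-continuous = λ W (r , o) x y p → let (Q , b , q) = o (x +ᴹ y) p in
          (λ z → mem Q (z +ᴹ -ᴹ x)) , (λ z → mem Q (z +ᴹ -ᴹ y)) ,
          translate-basic Q b x , translate-basic Q b y , at-centre Q x , at-centre Q y ,
          λ u v s t → r (≈ᴹ-trans (P.interchange _ _ _ _) (+ᴹ-cong (recentre x u) (recentre y v)))
            (q (Submodule.mem-+ Q s t))
      ; *-continuous = λ c → *-continuous-basic (⟦ κ ⟧ c)
      ; linear-basis = λ U (r , o) p → let (Q , b , q) = o 0ᴹ p in
          Q , (Submodule.mem-resp Q , λ x s → Q , b , λ t → Submodule.mem-+ Q s t) ,
          λ s → r (+ᴹ-identityˡ _) (q s)
      }
    ; *-continuousʳ = *-continuous-basic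
    ; *-continuousˡ = λ m V (r , o) → open-from-neighbourhoods τR (λ a → V (a *ₗ m)) λ h p →
        let (Q , b , q) = o (h *ₗ m) p ; (i , s) = b m in
        (λ x → G i (x R.- h)) , translates-open i h ,
        G-resp i (R.sym (R.-‿inverseʳ h)) (G-0 i) ,
        λ {x} t → r (≈ᴹ-trans (+ᴹ-congˡ (≈ᴹ-trans (*ₗ-distribʳ m _ _) (+ᴹ-congˡ (P.-‿*ˡ h m))))
          (recentre (h *ₗ m) (x *ₗ m))) (q (s t))
    }

  -- The fine topology is finer than the ST topology just built, in which these cosets are open.
  translate-open : {τ : TopologyOnᴹ M} → IsFineTopology κ τR M τ → ∀ Q → Basic Q →
    ∀ c → Open τ (λ x → mem Q (x +ᴹ -ᴹ c))
  translate-open fine Q b c = IsFineTopology.finest fine basicTopology basicTopology-ST (translate-basic Q b c)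

module _ {𝕜 : Set ℓ} (A : CRing ℓ) (κ : 𝕜 → CommutativeRing.Carrier A) where
  open CommutativeRing A hiding (zero)

  -- The index κ is a mere function, not a ring homomorphism: deciding that two structure maps
  -- of an iterated Laurent series ring agree definitionally then does not unfold the proofs
  -- that they are homomorphisms.
  record Stable : Set (lsuc ℓ) where
    field
      mem : Pred Carrier ℓ
      mem-resp : mem Respects _≈_
      mem-+ : ∀ {x y} → mem x → mem y → mem (x + y)
      mem-0 : mem 0#
      mem-* : ∀ c {x} → mem x → mem (κ c * x)

module _ {𝕜 : Set ℓ} {A : CRing ℓ} {κ : 𝕜 → CommutativeRing.Carrier A} where
  open CommutativeRing A hiding (zero)

  infix 4 _∈ˢ_
  _∈ˢ_ : Carrier → Stable A κ → Set ℓ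
  x ∈ˢ N = Stable.mem N x

  wholeStable : Stable A κ
  wholeStable = record
    { mem = λ _ → ⊤ ; mem-resp = λ _ _ → tt ; mem-+ = λ _ _ → tt ; mem-0 = tt ; mem-* = λ _ _ → tt }

  infixl 6 _∩ᵗ_
  _∩ᵗ_ : Stable A κ → Stable A κ → Stable A κ
  N ∩ᵗ N′ = record
    { mem = λ x → N.mem x × N′.mem x
    ; mem-resp = λ e (p , q) → N.mem-resp e p , N′.mem-resp e q
    ; mem-+ = λ (p , q) (p′ , q′) → N.mem-+ p p′ , N′.mem-+ q q′
    ; mem-0 = N.mem-0 , N′.mem-0
    ; mem-* = λ c (p , q) → N.mem-* c p , N′.mem-* c q
    }
    where
    module N = Stable N
    module N′ = Stable N′

  preimageStable : Carrier → Stable A κ → Stable A κ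
  preimageStable a N = record
    { mem = λ x → N.mem (a * x)
    ; mem-resp = λ e → N.mem-resp (*-congˡ e)
    ; mem-+ = λ p q → N.mem-resp (sym (distribˡ a _ _)) (N.mem-+ p q)
    ; mem-0 = N.mem-resp (sym (zeroʳ a)) N.mem-0
    ; mem-* = λ c p → N.mem-resp (ModuleProperties.*-comm-* A (regular A) (κ c) a _) (N.mem-* c p)
    }
    where module N = Stable N

module _ {𝕜 : Set ℓ} (A : CRing ℓ) (κ : 𝕜 → CommutativeRing.Carrier A) (τ : TopologyOn A) where
  open CommutativeRing A hiding (zero)

  -- The fine topology of A((t)) is only given as a topology of A[[t]]-modules, so it is not
  -- known that the preimage of an open submodule under multiplication by t⁻¹ is open; Op
  -- consists of open submodules for which all such preimages are open.
  record OpenFamily : Set (lsuc (lsuc ℓ)) where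
    field
      Op : Pred (Stable A κ) (lsuc ℓ)
      op-∩ : ∀ {N N′} → Op N → Op N′ → Op (N ∩ᵗ N′)
      op-whole : Op wholeStable
      op-preimage : ∀ a {N} → Op N → Op (preimageStable a N)
      op-translate : ∀ N → Op N → ∀ c → Open τ (λ x → x - c ∈ˢ N)
      op-separate : ∀ a → ¬ a ≈ 0# → ∃ λ N → Op N × ¬ a ∈ˢ N

    op-below : ∀ n (N : ℕ → Σ (Stable A κ) Op) → Σ (Σ (Stable A κ) Op) λ P →
      ∀ {x} → x ∈ˢ proj₁ P → ∀ i → i < n → x ∈ˢ proj₁ (N i)
    op-below zero N = (wholeStable , op-whole) , λ _ i ()
    op-below (suc n) N = (proj₁ (N n) ∩ᵗ proj₁ (proj₁ rec) , op-∩ {proj₁ (N n)} {proj₁ (proj₁ rec)} (proj₂ (N n)) (proj₂ (proj₁ rec))) ,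
      λ {x} (p , q) i i≤n → select i (ℕ.m≤n⇒m<n∨m≡n (ℕ.s≤s⁻¹ i≤n)) p q
      where
      rec = op-below n N
      select : ∀ {x} i → i < n ⊎ i ≡ n → x ∈ˢ proj₁ (N n) → x ∈ˢ proj₁ (proj₁ rec) → x ∈ˢ proj₁ (N i)
      select i (inj₁ i<n) p q = proj₂ rec q i i<n
      select i (inj₂ ≡.refl) p q = p

discreteFamily : {𝕜 : Set ℓ} (A : CRing ℓ) (κ : 𝕜 → CommutativeRing.Carrier A) (τ : TopologyOn A) →
  IsDiscrete τ → OpenFamily A κ τ
discreteFamily A κ τ discrete = record
  { Op = λ _ → ⊤
  ; op-∩ = λ _ _ → tt
  ; op-whole = tt
  ; op-preimage = λ _ _ → tt
  ; op-translate = λ N _ c → discrete _ λ e → Stable.mem-resp N (+-congʳ e)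
  ; op-separate = λ a a≉0 → record
      { mem = _≈ 0#
      ; mem-resp = λ e p → trans (sym e) p
      ; mem-+ = λ p q → trans (+-cong p q) (+-identityˡ 0#)
      ; mem-0 = refl
      ; mem-* = λ c p → trans (*-congˡ p) (zeroʳ _)
      } , tt , a≉0
  }
  where open CommutativeRing A

module Series (A : CRing ℓ) where
  open CommutativeRing A hiding (zero)
  open MonoidSum +-monoid using (sum)
  private
    module S = CommutativeRing (powerSeriesRing A)
    t = seriesVariable A
    open Exp S.semiring using (_^_; ^-homo-*)

  t^ : ℕ → S.Carrier
  t^ n = t ^ n

  t^-+ : ∀ m n → t^ (m ℕ.+ n) S.≈ t^ m S.* t^ n
  t^-+ = ^-homo-* t

  shifted : ℕ → S.Carrier → S.Carrier
  shifted n f = t^ n S.* f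

  sum-closed : (P : Pred Carrier ℓ) → P 0# → (∀ {x y} → P x → P y → P (x + y)) →
    ∀ {n} (f : Vector Carrier n) → (∀ i → P (f i)) → P (sum f)
  sum-closed P P0 P+ {zero} f p = P0
  sum-closed P P0 P+ {suc n} f p = P+ (p zero) (sum-closed P P0 P+ (f ∘ suc) (p ∘ suc))

  private
    sum-zero : ∀ {n} (f : Vector Carrier n) → (∀ i → f i ≈ 0#) → sum f ≈ 0#
    sum-zero f = sum-closed (_≈ 0#) refl (λ p q → trans (+-cong p q) (+-identityˡ 0#)) f

  constant-* : ∀ a f n → (⟦ constantSeries A ⟧ a S.* f) n ≈ a * f n
  constant-* a f zero = +-identityʳ _
  constant-* a f (suc n) = trans (+-congˡ (sum-zero {suc n} _ λ i → zeroˡ (f (n ∸ toℕ i)))) (+-identityʳ _)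

  t*-suc : ∀ f n → (t S.* f) (suc n) ≈ f n
  t*-suc f n = trans (+-cong (zeroˡ _) (trans (+-cong (*-identityˡ _) (sum-zero {n} _ λ i → zeroˡ (f (n ∸ suc (toℕ i))))) (+-identityʳ _)))
    (+-identityˡ _)

  t*-zero : ∀ f → (t S.* f) 0 ≈ 0#
  t*-zero f = trans (+-identityʳ _) (zeroˡ _)

  shifted-+ : ∀ n f j → shifted n f (n ℕ.+ j) ≈ f j
  shifted-+ zero f j = S.*-identityˡ f j
  shifted-+ (suc n) f j = trans (S.*-assoc t (t^ n) f (suc (n ℕ.+ j)))
    (trans (t*-suc (shifted n f) (n ℕ.+ j)) (shifted-+ n f j))

  shifted-< : ∀ n f j → j < n → shifted n f j ≈ 0#
  shifted-< (suc n) f zero _ = trans (S.*-assoc t (t^ n) f 0) (t*-zero (shifted n f))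
  shifted-< (suc n) f (suc j) (s≤s j<n) = trans (S.*-assoc t (t^ n) f (suc j))
    (trans (t*-suc (shifted n f) j) (shifted-< n f j j<n))

  shifted-tail : ∀ r f → (∀ j → j < r → f j ≈ 0#) → f S.≈ shifted r (λ j → f (r ℕ.+ j))
  shifted-tail r f p j = split (ℕ.≤-<-connex r j)
    where
    split : r ≤ j ⊎ j < r → f j ≈ shifted r (λ j → f (r ℕ.+ j)) j
    split (inj₁ r≤j) = ≡.subst (λ k → f k ≈ shifted r (λ j → f (r ℕ.+ j)) k) (ℕ.m+[n∸m]≡n r≤j)
      (sym (shifted-+ r (λ j → f (r ℕ.+ j)) (j ∸ r)))
    split (inj₂ j<r) = trans (p j j<r) (sym (shifted-< r (λ j → f (r ℕ.+ j)) j j<r))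

  private
    module L = CommutativeRing (laurentSeriesRing A)

  fraction-≈ : ∀ {x y : S.Carrier} {m n : ℕ} → shifted n x S.≈ shifted m y → (x , m) L.≈ (y , n)
  fraction-≈ e = record { k = 0 ; equal = S.*-congˡ {t^ 0} e }

  -- The power tᵏ in the equality of fractions is cancelled by reading coefficients from index k on.
  fraction-cancel : ∀ {x y : S.Carrier} {m n : ℕ} → (x , m) L.≈ (y , n) → shifted n x S.≈ shifted m y
  fraction-cancel {x} {y} {m} {n} record { k = k ; equal = e } j = trans (sym (shifted-+ k (shifted n x) j))
    (trans (e (k ℕ.+ j)) (shifted-+ k (shifted m y) j))

module LaurentFamily (em : ExcludedMiddle ℓ) {𝕜 A : CRing ℓ} (κ : RingHom 𝕜 A) (τA : TopologyOn A)
  (family : OpenFamily A ⟦ κ ⟧ τA) (τ : TopologyOn (laurentSeriesRing A)) (laurent : IsLaurentTopology κ τA τ) where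
  open OpenFamily family
  open IsLaurentTopology laurent
  open Series A
  private
    module A = CommutativeRing A
    module B = CommutativeRing (powerSeriesRing A)
    module L = CommutativeRing (laurentSeriesRing A)
    C : A.Carrier → B.Carrier
    C = ⟦ constantSeries A ⟧
    toL : B.Carrier → L.Carrier
    toL = ⟦ toLaurentSeries A ⟧

  OpSub : Set (lsuc ℓ)
  OpSub = Σ (Stable A ⟦ κ ⟧) Op

  _∩ᴼ_ : OpSub → OpSub → OpSub
  (N , o) ∩ᴼ (N′ , o′) = N ∩ᵗ N′ , op-∩ {N} {N′} o o′

  wholeᴼ : OpSub
  wholeᴼ = wholeStable , op-whole

  below-index : ∀ n (N : Fin n → OpSub) → Σ OpSub λ P → ∀ {x} → x ∈ˢ proj₁ P → ∀ i → x ∈ˢ proj₁ (N i)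
  below-index zero N = wholeᴼ , λ _ ()
  below-index (suc n) N = N zero ∩ᴼ proj₁ rec , λ { (p , q) zero → p ; (p , q) (suc i) → proj₂ rec q i }
    where rec = below-index n (N ∘ suc)

  module Truncated (i : ℕ) where
    private
      T = truncatedPolynomials A (suc i)
      module T = LeftModule T
    open FineTopology {𝕜 = 𝕜} {R = A} κ τA OpSub (Stable.mem ∘ proj₁)
      (Stable.mem-resp ∘ proj₁) (Stable.mem-0 ∘ proj₁) wholeᴼ (λ N N′ → N ∩ᴼ N′ , λ p → p)
      (λ (N , o) c → op-translate N o c) T public

    box : OpSub → Submodule (restrictScalars κ T)
    box (N , o) = record
      { mem = λ f → ∀ j → N.mem (f j)
      ; mem-resp = λ e p j → N.mem-resp (e j) (p j)
      ; mem-+ = λ p q j → N.mem-+ (p j) (q j)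
      ; mem-0 = λ j → N.mem-0
      ; mem-* = λ c p j → N.mem-* c (p j)
      }
      where module N = Stable N

    box-basic : ∀ N → Basic (box N)
    box-basic (N , o) v = proj₁ M , λ p j → Stable.mem-resp N (A.*-comm _ _) (proj₂ M p j)
      where M = below-index (suc i) (λ j → preimageStable (v j) N , op-preimage (v j) {N} o)

    box-open : ∀ N (c : T.Carrierᴹ) → Open (τtruncated i) (λ f → mem (box N) (f T.+ᴹ T.-ᴹ c))
    box-open N c = translate-open {τ = τtruncated i} (truncated-fine i) (box N) (box-basic N) c

  Index : Set (lsuc ℓ)
  Index = ℕ × OpSub

  -- Neighbourhoods of 0 in A[[t]] for the inverse limit topology, pulled back from the boxes in the
  -- truncations.
  jets : Index → Pred B.Carrier ℓ
  jets (i , N , o) h = ∀ j → j ≤ i → h j ∈ˢ N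

  jets-meet : ∀ a b → Σ Index λ c → ∀ {h} → jets c h → jets a h × jets b h
  jets-meet (i , N) (i′ , N′) = (i ℕ.+ i′ , N ∩ᴼ N′) , λ p →
    (λ j j≤i → proj₁ (p j (ℕ.≤-trans j≤i (ℕ.m≤m+n i i′)))) ,
    (λ j j≤i → proj₂ (p j (ℕ.≤-trans j≤i (ℕ.m≤n+m i′ i))))

  jets-translate : ∀ a c → Open τpower (λ h → jets a (h B.- c))
  jets-translate (i , N) c = Topology.Open-≐ τpower
    ((λ {h} p j j≤i → ≡.subst (λ k → h k A.- c k ∈ˢ proj₁ N) (Fin.toℕ-fromℕ< (s≤s j≤i)) (p (fromℕ< (s≤s j≤i))))
    , λ p j → p (toℕ j) (ℕ.s≤s⁻¹ (Fin.toℕ<n j)))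
    (power-continuous i _ (Truncated.box-open i N (truncate A (suc i) c)))

  module Fine = FineTopology {𝕜 = 𝕜} {R = powerSeriesRing A}
    (composeHom {B = A} {C = powerSeriesRing A} κ (constantSeries A)) τpower Index jets
    (λ (i , N , o) e p j j≤i → Stable.mem-resp N (e j) (p j j≤i)) (λ (i , N , o) j j≤i → Stable.mem-0 N)
    (0 , wholeᴼ) jets-meet jets-translate (laurentModule A)

  toModule : Stable (laurentSeriesRing A) (⟦ constantLaurent A ⟧ ∘ ⟦ κ ⟧) →
    Submodule (restrictScalars (composeHom {B = A} {C = powerSeriesRing A} κ (constantSeries A)) (laurentModule A))
  toModule N = record
    { mem = N.mem ; mem-resp = N.mem-resp ; mem-+ = N.mem-+ ; mem-0 = N.mem-0 ; mem-* = N.mem-* }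
    where module N = Stable N

  OpL : Pred (Stable (laurentSeriesRing A) (⟦ constantLaurent A ⟧ ∘ ⟦ κ ⟧)) (lsuc ℓ)
  OpL N = Fine.Basic (toModule N)

  -- Laurent series whose coefficient of t⁻ⁱ lies in W i for all i ≥ 0; the pair (x , q)
  -- stands for t⁻ᑫ x.
  principalPart : (ℕ → OpSub) → Stable (laurentSeriesRing A) (⟦ constantLaurent A ⟧ ∘ ⟦ κ ⟧)
  principalPart W = record
    { mem = part
    ; mem-resp = λ {f} {g} → part-resp {f} {g}
    ; mem-+ = λ {f} {g} p q i j e → W.mem-+ i
        (part-shift {f} (proj₂ g) p i j e) (part-shift {g} (proj₂ f) q i j (≡.trans e (ℕ.+-comm (proj₂ f) (proj₂ g))))
    ; mem-0 = λ i j _ → W.mem-0 i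
    ; mem-* = λ c {f} p i j e → W.mem-resp i (A.sym (constant-* (⟦ κ ⟧ c) (proj₁ f) j)) (W.mem-* i c (p i j e))
    }
    where
    module W i = Stable (proj₁ (W i))
    part : Pred L.Carrier _
    part (x , q) = ∀ i j → i ℕ.+ j ≡ q → W.mem i (x j)
    part-shift : ∀ {f} n → part f → part (shifted n (proj₁ f) , proj₂ f ℕ.+ n)
    part-shift {x , m} n p i j e = split (ℕ.≤-<-connex n j)
      where
      split : n ≤ j ⊎ j < n → W.mem i (shifted n x j)
      split (inj₂ j<n) = W.mem-resp i (A.sym (shifted-< n x j j<n)) (W.mem-0 i)
      split (inj₁ n≤j) = W.mem-resp i (A.trans (A.sym (shifted-+ n x (j ∸ n)))
          (≡.subst (λ k → shifted n x (n ℕ.+ (j ∸ n)) A.≈ shifted n x k) (ℕ.m+[n∸m]≡n n≤j) A.refl))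
        (p i (j ∸ n) (ℕ.+-cancelʳ-≡ n _ _ (≡.trans (ℕ.+-assoc i (j ∸ n) n)
          (≡.trans (≡.cong (i ℕ.+_) (ℕ.m∸n+n≡m n≤j)) e))))
    part-unshift : ∀ {x m} n → part (shifted n x , m ℕ.+ n) → part (x , m)
    part-unshift {x} {m} n p i j e = W.mem-resp i (shifted-+ n x j) (p i (n ℕ.+ j)
      (≡.trans (≡.cong (i ℕ.+_) (ℕ.+-comm n j)) (≡.trans (≡.sym (ℕ.+-assoc i j n)) (≡.cong (ℕ._+ n) e))))
    part-resp : ∀ {f g} → f L.≈ g → part f → part g
    part-resp {x , m} {y , n} e p = part-unshift {y} {n} m λ i j e′ →
      W.mem-resp i (fraction-cancel {x} {y} {m} {n} e j) (part-shift {x , m} n p i j (≡.trans e′ (ℕ.+-comm n m)))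

  -- The coefficient of t⁻ⁱ in h · t⁻ᑫx is a sum of products hₗ xⱼ₋ₗ with i + j = q. Hence only i ≤
  -- q and l ≤ q occur, and finitely many conditions on finitely many coefficients of h suffice,
  -- although W imposes infinitely many.
  principalPart-op : ∀ W → OpL (principalPart W)
  principalPart-op W (x , q) = (q , N) , λ {h} p i j e → sum-closed (W.mem i) (W.mem-0 i) (W.mem-+ i) {suc j}
      (λ l → h (toℕ l) A.* x (j ∸ toℕ l)) λ l → W.mem-resp i (A.*-comm _ _)
        (proj₂ (Nᵢ i) (proj₂ N₀ (p (toℕ l) (ℕ.≤-trans (ℕ.s≤s⁻¹ (Fin.toℕ<n l)) (j≤q i j e))) i (s≤s (i≤q i j e)))
          (j ∸ toℕ l) (s≤s (ℕ.≤-trans (ℕ.m∸n≤m j (toℕ l)) (j≤q i j e))))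
    where
    module W i = Stable (proj₁ (W i))
    Nᵢ : ∀ i → _
    Nᵢ i = op-below (suc q) (λ r → preimageStable (x r) (proj₁ (W i)) , op-preimage (x r) {proj₁ (W i)} (proj₂ (W i)))
    N₀ = op-below (suc q) (λ i → proj₁ (Nᵢ i))
    N = proj₁ N₀
    i≤q : ∀ i j → i ℕ.+ j ≡ q → i ≤ q
    i≤q i j e = ≡.subst (i ≤_) e (ℕ.m≤m+n i j)
    j≤q : ∀ i j → i ℕ.+ j ≡ q → j ≤ q
    j≤q i j e = ≡.subst (j ≤_) e (ℕ.m≤n+m j i)

  t⁻^ : ℕ → L.Carrier
  t⁻^ j = B.1# , j

  private
    nonzero-coefficient : ∀ f → ¬ f L.≈ L.0# → ∃ λ j → ¬ proj₁ f j A.≈ A.0#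
    nonzero-coefficient (x , q) f≉0 = decidable-stable em λ none → f≉0 (fraction-≈ {x} {B.0#} {q} {0} (begin
      shifted 0 x     ≈⟨ B.*-congˡ {t^ 0} {x} {B.0#} (λ j → decidable-stable em λ xj≉0 → none (j , xj≉0)) ⟩
      shifted 0 B.0#  ≈⟨ B.zeroʳ (t^ 0) ⟩
      B.0#            ≈⟨ B.zeroʳ (t^ q) ⟨
      shifted q B.0#  ∎))
      where open ≈-Reasoning B.setoid

  laurentFamily : OpenFamily (laurentSeriesRing A) (⟦ constantLaurent A ⟧ ∘ ⟦ κ ⟧) τ
  laurentFamily = record
    { Op = OpL
    ; op-∩ = λ {N} {N′} b b′ → Fine.basic-∩ {toModule N} {toModule N′} b b′
    ; op-whole = Fine.basic-whole
    ; op-preimage = λ a {N} b v → proj₁ (b (a L.* v)) , λ {h} p →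
        Stable.mem-resp N (ModuleProperties.*-comm-* (laurentSeriesRing A) (regular (laurentSeriesRing A)) (toL h) a v) (proj₂ (b (a L.* v)) p)
    ; op-translate = λ N b c → Fine.translate-open {τ} laurent-fine (toModule N) b c
    ; op-separate = λ f f≉0 →
        let (j , xj≉0) = nonzero-coefficient f f≉0
            (N , o , N∌) = op-separate (proj₁ f j) xj≉0
            W = principalPart (λ _ → N , o)
        -- The nonzero coefficient may belong to a positive power of t, which `principalPart` does
        -- not see; multiplication by t⁻ʲ moves it to the exponent -q, where q is the exponent of
        -- the denominator of f.
        in preimageStable (t⁻^ j) W ,
          (λ v → proj₁ (principalPart-op (λ _ → N , o) (t⁻^ j L.* v)) , λ {h} p →
            Stable.mem-resp W (ModuleProperties.*-comm-* (laurentSeriesRing A) (regular (laurentSeriesRing A)) (toL h) (t⁻^ j) v)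
              (proj₂ (principalPart-op (λ _ → N , o) (t⁻^ j L.* v)) p)) ,
          λ p → N∌ (Stable.mem-resp N (B.*-identityˡ (proj₁ f) j) (p (proj₂ f) j (ℕ.+-comm (proj₂ f) j)))
    }

module LaurentTopology (em : ExcludedMiddle ℓ) {𝕜 A : CRing ℓ} (κ : RingHom 𝕜 A) (τA : TopologyOn A)
  (family : OpenFamily A ⟦ κ ⟧ τA) (τ : TopologyOn (laurentSeriesRing A)) (laurent : IsLaurentTopology κ τA τ) where
  open OpenFamily family
  open IsLaurentTopology laurent
  open Series A
  private
    module A = CommutativeRing A
    module B = CommutativeRing (powerSeriesRing A)
    module L = CommutativeRing (laurentSeriesRing A)
    C : A.Carrier → B.Carrier
    C = ⟦ constantSeries A ⟧
    toL : B.Carrier → L.Carrier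
    toL = ⟦ toLaurentSeries A ⟧

  open LaurentFamily em κ τA family τ laurent

  series-continuous : ∀ U → Open τ U → Open τpower (U ∘ toL)
  series-continuous U o = Topology.Open-≐ τpower
    ((λ {h} → Topology.Open-saturated τ o (L.*-identityʳ (toL h))) ,
      λ {h} → Topology.Open-saturated τ o (L.sym (L.*-identityʳ (toL h))))
    (IsSTModule.*-continuousˡ (IsFineTopology.isSTModule laurent-fine) L.1# U o)

  private
    coinducedByConstants : TopologyOn (powerSeriesRing A)
    coinducedByConstants = record
      { Open = λ U → U Respects B._≈_ × Open τA (U ∘ C)
      ; Open-saturated = proj₁
      ; Open-≐ = λ (U⊆V , V⊆U) (r , o) → (λ e p → U⊆V (r e (V⊆U p))) ,
          Topology.Open-≐ τA ((λ p → U⊆V p) , λ p → V⊆U p) o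
      ; Open-whole = (λ _ _ → tt) , Topology.Open-whole τA
      ; Open-∩ = λ (r , o) (r′ , o′) → (λ e (p , q) → r e p , r′ e q) , Topology.Open-∩ τA o o′
      ; Open-⋃ = λ I U os → (λ e (i , p) → i , proj₁ (os i) e p) ,
          Topology.Open-⋃ τA I (λ i → U i ∘ C) (λ i → proj₂ (os i))
      }

    truncate-cong : ∀ i {f g : B.Carrier} → (∀ j → j < suc i → f j A.≈ g j) →
      ∀ j → truncate A (suc i) f j A.≈ truncate A (suc i) g j
    truncate-cong i p j = p (toℕ j) (Fin.toℕ<n j)

  -- The final topology along the constants makes every truncation continuous, because truncating a
  -- constant a gives a·e₀. The limit topology is the coarsest with this property, so its open sets
  -- pull back to open sets of A.
  constants-continuous : ∀ U → Open τ U → Open τA (U ∘ toL ∘ C)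
  constants-continuous U o = proj₂ (power-coarsest coinducedByConstants continuous (series-continuous U o))
    where
    continuous : ∀ i → Continuous coinducedByConstants (τtruncated i) (truncate A (suc i))
    continuous i V v = (λ {f} {g} e → Topology.Open-saturated (τtruncated i) v (λ j → e (toℕ j))) ,
      Topology.Open-≐ τA
        ((λ {a} → Topology.Open-saturated (τtruncated i) v (scalar a)) ,
          λ {a} → Topology.Open-saturated (τtruncated i) v (λ j → A.sym (scalar a j)))
        (IsSTModule.*-continuousˡ (IsFineTopology.isSTModule (truncated-fine i)) e₀ V v)
      where
      e₀ : Vector A.Carrier (suc i)
      e₀ = truncate A (suc i) B.1#
      scalar : ∀ a j → a A.* e₀ j A.≈ truncate A (suc i) (C a) j
      scalar a j = A.trans (A.sym (constant-* a B.1# (toℕ j))) (B.*-identityʳ (C a) (toℕ j))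

  private
    adicTopology : TopologyOn (powerSeriesRing A)
    adicTopology = record
      { Open = λ U → U Respects B._≈_ × Lift (lsuc ℓ) (∀ f → U f → ∃ λ m → ∀ g → (∀ j → j < m → f j A.≈ g j) → U g)
      ; Open-saturated = proj₁
      ; Open-≐ = λ (U⊆V , V⊆U) (r , lift o) → (λ e p → U⊆V (r e (V⊆U p))) ,
          lift λ f p → proj₁ (o f (V⊆U p)) , λ g e → U⊆V (proj₂ (o f (V⊆U p)) g e)
      ; Open-whole = (λ _ _ → tt) , lift λ _ _ → 0 , λ _ _ → tt
      ; Open-∩ = λ (r , lift o) (r′ , lift o′) → (λ e (p , q) → r e p , r′ e q) , lift λ f (p , q) →
          let (m , s) = o f p ; (n , t) = o′ f q in m ℕ.+ n , λ g e →
            s g (λ j j<m → e j (ℕ.≤-trans j<m (ℕ.m≤m+n m n))) , t g (λ j j<n → e j (ℕ.≤-trans j<n (ℕ.m≤n+m n m)))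
      ; Open-⋃ = λ I U os → (λ e (i , p) → i , proj₁ (os i) e p) , lift λ f (i , p) →
          let (m , s) = lower (proj₂ (os i)) f p in m , λ g e → i , s g e
      }

  -- The t-adic topology also makes every truncation continuous, whatever the topology of A, since
  -- it sees each truncation as discrete. Hence all open sets of A[[t]] are t-adically open.
  adic : ∀ U → Open τ U → U L.0# → ∃ λ m → ∀ h → U (toL (shifted m h))
  adic U o p = proj₁ near , λ h → proj₂ near (shifted (proj₁ near) h)
      (λ j j<m → A.sym (shifted-< (proj₁ near) h j j<m))
    where
    continuous : ∀ i → Continuous adicTopology (τtruncated i) (truncate A (suc i))
    continuous i V v = (λ {f} {g} e → Topology.Open-saturated (τtruncated i) v (λ j → e (toℕ j))) ,
      lift λ f p → suc i , λ g e → Topology.Open-saturated (τtruncated i) v (truncate-cong i e) p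
    near = lower (proj₂ (power-coarsest adicTopology continuous (series-continuous U o))) B.0# p

  private
    excluding : ∀ a → Σ OpSub λ N → a ∈ˢ proj₁ N → a A.≈ A.0#
    excluding a = decide em
      where
      decide : Dec (a A.≈ A.0#) → Σ OpSub λ N → a ∈ˢ proj₁ N → a A.≈ A.0#
      decide (yes a≈0) = wholeᴼ , λ _ → a≈0
      decide (no a≉0) = let (N , o , N∌a) = op-separate a a≉0 in (N , o) , λ p → contradiction p N∌a

    m+[q∸m]≡q+[m∸q] : ∀ m q → m ℕ.+ (q ∸ m) ≡ q ℕ.+ (m ∸ q)
    m+[q∸m]≡q+[m∸q] zero q = ≡.sym (≡.trans (≡.cong (q ℕ.+_) (ℕ.0∸n≡0 q)) (ℕ.+-identityʳ q))
    m+[q∸m]≡q+[m∸q] (suc m) zero = ℕ.+-identityʳ (suc m)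
    m+[q∸m]≡q+[m∸q] (suc m) (suc q) = ≡.cong suc (m+[q∸m]≡q+[m∸q] m q)

  -- If c m has a pole of order p > m with coefficient a, then W p excludes a.
  separation : (c : ℕ → L.Carrier) → Σ (ℕ → OpSub) λ W →
    ∀ m → c m ∈ˢ principalPart W → ∃ λ h → toL (t^ m) L.* c m L.≈ toL h
  separation c = (λ p → proj₁ (W p)) , λ m part → let (x , q) = c m in
      -- This is tᵐ⁻ᑫx: of the two truncated differences at most one is nonzero, which covers m ≥ q
      -- and m < q together.
      shifted (m ∸ q) (λ j → x ((q ∸ m) ℕ.+ j)) ,
      fraction-≈ {shifted m x} {shifted (m ∸ q) (λ j → x ((q ∸ m) ℕ.+ j))} {q} {0}
        (cleared m x q (λ j j<q∸m → vanishing m part j j<q∸m))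
    where
    W : ∀ p → _
    -- Only the finitely many m < p are concerned, so one member of the family meets all conditions.
    -- The index q ∸ p is that of t⁻ᵖ when p ≤ q; otherwise it is 0 and adds a harmless restriction.
    W p = op-below p (λ m → proj₁ (excluding (proj₁ (c m) (proj₂ (c m) ∸ p))))
    vanishing : ∀ m → c m ∈ˢ principalPart (λ p → proj₁ (W p)) →
      ∀ j → j < proj₂ (c m) ∸ m → proj₁ (c m) j A.≈ A.0#
    vanishing m part j j<q∸m = ≡.subst (λ k → x k A.≈ A.0#) q∸p≡j
        (proj₂ (excluding (x (q ∸ p))) (proj₂ (W p)
          (≡.subst (λ k → x k ∈ˢ proj₁ (proj₁ (W p))) (≡.sym q∸p≡j) (part p j (ℕ.m∸n+n≡m j≤q))) m m<p))
      where
      x = proj₁ (c m)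
      q = proj₂ (c m)
      p = q ∸ j
      j≤q : j ≤ q
      j≤q = ℕ.≤-trans (ℕ.<⇒≤ j<q∸m) (ℕ.m∸n≤m q m)
      q∸p≡j : q ∸ p ≡ j
      q∸p≡j = ℕ.m∸[m∸n]≡n j≤q
      m<p : m < p
      m<p = ℕ.m+n≤o⇒m≤o∸n (suc m) (≡.subst (_≤ q) (≡.cong suc (ℕ.+-comm j m))
        (ℕ.≤-trans (ℕ.+-monoˡ-≤ m j<q∸m) (ℕ.≤-reflexive (ℕ.m∸n+n≡m (m≤q)))))
        where
        m≤q : m ≤ q
        m≤q = ℕ.<⇒≤ (ℕ.m∸n≢0⇒n<m λ e → contradiction (≡.subst (j <_) e j<q∸m) λ ())
    cleared : ∀ m x q → (∀ j → j < q ∸ m → x j A.≈ A.0#) →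
      shifted 0 (shifted m x) B.≈ shifted q (shifted (m ∸ q) (λ j → x ((q ∸ m) ℕ.+ j)))
    cleared m x q v = begin
      t^ 0 B.* (t^ m B.* x)               ≈⟨ B.*-identityˡ (t^ m B.* x) ⟩
      t^ m B.* x                          ≈⟨ B.*-congˡ {t^ m} (shifted-tail (q ∸ m) x v) ⟩
      t^ m B.* (t^ (q ∸ m) B.* y)         ≈⟨ B.*-assoc (t^ m) (t^ (q ∸ m)) y ⟨
      (t^ m B.* t^ (q ∸ m)) B.* y         ≈⟨ B.*-congʳ {y} (t^-+ m (q ∸ m)) ⟨
      t^ (m ℕ.+ (q ∸ m)) B.* y            ≡⟨ ≡.cong (λ k → t^ k B.* y) (m+[q∸m]≡q+[m∸q] m q) ⟩
      t^ (q ℕ.+ (m ∸ q)) B.* y            ≈⟨ B.*-congʳ {y} (t^-+ q (m ∸ q)) ⟩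
      (t^ q B.* t^ (m ∸ q)) B.* y         ≈⟨ B.*-assoc (t^ q) (t^ (m ∸ q)) y ⟩
      t^ q B.* (t^ (m ∸ q) B.* y)         ∎
      where
      open ≈-Reasoning B.setoid
      y : B.Carrier
      y j = x ((q ∸ m) ℕ.+ j)

-- Descent of the topology to the residue fields

linearRing-of-ST : {𝕜 K : CRing ℓ} {κ : RingHom 𝕜 K} {τ : TopologyOn K} → IsSTRing κ τ → LinearRing κ τ
linearRing-of-ST {K = K} {κ} {τ} st = record
  { translate = λ c V v → open-from-neighbourhoods τ (λ x → V (c + x)) λ x p →
      let (U , W , u , w , Uc , Wx , s) = +-continuous V v c x p in W , w , Wx , λ {y} Wy → s c y Uc Wy
  ; multiply = IsSTRing.*-continuous st
  ; linear-basis = λ U u p → let (N , o , q) = linear-basis U u p in record { submodule = N ; isOpen = o } , q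
  }
  where
  open CommutativeRing K
  open IsLinearTopology (IsSTRing.isLinearTopology st)

-- An open submodule N of K induces on k₁ the classes of elements of N ∩ O. Their preimage in O is
-- open as the trace of a union of translates of N by elements of the maximal ideal.
residueLinearRing : {𝕜 : CRing ℓ} {n : ℕ} {K : CRing ℓ} {F : IsField K} (O : CDVRIn K)
  {lf : LocalField n (CDVRIn.residueField O)} {ι : IntegralHom 𝕜 (step F O lf)} {τ : TopologyOn K} →
  LinearRing (IntegralHom.hom ι) τ → LinearRing (IntegralHom.hom (residueHom O ι)) (residueTopology O τ)
residueLinearRing {K = K} O {lf} {ι} {τ} linear = record
  { translate = λ c V (r , V′ , v , e) → (λ {x} {y} p → r (k₁.+-cong {c} {c} {x} {y} (k₁.refl {c}) p)) ,
      (λ z → V′ (proj₁ c K.+ z)) , translate (proj₁ c) V′ v , (λ p → proj₁ e p) , λ p → proj₂ e p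
  ; multiply = λ c V (r , V′ , v , e) → (λ {x} {y} p → r (k₁.*-cong {c} {c} {x} {y} (k₁.refl {c}) p)) ,
      (λ z → V′ (proj₁ c K.* z)) , multiply (proj₁ c) V′ v , (λ p → proj₁ e p) , λ p → proj₂ e p
  ; linear-basis = λ U (r , V , v , (U⊆V , V⊆U)) p →
      let (N , N⊆V) = linear-basis V v (U⊆V p) in saturation N ,
      λ {x} (y , q , x~y) → r {y} {x} (k₁.sym {x} {y} x~y) (V⊆U (N⊆V q))
  }
  where
  module K = CommutativeRing K
  module O = CDVRIn O
  module 𝒪 = CommutativeRing O.valuationRing
  module k₁ = CommutativeRing O.residueField
  open LinearRing linear

  module _ (N : OpenSubmodule (IntegralHom.hom ι) τ) where
    private module N = OpenSubmodule N

    mem′ : Pred k₁.Carrier _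
    mem′ x = ∃ λ y → N.mem (proj₁ y) × x k₁.≈ y

    saturation : OpenSubmodule (IntegralHom.hom (residueHom O ι)) (residueTopology O τ)
    saturation = record
      { submodule = record
        { mem = mem′
        ; mem-resp = λ {x} {x′} e (y , p , q) → y , p , k₁.trans {x′} {x} {y} (k₁.sym {x} {x′} e) q
        ; mem-+ = λ {x} {x′} (y , p , q) (y′ , p′ , q′) → y 𝒪.+ y′ , N.mem-+ p p′ , k₁.+-cong {x} {y} {x′} {y′} q q′
        ; mem-0 = 𝒪.0# , N.mem-0 , k₁.refl {k₁.0#}
        ; mem-* = λ c {x} (y , p , q) → ⟦ toO₁ O ι ⟧ c 𝒪.* y , N.mem-* c p ,
            k₁.*-cong {⟦ toO₁ O ι ⟧ c} {⟦ toO₁ O ι ⟧ c} {x} {y} (k₁.refl {⟦ toO₁ O ι ⟧ c}) q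
        }
      ; isOpen = (λ {x} {x′} e (y , p , q) → y , p , k₁.trans {x′} {x} {y} (k₁.sym {x} {x′} e) q) ,
          ⋃ 𝔪 (λ w z → N.mem (K.- proj₁ (proj₁ w) K.+ z)) ,
          Topology.Open-⋃ τ 𝔪 _ (λ w → translate (K.- proj₁ (proj₁ w)) N.mem N.isOpen) ,
          ((λ {x} (y , p , q) → (x 𝒪.- y , q) , N.mem-resp (K.sym (cancel (proj₁ x) (proj₁ y))) p) ,
           λ {x} ((w , w∈𝔪) , p) → 𝒪.- w 𝒪.+ x , p ,
             Submodule.mem-resp O.maximalIdeal {w} {x 𝒪.- (𝒪.- w 𝒪.+ x)} (K.sym (cancel′ (proj₁ x) (proj₁ w))) w∈𝔪)
      }
      where
      𝔪 : Set _
      𝔪 = Σ 𝒪.Carrier (mem O.maximalIdeal)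
      open ModuleProperties K (regular K)
      cancel : ∀ x y → K.- (x K.+ K.- y) K.+ x K.≈ y
      cancel x y = K.trans (K.+-congʳ (K.sym (⁻¹-∙-comm x (K.- y)))) (K.trans (K.+-congʳ (K.+-comm _ _))
        (K.trans (K.+-assoc _ _ _) (K.trans (K.+-congˡ (K.-‿inverseˡ x)) (K.trans (K.+-identityʳ _) (-ᴹ-involutive y)))))
      cancel′ : ∀ x w → x K.+ K.- (K.- w K.+ x) K.≈ w
      cancel′ x w = K.trans (K.+-comm _ _) (K.trans (K.+-congʳ (K.-‿cong (K.+-comm _ _))) (cancel x w))

module _ (em : ExcludedMiddle ℓ) where

  openFamily : {𝕜 A : CRing ℓ} (κ : RingHom 𝕜 A) → ∀ n (τ : TopologyOn (iteratedLaurent n A)) →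
    IsIteratedLaurentTopology κ n τ → OpenFamily (iteratedLaurent n A) ⟦ iteratedHom κ n ⟧ τ
  openFamily {A = A} κ zero τ (lift discrete) = discreteFamily A ⟦ κ ⟧ τ discrete
  openFamily κ (suc n) τ (τ′ , it , laurent) =
    LaurentFamily.laurentFamily em (iteratedHom κ n) τ′ (openFamily κ n τ′ it) τ laurent

  -- A parametrization in a form that descends to k₁: openness of F is demanded only for members of
  -- `Op`, for which it can be verified again for the induced map.
  record Coordinates {𝕜 : CRing ℓ} {n} {K : CRing ℓ} (lf : LocalField n K) (ι : IntegralHom 𝕜 lf) (τ : TopologyOn K)
      {𝕜′ : CRing ℓ} (κ : RingHom 𝕜 𝕜′) : Set (lsuc (lsuc ℓ)) where
    private
      module K = CommutativeRing K
      module S = CommutativeRing (iteratedLaurent n 𝕜′)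
    field
      F : RingHom (iteratedLaurent n 𝕜′) K
      injective : ∀ x y → ⟦ F ⟧ x K.≈ ⟦ F ⟧ y → x S.≈ y
      surjective : ∀ y → ∃ λ x → ⟦ F ⟧ x K.≈ y
      𝕜-homomorphism : ∀ c → ⟦ F ⟧ (⟦ iteratedHom κ n ⟧ c) K.≈ ⟦ IntegralHom.hom ι ⟧ c
      τS : TopologyOn (iteratedLaurent n 𝕜′)
      isIterated : IsIteratedLaurentTopology κ n τS
      continuous : Continuous τS τ ⟦ F ⟧
      opens : ∀ N → OpenFamily.Op (openFamily κ n τS isIterated) N → Open τ (λ y → ∃ λ x → x ∈ˢ N × ⟦ F ⟧ x K.≈ y)
      respectsValuations : RespectsValuations lf 𝕜′ ⟦ F ⟧

  coordinates : {𝕜 : CRing ℓ} {n : ℕ} {K : CRing ℓ} {lf : LocalField n K} {ι : IntegralHom 𝕜 lf} {τ : TopologyOn K} →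
    Parametrization lf ι τ → Coordinates lf ι τ {lastResidueField lf} (lastResidueHom lf ι)
  coordinates {n = n} {K = K} {lf} {ι} {τ} P = record
    { F = record { ⟦_⟧ = F ; isRingHomomorphism = F.isRingHomomorphism }
    ; injective = λ x y → F.injective {x} {y}
    ; surjective = λ y → proj₁ (F.surjective y) , proj₂ (F.surjective y) {proj₁ (F.surjective y)} S.refl
    ; 𝕜-homomorphism = 𝕜-homomorphism
    ; τS = τS
    ; isIterated = isIteratedLaurentTopology
    ; continuous = continuous
    ; opens = λ N o → open-map (Stable.mem N) (Topology.Open-≐ τS
        ((λ {x} → Stable.mem-resp N {x S.- S.0#} {x} (minus-0 x)) , λ {x} → Stable.mem-resp N {x} {x S.- S.0#} (S.sym {x S.- S.0#} {x} (minus-0 x)))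
        (OpenFamily.op-translate (openFamily (lastResidueHom lf ι) n τS isIteratedLaurentTopology) N o S.0#))
    ; respectsValuations = respectsValuations
    }
    where
    open Parametrization P
    module F = IsRingIsomorphism isRingIsomorphism
    module S = CommutativeRing (iteratedLaurent n (lastResidueField lf))
    minus-0 : ∀ x → (x S.- S.0#) S.≈ x
    minus-0 = ModuleProperties.minus-zero (iteratedLaurent n (lastResidueField lf))
      (regular (iteratedLaurent n (lastResidueField lf)))

module LaurentStep (em : ExcludedMiddle ℓ) {𝕜 A K : CRing ℓ} {n : ℕ} {FK : IsField K} (O : CDVRIn K)
  {lf : LocalField n (CDVRIn.residueField O)} (ι : IntegralHom 𝕜 (step FK O lf)) (τ : TopologyOn K)
  (linear : LinearRing (IntegralHom.hom ι) τ)
  (κ : RingHom 𝕜 A) (τA : TopologyOn A) (family : OpenFamily A ⟦ κ ⟧ τA)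
  (τL : TopologyOn (laurentSeriesRing A)) (laurent : IsLaurentTopology κ τA τL)
  (F : RingHom (laurentSeriesRing A) K)
  (injective : ∀ x y → CommutativeRing._≈_ K (⟦ F ⟧ x) (⟦ F ⟧ y) → CommutativeRing._≈_ (laurentSeriesRing A) x y)
  (surjective : ∀ y → ∃ λ x → CommutativeRing._≈_ K (⟦ F ⟧ x) y)
  (𝕜-homomorphism : ∀ c → CommutativeRing._≈_ K (⟦ F ⟧ (⟦ constantLaurent A ⟧ (⟦ κ ⟧ c))) (⟦ IntegralHom.hom ι ⟧ c))
  (continuous : Continuous τL τ ⟦ F ⟧)
  (opens : ∀ N → OpenFamily.Op (LaurentFamily.laurentFamily em κ τA family τL laurent) N →
    Open τ (λ y → ∃ λ x → x ∈ˢ N × CommutativeRing._≈_ K (⟦ F ⟧ x) y))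
  (into : ∀ f → CDVRIn.mem O (⟦ F ⟧ (⟦ toLaurentSeries A ⟧ f)))
  (onto : ∀ x → CDVRIn.mem O x → ∃ λ f → CommutativeRing._≈_ K (⟦ F ⟧ (⟦ toLaurentSeries A ⟧ f)) x)
  (F̄ : CommutativeRing.Carrier A → CommutativeRing.Carrier (CDVRIn.residueField O))
  (F̄-residue : ∀ f → CommutativeRing._≈_ (CDVRIn.residueField O) (F̄ (f 0)) (⟦ F ⟧ (⟦ toLaurentSeries A ⟧ f) , into f))
  where
  open LaurentFamily em κ τA family τL laurent using (principalPart; principalPart-op; wholeᴼ; t⁻^)
  open LaurentTopology em κ τA family τL laurent using (constants-continuous; adic; separation)
  open Series A
  private
    module A = CommutativeRing A
    module B = CommutativeRing (powerSeriesRing A)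
    module L = CommutativeRing (laurentSeriesRing A)
    module K = CommutativeRing K
    module O = CDVRIn O
    module 𝒪 = CommutativeRing O.valuationRing
    module k₁ = CommutativeRing O.residueField
    module F = RingHom F
    toL : B.Carrier → L.Carrier
    toL = ⟦ toLaurentSeries A ⟧
    C : A.Carrier → B.Carrier
    C = ⟦ constantSeries A ⟧
    module C = RingHom (constantSeries A)
    module res = RingHom O.toResidueField
    open Exp K.semiring using (_^_)
    Φ : RingHom (powerSeriesRing A) K
    Φ = composeHom {B = laurentSeriesRing A} {C = K} (toLaurentSeries A) F
    module Φ = RingHom Φ
    t : B.Carrier
    t = seriesVariable A

    Φ-inO : ∀ f {x} → ⟦ Φ ⟧ f K.≈ x → O.mem x
    Φ-inO f e = Subring.mem-resp O.subring e (into f)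

    Φ-power : ∀ m → ⟦ Φ ⟧ (t^ m) K.≈ ⟦ Φ ⟧ t ^ m
    Φ-power zero = Φ.1#-homo
    Φ-power (suc m) = K.trans (Φ.*-homo t (t^ m)) (K.*-congˡ (Φ-power m))

    residue-cong : ∀ {x y} (p : O.mem x) (q : O.mem y) → x K.≈ y → (x , p) k₁.≈ (y , q)
    residue-cong {x} {y} p q = res.⟦⟧-cong {x , p} {y , q}

    F̄-constant : ∀ a → F̄ a k₁.≈ (⟦ Φ ⟧ (C a) , into (C a))
    F̄-constant a = F̄-residue (C a)

    power-* : ∀ m f → ⟦ Φ ⟧ t ^ m K.* ⟦ F ⟧ f K.≈ ⟦ F ⟧ (toL (t^ m) L.* f)
    power-* m f = K.trans (K.*-congʳ (K.sym (Φ-power m))) (K.sym (F.*-homo (toL (t^ m)) f))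

    -- The inverse of the constant a in the field A((t)) is some t⁻ᵐx, and comparing coefficients of
    -- tᵐ in ax = tᵐ shows that its constant term x m inverts a.
    coefficient-invertible : ∀ a → ¬ a A.≈ A.0# → ∃ λ b → a A.* b A.≈ A.1#
    coefficient-invertible a a≉0 = x m , (begin
      a A.* x m                          ≈⟨ constant-* a x m ⟨
      (C a B.* x) m                      ≈⟨ B.*-identityˡ (C a B.* x) m ⟨
      shifted 0 (C a B.* x) m            ≈⟨ fraction-cancel {C a B.* x} {B.1#} {m} {0} Ca*f≈1 m ⟩
      shifted m B.1# m                   ≡⟨ ≡.cong (shifted m B.1#) (ℕ.+-identityʳ m) ⟨
      shifted m B.1# (m ℕ.+ 0)           ≈⟨ shifted-+ m B.1# 0 ⟩
      A.1#                               ∎)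
      where
      open ≈-Reasoning A.setoid
      Ca≉0 : ¬ ⟦ Φ ⟧ (C a) K.≈ K.0#
      Ca≉0 e = a≉0 (A.trans (A.sym (B.*-identityˡ (C a) 0)) (A.trans
        (fraction-cancel {C a} {B.0#} {0} {0} (injective (toL (C a)) L.0# (K.trans e (K.sym F.0#-homo))) 0)
        (B.*-identityˡ B.0# 0)))
      inverse = IsField.invertible FK (⟦ Φ ⟧ (C a)) Ca≉0
      f = proj₁ (surjective (proj₁ inverse))
      x = proj₁ f
      m = proj₂ f
      Ca*f≈1 : (toL (C a) L.* f) L.≈ L.1#
      Ca*f≈1 = injective (toL (C a) L.* f) L.1# (K.trans (F.*-homo (toL (C a)) f)
        (K.trans (K.*-congˡ (proj₂ (surjective (proj₁ inverse)))) (K.trans (proj₂ inverse) (K.sym F.1#-homo))))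

    -- A nonzero a is invertible, so its constant series maps to a unit of O, whose residue class is
    -- not 0.
    F̄-kernel : ∀ a → F̄ a k₁.≈ k₁.0# → a A.≈ A.0#
    F̄-kernel a e = decidable-stable em λ a≉0 →
      let (b , ab≈1) = coefficient-invertible a a≉0 in
      Submodule.mem-resp O.maximalIdeal {z 𝒪.- 𝒪.0#} {z} minus-zero (k₁.trans {z} {F̄ a} {k₁.0#} (k₁.sym {F̄ a} {z} (F̄-constant a)) e)
        ((⟦ Φ ⟧ (C b) , into (C b)) , K.trans (K.sym (Φ.*-homo (C a) (C b)))
          (K.trans (Φ.⟦⟧-cong (B.trans {C a B.* C b} {C (a A.* b)} {B.1#} (B.sym {C (a A.* b)} {C a B.* C b} (C.*-homo a b)) (C.⟦⟧-cong ab≈1))) Φ.1#-homo))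
      where
      z : 𝒪.Carrier
      z = ⟦ Φ ⟧ (C a) , into (C a)
      minus-zero : (z 𝒪.- 𝒪.0#) 𝒪.≈ z
      minus-zero = ModuleProperties.minus-zero K (regular K) (proj₁ z)

  -- If the image of f lies in the maximal ideal, then F̄ (f 0) = 0, so f 0 = 0 and t divides f.
  uniformizer : Uniformizer O
  uniformizer = record
    { π = ⟦ Φ ⟧ t
    ; π⁻¹ = ⟦ F ⟧ (t⁻^ 1)
    ; π*π⁻¹ = t*t⁻¹
    ; π∈O = into t
    ; absorb = λ a → let (f , e) = surjective a in proj₂ f , Φ-inO (proj₁ f) (K.sym
        (K.trans (K.*-congˡ (K.sym e)) (K.trans (power-* (proj₂ f) f)
          (F.⟦⟧-cong {toL (t^ (proj₂ f)) L.* f} {toL (proj₁ f)} (fraction-≈ {t^ (proj₂ f) B.* proj₁ f} {proj₁ f} {proj₂ f} {0} (B.*-identityˡ (shifted (proj₂ f) (proj₁ f))))))))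
    ; uniformizes = λ (x , p) x∈𝔪 → let (f , e) = onto x p in
        Φ-inO (f ∘ suc) (K.sym (K.trans (K.*-congˡ (K.trans (K.sym e) (divided f (F̄-kernel (f 0)
            (k₁.trans {F̄ (f 0)} {⟦ Φ ⟧ f , into f} {k₁.0#} (F̄-residue f)
              (k₁.trans {⟦ Φ ⟧ f , into f} {x , p} {k₁.0#} (residue-cong (into f) p e) (vanishes x p x∈𝔪)))))))
          (ModuleProperties.*-cancel K (regular K) (K.trans (K.*-comm _ _) t*t⁻¹) _)))
    }
    where
    t*t⁻¹ : ⟦ Φ ⟧ t K.* ⟦ F ⟧ (t⁻^ 1) K.≈ K.1#
    t*t⁻¹ = K.trans (K.sym (F.*-homo (toL t) (t⁻^ 1))) (K.trans (F.⟦⟧-cong {toL t L.* t⁻^ 1} {L.1#}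
      (fraction-≈ {t B.* B.1#} {B.1#} {1} {0} (B.trans {shifted 0 (t B.* B.1#)} {t B.* B.1#} {shifted 1 B.1#} (B.*-identityˡ (t B.* B.1#))
        (B.sym {shifted 1 B.1#} {t B.* B.1#} (B.*-identityʳ (t B.* B.1#)))))) F.1#-homo)
    divided : ∀ f → f 0 A.≈ A.0# → ⟦ Φ ⟧ f K.≈ ⟦ Φ ⟧ t K.* ⟦ Φ ⟧ (f ∘ suc)
    divided f f0≈0 = K.trans (Φ.⟦⟧-cong {f} {t B.* (f ∘ suc)} λ
      { zero → A.trans f0≈0 (A.sym (t*-zero (f ∘ suc))) ; (suc j) → A.sym (t*-suc (f ∘ suc) j) })
      (Φ.*-homo t (f ∘ suc))
    vanishes : ∀ x p → mem O.maximalIdeal (x , p) → (x , p) k₁.≈ k₁.0#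
    vanishes x p q = Submodule.mem-resp O.maximalIdeal {x , p} {(x , p) 𝒪.- 𝒪.0#}
      (K.sym (ModuleProperties.minus-zero K (regular K) x)) q

  private
    image : Stable (laurentSeriesRing A) (⟦ constantLaurent A ⟧ ∘ ⟦ κ ⟧) → Submodule (restrictScalars (IntegralHom.hom ι) (regular K))
    image N = record
      { mem = λ y → ∃ λ x → x ∈ˢ N × ⟦ F ⟧ x K.≈ y
      ; mem-resp = λ e (x , p , q) → x , p , K.trans q e
      ; mem-+ = λ (x , p , q) (x′ , p′ , q′) → x L.+ x′ , N.mem-+ p p′ , K.trans (F.+-homo x x′) (K.+-cong q q′)
      ; mem-0 = L.0# , N.mem-0 , F.0#-homo
      ; mem-* = λ c (x , p , q) → ⟦ constantLaurent A ⟧ (⟦ κ ⟧ c) L.* x , N.mem-* c p ,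
          K.trans (F.*-homo (⟦ constantLaurent A ⟧ (⟦ κ ⟧ c)) x) (K.*-cong (𝕜-homomorphism c) q)
      }
      where module N = Stable N

  adapted : AdaptedTopology (IntegralHom.hom ι) τ O uniformizer
  adapted = record
    { linearRing = linear
    ; adic = λ N → let module N = OpenSubmodule N
                       (m , p) = adic (N.mem ∘ ⟦ F ⟧) (continuous N.mem N.isOpen) (N.mem-resp (K.sym F.0#-homo) N.mem-0) in
        m , λ {a} a∈O → let (f , e) = onto a a∈O in
          N.mem-resp (K.trans (Φ.*-homo (t^ m) f) (K.*-cong (Φ-power m) e)) (p f)
    ; separates = λ c → let (W , p) = separation (λ m → proj₁ (surjective (c m))) in
        record { submodule = image (principalPart W) ; isOpen = opens (principalPart W) (principalPart-op W) } ,
        λ m (x , q , e) → let (f , Ff≈c) = surjective (c m)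
                              (h , r) = p m (Stable.mem-resp (principalPart W) {x} {f} (injective x f (K.trans e (K.sym Ff≈c))) q) in
          Φ-inO h (K.sym (K.trans (K.*-congˡ (K.sym Ff≈c)) (K.trans (power-* m f) (F.⟦⟧-cong {toL (t^ m) L.* f} {toL h} r))))
    }

  F̄-hom : RingHom A O.residueField
  F̄-hom = mkRingHom A O.residueField F̄
      (λ {x} {y} e → via x y (residue-cong (into (C x)) (into (C y)) (Φ.⟦⟧-cong (C.⟦⟧-cong e))))
      (λ x y → k₁.trans {F̄ (x A.+ y)} {Ψ (x A.+ y)} {F̄ x k₁.+ F̄ y} (F̄-constant (x A.+ y))
        (k₁.trans {Ψ (x A.+ y)} {Ψ x k₁.+ Ψ y} {F̄ x k₁.+ F̄ y}
          (residue-cong (proj₂ (Ψ (x A.+ y))) (proj₂ (Ψ x 𝒪.+ Ψ y)) (K.trans (Φ.⟦⟧-cong (C.+-homo x y)) (Φ.+-homo (C x) (C y))))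
          (k₁.sym {F̄ x k₁.+ F̄ y} {Ψ x k₁.+ Ψ y} (k₁.+-cong {F̄ x} {Ψ x} {F̄ y} {Ψ y} (F̄-constant x) (F̄-constant y)))))
      (λ x y → k₁.trans {F̄ (x A.* y)} {Ψ (x A.* y)} {F̄ x k₁.* F̄ y} (F̄-constant (x A.* y))
        (k₁.trans {Ψ (x A.* y)} {Ψ x k₁.* Ψ y} {F̄ x k₁.* F̄ y}
          (residue-cong (proj₂ (Ψ (x A.* y))) (proj₂ (Ψ x 𝒪.* Ψ y)) (K.trans (Φ.⟦⟧-cong (C.*-homo x y)) (Φ.*-homo (C x) (C y))))
          (k₁.sym {F̄ x k₁.* F̄ y} {Ψ x k₁.* Ψ y} (k₁.*-cong {F̄ x} {Ψ x} {F̄ y} {Ψ y} (F̄-constant x) (F̄-constant y)))))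
      (k₁.trans {F̄ A.0#} {Ψ A.0#} {k₁.0#} (F̄-constant A.0#)
        (residue-cong (proj₂ (Ψ A.0#)) (proj₂ 𝒪.0#) (K.trans (Φ.⟦⟧-cong C.0#-homo) Φ.0#-homo)))
      (k₁.trans {F̄ A.1#} {Ψ A.1#} {k₁.1#} (F̄-constant A.1#)
        (residue-cong (proj₂ (Ψ A.1#)) (proj₂ 𝒪.1#) (K.trans (Φ.⟦⟧-cong C.1#-homo) Φ.1#-homo)))
      (λ x → k₁.trans {F̄ (A.- x)} {Ψ (A.- x)} {k₁.- F̄ x} (F̄-constant (A.- x))
        (k₁.trans {Ψ (A.- x)} {k₁.- Ψ x} {k₁.- F̄ x}
          (residue-cong (proj₂ (Ψ (A.- x))) (proj₂ (𝒪.- Ψ x)) (K.trans (Φ.⟦⟧-cong (C.-‿homo x)) (Φ.-‿homo (C x))))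
          (k₁.sym {k₁.- F̄ x} {k₁.- Ψ x} (k₁.-‿cong {F̄ x} {Ψ x} (F̄-constant x)))))
    where
    Ψ : A.Carrier → k₁.Carrier
    Ψ a = ⟦ Φ ⟧ (C a) , into (C a)
    via : ∀ x y → Ψ x k₁.≈ Ψ y → F̄ x k₁.≈ F̄ y
    via x y e = k₁.trans {F̄ x} {Ψ x} {F̄ y} (F̄-constant x) (k₁.trans {Ψ x} {Ψ y} {F̄ y} e (k₁.sym {F̄ y} {Ψ y} (F̄-constant y)))

  F̄-injective : ∀ x y → F̄ x k₁.≈ F̄ y → x A.≈ y
  F̄-injective x y e = GroupProperties.x∙y⁻¹≈ε⇒x≈y A.+-group x y (F̄-kernel (x A.- y)
    (k₁.trans {F̄ (x A.- y)} {F̄ x k₁.+ F̄ (A.- y)} {k₁.0#} (F̄.+-homo x (A.- y))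
      (k₁.trans {F̄ x k₁.+ F̄ (A.- y)} {F̄ y k₁.- F̄ y} {k₁.0#} (k₁.+-cong {F̄ x} {F̄ y} {F̄ (A.- y)} {k₁.- F̄ y} e (F̄.-‿homo y))
        (k₁.-‿inverseʳ (F̄ y)))))
    where module F̄ = RingHom F̄-hom

  F̄-surjective : ∀ y → ∃ λ x → F̄ x k₁.≈ y
  F̄-surjective (y , p) = let (f , e) = onto y p in f 0 ,
    k₁.trans {F̄ (f 0)} {⟦ Φ ⟧ f , into f} {y , p} (F̄-residue f) (residue-cong (into f) p e)

  F̄-𝕜-homomorphism : ∀ c → F̄ (⟦ κ ⟧ c) k₁.≈ ⟦ IntegralHom.hom (residueHom O ι) ⟧ c
  F̄-𝕜-homomorphism c = k₁.trans {F̄ (⟦ κ ⟧ c)} {⟦ Φ ⟧ (C (⟦ κ ⟧ c)) , into (C (⟦ κ ⟧ c))} {⟦ IntegralHom.hom (residueHom O ι) ⟧ c}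
    (F̄-constant (⟦ κ ⟧ c)) (residue-cong (into (C (⟦ κ ⟧ c))) (proj₂ (⟦ toO₁ O ι ⟧ c)) (𝕜-homomorphism c))

  F̄-continuous : Continuous τA (residueTopology O τ) F̄
  F̄-continuous V (r , V′ , v , (V⊆V′ , V′⊆V)) = Topology.Open-≐ τA
    ((λ {a} p → r {⟦ Φ ⟧ (C a) , into (C a)} {F̄ a} (k₁.sym {F̄ a} {⟦ Φ ⟧ (C a) , into (C a)} (F̄-constant a)) (V′⊆V p)) ,
      λ {a} p → V⊆V′ (r {F̄ a} {⟦ Φ ⟧ (C a) , into (C a)} (F̄-constant a) p))
    (constants-continuous (V′ ∘ ⟦ F ⟧) (continuous V′ v))

  -- W imposes N on the coefficient of t⁰ and nothing on poles, so inside A[[t]] the condition reads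
  -- f 0 ∈ N, which is a condition on the residue class.
  F̄-opens : ∀ N → OpenFamily.Op family N → Open (residueTopology O τ) (λ y → ∃ λ a → a ∈ˢ N × F̄ a k₁.≈ y)
  F̄-opens N o = (λ {x} {y} e (a , p , q) → a , p , k₁.trans {F̄ a} {x} {y} q e) ,
      _ , opens (principalPart W) (principalPart-op W) ,
      ( (λ {(y , y∈O)} (a , p , q) → let (f , e) = onto y y∈O in toL f ,
          (λ { zero zero _ → Stable.mem-resp N {a} {f 0} (A.sym (F̄-injective (f 0) a
                 (k₁.trans {F̄ (f 0)} {y , y∈O} {F̄ a} (k₁.trans {F̄ (f 0)} {⟦ Φ ⟧ f , into f} {y , y∈O} (F̄-residue f) (residue-cong (into f) y∈O e))
                   (k₁.sym {F̄ a} {y , y∈O} q)))) p }) , e)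
      , λ {(y , y∈O)} (b , p , q) → let (f , e) = onto y y∈O in f 0 ,
          Stable.mem-resp (principalPart W) {b} {toL f} (injective b (toL f) (K.trans q (K.sym e))) p 0 0 ≡.refl ,
          k₁.trans {F̄ (f 0)} {⟦ Φ ⟧ f , into f} {y , y∈O} (F̄-residue f) (residue-cong (into f) y∈O e))
    where
    W : ℕ → Σ (Stable A ⟦ κ ⟧) (OpenFamily.Op family)
    W zero = N , o
    W (suc _) = wholeᴼ

module _ (em : ExcludedMiddle ℓ) {𝕜 𝕜′ : CRing ℓ} (κ : RingHom 𝕜 𝕜′) where

  adaptedTopologies : ∀ {n} {K : CRing ℓ} (lf : LocalField n K) (ι : IntegralHom 𝕜 lf) (τ : TopologyOn K) →
    LinearRing (IntegralHom.hom ι) τ → Coordinates em lf ι τ κ → Σ (Uniformizers lf) (AdaptedTopologies lf ι τ)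
  adaptedTopologies (dim0 _) ι τ linear coords = tt , tt
  adaptedTopologies {n = suc n} (step FK O lf) ι τ linear coords =
    (S.uniformizer , proj₁ rec) , (S.adapted , proj₂ rec)
    where
    open Coordinates coords
    module S = LaurentStep em {A = iteratedLaurent n 𝕜′} O {lf} ι τ linear
      (iteratedHom κ n) (proj₁ isIterated)
      (openFamily em κ n (proj₁ isIterated) (proj₁ (proj₂ isIterated)))
      τS (proj₂ (proj₂ isIterated)) F injective surjective 𝕜-homomorphism continuous opens
      (proj₁ respectsValuations) (proj₁ (proj₂ respectsValuations))
      (proj₁ (proj₂ (proj₂ respectsValuations))) (proj₁ (proj₂ (proj₂ (proj₂ respectsValuations))))
    rec = adaptedTopologies lf (residueHom O ι) (residueTopology O τ) (residueLinearRing O {lf} {ι} {τ} linear) record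
      { F = S.F̄-hom
      ; injective = S.F̄-injective
      ; surjective = S.F̄-surjective
      ; 𝕜-homomorphism = S.F̄-𝕜-homomorphism
      ; τS = proj₁ isIterated
      ; isIterated = proj₁ (proj₂ isIterated)
      ; continuous = S.F̄-continuous
      ; opens = S.F̄-opens
      ; respectsValuations = proj₂ (proj₂ (proj₂ (proj₂ respectsValuations)))
      }

-- The comparison on K itself and the equality of the operators

regularComparison : {𝕜 K : CRing ℓ} (κ : RingHom 𝕜 K) (τ : TopologyOn K) → Comparison κ τ (regular K) (regular K)
regularComparison {K = K} κ τ = record
  { structures = record
    { to = λ x → x
    ; from = λ x → x
    ; to-cong = λ e → e
    ; from-cong = λ e → e
    ; to-+ = λ _ _ → refl
    ; from-+ = λ _ _ → refl
    ; to-from = λ _ → refl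
    ; from-to = λ _ → refl
    ; commute = ModuleProperties.*-comm-* K (regular K)
    }
  ; finite = regular-finite
  ; finite′ = regular-finite
  -- Both structures are the multiplication of K, so all differences vanish; the liftings enter only
  -- on the lattice quotients.
  ; nilpotent = λ x → 1 , λ a → -‿inverseʳ (a * x)
  ; fine-to = λ _ _ U-open → U-open
  ; fine-from = λ _ _ U-open → U-open
  }
  where
  open CommutativeRing K
  regular-finite : IsFiniteModule (regular K)
  regular-finite = 1 , (λ _ → 1#) , λ x → (λ _ → x) , sym (trans (+-identityʳ _) (*-identityʳ x))

theorem0p1 : (∀ a → ExcludedMiddle a) →
    ∀ {ℓ : Level} (𝕜 : CRing ℓ) → IsField 𝕜 → IsPerfect 𝕜 →
    (n : ℕ) (K : TLF 𝕜 n) (σ σ′ : SystemOfLiftings K) →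
    (E K σ ≐ E K σ′) ×
    (∀ (i : Fin n) (j : Fin 2) → Eᵢⱼ K i j σ ≐ Eᵢⱼ K i j σ′)
theorem0p1 em {ℓ} 𝕜 _ _ n K σ σ′ =
  ((λ {φ} → Transfer.bt (transfer σ σ′ φ)) , λ {φ} → Transfer.bt (transfer σ′ σ φ)) ,
  λ i j → (λ {φ} → Transfer.btᵢⱼ (transfer σ σ′ φ) i j) , λ {φ} → Transfer.btᵢⱼ (transfer σ′ σ φ) i j
  where
  open TLF K
  K₀ = underlyingField
  topologies : Σ (Uniformizers localField) (AdaptedTopologies localField structure topology)
  topologies = adaptedTopologies (em ℓ) (lastResidueHom localField structure) localField structure topology
    (linearRing-of-ST isSTRing) (coordinates (em ℓ) parametrization)
  transfer : (σ σ′ : SystemOfLiftings K) (φ : Endₖ K) →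
    Transfer {lf = localField} {ι = structure} {τ = topology} σ σ′
      {regular K₀} {regular K₀} {regular K₀} {regular K₀} φ φ
  transfer σ σ′ φ = comparison-transfer (em ℓ) localField structure topology (proj₁ topologies) (proj₂ topologies) σ σ′
    {regular K₀} {regular K₀} {regular K₀} {regular K₀}
    (regularComparison (IntegralHom.hom structure) topology) (regularComparison (IntegralHom.hom structure) topology)
    φ φ (λ _ → CommutativeRing.refl K₀)
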